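{- Let $n$ be a positive integer coprime with $6$. Then, for indeterminates $a$ and $q$, modulo $[n](1-aq^n)(a-q^n)$, $$ \sum_{k=0}^{n-1}\frac{(aq;q^2)_k (q/a;q^2)_k (q;q^2)_{2k}}{(q^2;q^2)_{2k}(aq^6;q^6)_k (q^6/a;q^6)_k }[8k+1]q^{2k^2} \equiv q^{ -(n-1)/2}[n]\biggl(\frac{ -3}{n}\biggr). $$
   Context: $(x;q)_k=\prod_{j=0}^{k-1}(1-xq^j)$ for integers $k\ge0$; $[n]=[n]_q=(1-q^n)/(1-q)$; $\bigl(\frac{ -3}{n}\bigr)$ is the Jacobi--Kronecker symbol. Congruence convention: for polynomials $A_1,A_2,P$, $A_1/A_2\equiv0\pmod{P}$ means $P$ divides $A_1$ and $P$ is coprime with $A_2$; for rational functions $A,B$, $A\equiv B\pmod P$ means $A-B\equiv0\pmod P$. -}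

module Defs where

open import Data.Nat as ℕ using (ℕ; zero; suc)
open import Data.Nat.DivMod using (_/_)
open import Data.Nat.Divisibility using (_∣?_)
open import Data.Integer as ℤ using (ℤ; +_; -_)
open import Data.List using (List; []; _∷_; map; upTo)
open import Data.Bool.ListAction using (any)
open import Data.Bool using (Bool; true; false; if_then_else_)
open import Data.Product using (Σ; _×_; ∃; ∃-syntax)
open import Relation.Nullary using (¬_; does)
open import Relation.Binary.PropositionalEquality using (_≡_)

-- Univariate integer polynomials (in q): coefficient lists, lowest first.

Poly1 : Set
Poly1 = List ℤ

add1 : Poly1 → Poly1 → Poly1
add1 [] r = r
add1 (x ∷ p) [] = x ∷ p
add1 (x ∷ p) (y ∷ r) = (x ℤ.+ y) ∷ add1 p r

neg1 : Poly1 → Poly1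
neg1 = map (-_)

mul1 : Poly1 → Poly1 → Poly1
mul1 [] r = []
mul1 (x ∷ p) r = add1 (map (x ℤ.*_) r) (+ 0 ∷ mul1 p r)

coeff1 : Poly1 → ℕ → ℤ
coeff1 [] _ = + 0
coeff1 (x ∷ p) zero = x
coeff1 (x ∷ p) (suc j) = coeff1 p j

-- Bivariate integer polynomials ℤ[a,q]: list (indexed by the power of a)
-- of polynomials in q.

Poly : Set
Poly = List Poly1

_⊕_ : Poly → Poly → Poly
[] ⊕ r = r
(x ∷ p) ⊕ [] = x ∷ p
(x ∷ p) ⊕ (y ∷ r) = add1 x y ∷ (p ⊕ r)

⊖_ : Poly → Poly
⊖ p = map neg1 p

_⊝_ : Poly → Poly → Poly
p ⊝ r = p ⊕ (⊖ r)

_⊛_ : Poly → Poly → Poly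
[] ⊛ r = []
(c ∷ p) ⊛ r = map (mul1 c) r ⊕ ([] ∷ (p ⊛ r))

coeff : Poly → ℕ → ℕ → ℤ
coeff [] _ _ = + 0
coeff (c ∷ p) zero j = coeff1 c j
coeff (c ∷ p) (suc i) j = coeff p i j

_≈_ : Poly → Poly → Set
P ≈ Q = ∀ i j → coeff P i j ≡ coeff Q i j

cst : ℤ → Poly
cst c = (c ∷ []) ∷ []

𝟘 𝟙 A Q : Poly
𝟘 = []
𝟙 = cst (+ 1)
A = [] ∷ ((+ 1 ∷ []) ∷ [])
Q = (+ 0 ∷ + 1 ∷ []) ∷ []

_^ᴾ_ : Poly → ℕ → Poly
P ^ᴾ zero = 𝟙
P ^ᴾ suc k = P ⊛ (P ^ᴾ k)

qint : ℕ → Poly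
qint zero = 𝟘
qint (suc m) = 𝟙 ⊕ (Q ⊛ qint m)

_∣ᴾ_ : Poly → Poly → Set
P ∣ᴾ N = ∃[ C ] (P ⊛ C) ≈ N

IsUnitᴾ : Poly → Set
IsUnitᴾ U = ∃[ V ] (U ⊛ V) ≈ 𝟙

CoprimeᴾP : Poly → Poly → Set
CoprimeᴾP P D = ∀ C → C ∣ᴾ P → C ∣ᴾ D → IsUnitᴾ C

record Frac : Set where
  constructor _⁄_
  field
    num : Poly
    den : Poly
open Frac public

infixl 6 _+F_ _-F_
infixl 7 _*F_ _÷F_

_+F_ : Frac → Frac → Frac
(n₁ ⁄ d₁) +F (n₂ ⁄ d₂) = ((n₁ ⊛ d₂) ⊕ (n₂ ⊛ d₁)) ⁄ (d₁ ⊛ d₂)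

_-F_ : Frac → Frac → Frac
(n₁ ⁄ d₁) -F (n₂ ⁄ d₂) = ((n₁ ⊛ d₂) ⊝ (n₂ ⊛ d₁)) ⁄ (d₁ ⊛ d₂)

_*F_ : Frac → Frac → Frac
(n₁ ⁄ d₁) *F (n₂ ⁄ d₂) = (n₁ ⊛ n₂) ⁄ (d₁ ⊛ d₂)

_÷F_ : Frac → Frac → Frac
(n₁ ⁄ d₁) ÷F (n₂ ⁄ d₂) = (n₁ ⊛ d₂) ⁄ (d₁ ⊛ n₂)

poly : Poly → Frac
poly P = P ⁄ 𝟙

1F : Frac
1F = poly 𝟙

_^F_ : Frac → ℕ → Frac
x ^F zero = 1F
x ^F suc k = x *F (x ^F k)

poch : Frac → Frac → ℕ → Frac
poch x y zero = 1F
poch x y (suc k) = poch x y k *F (1F -F (x *F (y ^F k)))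

sumF : ℕ → (ℕ → Frac) → Frac
sumF zero f = poly 𝟘
sumF (suc n) f = sumF n f +F f n

ZeroMod : Frac → Poly → Set
ZeroMod F P = ∃[ N ] ∃[ D ] (¬ (D ≈ 𝟘) × (N ⊛ den F) ≈ (D ⊛ num F) × P ∣ᴾ N × CoprimeᴾP P D)

CongMod : Frac → Frac → Poly → Set
CongMod F G P = ZeroMod (F -F G) P

legendre-3 : ℕ → ℤ
legendre-3 p =
  if does (p ∣? 3) then + 0
  else if any (λ x → does (p ∣? (x ℕ.* x ℕ.+ 3))) (upTo p) then + 1
  else - (+ 1)

findDiv : ℕ → ℕ → ℕ → ℕ
findDiv zero d n = n
findDiv (suc f) d n = if does (d ∣? n) then d else findDiv f (suc d) n

spf : ℕ → ℕ
spf n = findDiv n 2 n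

jac : ℕ → ℕ → ℤ
jac zero _ = + 1
jac (suc f) zero = + 0
jac (suc f) (suc zero) = + 1
jac (suc f) (suc (suc m)) with spf (suc (suc m))
... | zero = + 0
... | suc p = legendre-3 (suc p) ℤ.* jac f (suc (suc m) / suc p)

jacobi-3 : ℕ → ℤ
jacobi-3 n = jac n n

aF qF : Frac
aF = poly A
qF = poly Q

qpowF : ℕ → Frac
qpowF m = poly (Q ^ᴾ m)

term5 : ℕ → Frac
term5 k =
  ((poch (aF *F qF) (qpowF 2) k *F poch (qF ÷F aF) (qpowF 2) k *F poch qF (qpowF 2) (2 ℕ.* k))
   ÷F (poch (qpowF 2) (qpowF 2) (2 ℕ.* k) *F poch (aF *F qpowF 6) (qpowF 6) k
        *F poch (qpowF 6 ÷F aF) (qpowF 6) k))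
  *F poly (qint (8 ℕ.* k ℕ.+ 1)) *F qpowF (2 ℕ.* k ℕ.* k)

lhs5 : ℕ → Frac
lhs5 n = sumF n term5

-- q^{-(n-1)/2} [n] (-3/n); for odd n, (n-1)/2 = ⌊n/2⌋
rhs5 : ℕ → Frac
rhs5 n = (cst (jacobi-3 n) ⊛ qint n) ⁄ (Q ^ᴾ (n / 2))

modulus5 : ℕ → Poly
modulus5 n = qint n ⊛ ((𝟙 ⊝ (A ⊛ (Q ^ᴾ n))) ⊛ (A ⊝ (Q ^ᴾ n)))

{-# OPTIONS --safe #-}

-- For odd m the specialisation a = qᵐ terminates, and a Wilf–Zeilberger certificate for a ↦ a q⁶ gives its value
-- q^{-(m-1)/2} [m] χ(m), provided at least (m+1)/2 terms are summed.  The n-term sum can therefore be evaluated at the n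
-- points m = 1, 3, …, 2n-1.  After multiplication by D(a) = ∏_{0<j<n} (1 - a q⁶ʲ)(a - q⁶ʲ) it becomes a form of degree
-- n - 1 in (a , 1 + a²), which Lagrange interpolation recovers from these n values.  Subtracting q^{-(n-1)/2} [n] χ(n) D(a)
-- makes it vanish at m = n, so every remaining summand contains (1 - a qⁿ)(a - qⁿ).  The coefficients are divisible by [n]
-- away from denominators coprime to [n]: up to such factors 1 - qʷ depends on gcd(w , n) only, and the products over the
-- interpolation points become products over complete residue systems modulo n.  No root of unity is needed.

module Submission where

-- The shift is by q⁶ because the denominators then move by one place and the numerators, whose
-- exponents advance by 2, by three. It takes m to m + 6 without changing the sign χ, so m = 1, 3, 5
-- are the initial values. The cleared sum is invariant under a ↦ 1/a up to a power of a. This is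
-- why (a , 1 + a²) are the right variables and why n points determine a polynomial of degree 2n - 2
-- in a. Coprimality with 6 is used in the residue count: 2 and 6 are invertible modulo n. Oddness
-- also puts m = n among the points, at index (n - 1)/2. At the point m the sum is χ(m) [m] up to a
-- power of q, while the interpolation coefficient is (1 - qⁿ)/(1 - q^gcd(m,n)) up to harmless
-- factors; their product supplies [n]. The second obstacle is the meaning of the congruence: the
-- denominator has to be coprime with the modulus in ℤ[a , q], where Bézout identities hold only up
-- to a positive integer. An integer common factor is excluded in the end because [n] has constant
-- term 1.

open import Level using (0ℓ)
open import Algebra.Bundles using (CommutativeRing)
open import Data.Bool using (Bool; true; false; if_then_else_)
open import Data.Empty using (⊥; ⊥-elim)
open import Data.Fin using (Fin; zero; suc)
open import Data.Integer as ℤ using (ℤ; +_; -[1+_])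
import Data.Integer.Properties as ℤ
open import Data.List using (List; []; _∷_; map)
open import Data.Nat as ℕ using (ℕ; zero; suc; z≤n; s≤s)
import Data.Nat.Properties as ℕ
open import Data.Product using (_×_; _,_; proj₁; proj₂; ∃-syntax; Σ-syntax)
open import Data.Sum as Sum using (_⊎_; inj₁; inj₂)
open import Data.Vec as Vec using (Vec; []; _∷_)
open import Function using (_∘_)
open import Relation.Nullary using (¬_; Dec; does; yes; no)
import Relation.Nullary.Decidable as Dec
open import Relation.Binary using (Tri; tri<; tri≈; tri>)
open import Data.Nat.Coprimality using (Coprime; coprime-Bézout; coprime-divisor)
open import Data.Nat.GCD using (gcd; module Bézout; gcd[m,n]∣m; gcd[m,n]∣n; gcd-greatest)
open import Data.Nat.Divisibility as ∣ using (_∣_; divides)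
open import Data.Nat.Tactic.RingSolver using () renaming (solve-∀ to ℕ-solve-∀)
open import Relation.Binary.PropositionalEquality as ≡ using (_≡_; _≢_)

-- Ring identities are decided by comparing sparse polynomials with integer coefficients.
module RingTools (R : CommutativeRing 0ℓ 0ℓ) where

  open CommutativeRing R public hiding (zero)
  open import Algebra.Properties.Semiring.Exp semiring public
    using (_^_; ^-homo-*; ^-congˡ; ^-congʳ; ^-assocʳ)
  open import Algebra.Properties.Ring ring
    using (-‿distribˡ-*; -‿distribʳ-*; -‿involutive; -0#≈0#; -‿+-comm; x∙y⁻¹≈ε⇒x≈y)
  open import Relation.Binary.Reasoning.Setoid setoid public

  infix 8 :-_
  infixl 6 _:+_ _:-_
  infixl 7 _:*_
  infixr 8 _:^_
  infix 4 _:=_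

  -- The separate clause for 1 makes the literal 1 of the solver reduce to `1#` itself instead of
  -- `1# + 0#`, so that solved identities match the terms in which they are used.
  fromℕ : ℕ → Carrier
  fromℕ 0 = 0#
  fromℕ 1 = 1#
  fromℕ (suc (suc n)) = 1# + fromℕ (suc n)

  fromℕ-suc : ∀ n → fromℕ (suc n) ≈ 1# + fromℕ n
  fromℕ-suc zero = sym (+-identityʳ 1#)
  fromℕ-suc (suc n) = refl

  fromℕ-+ : ∀ m n → fromℕ (m ℕ.+ n) ≈ fromℕ m + fromℕ n
  fromℕ-+ zero n = sym (+-identityˡ _)
  fromℕ-+ (suc m) n = begin
    fromℕ (suc (m ℕ.+ n))  ≈⟨ fromℕ-suc (m ℕ.+ n) ⟩
    1# + fromℕ (m ℕ.+ n)  ≈⟨ +-congˡ (fromℕ-+ m n) ⟩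
    1# + (fromℕ m + fromℕ n)  ≈⟨ +-assoc _ _ _ ⟨
    1# + fromℕ m + fromℕ n  ≈⟨ +-congʳ (fromℕ-suc m) ⟨
    fromℕ (suc m) + fromℕ n  ∎

  fromℕ-* : ∀ m n → fromℕ (m ℕ.* n) ≈ fromℕ m * fromℕ n
  fromℕ-* zero n = sym (zeroˡ _)
  fromℕ-* (suc m) n = begin
    fromℕ (n ℕ.+ m ℕ.* n)  ≈⟨ fromℕ-+ n (m ℕ.* n) ⟩
    fromℕ n + fromℕ (m ℕ.* n)  ≈⟨ +-cong (sym (*-identityˡ _)) (fromℕ-* m n) ⟩
    1# * fromℕ n + fromℕ m * fromℕ n  ≈⟨ distribʳ _ _ _ ⟨
    (1# + fromℕ m) * fromℕ n  ≈⟨ *-congʳ (fromℕ-suc m) ⟨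
    fromℕ (suc m) * fromℕ n  ∎

  fromℤ : ℤ → Carrier
  fromℤ (+ n) = fromℕ n
  fromℤ -[1+ n ] = - fromℕ (suc n)

  fromℤ-⊖ : ∀ m n → fromℤ (m ℤ.⊖ n) ≈ fromℕ m + - fromℕ n
  fromℤ-⊖ m zero = sym (trans (+-congˡ -0#≈0#) (+-identityʳ _))
  fromℤ-⊖ zero (suc n) = sym (+-identityˡ _)
  fromℤ-⊖ (suc m) (suc n) = begin
    fromℤ (suc m ℤ.⊖ suc n)  ≈⟨ reflexive (≡.cong fromℤ (ℤ.[1+m]⊖[1+n]≡m⊖n m n)) ⟩
    fromℤ (m ℤ.⊖ n)  ≈⟨ fromℤ-⊖ m n ⟩
    fromℕ m + - fromℕ n  ≈⟨ +-congˡ (+-identityˡ _) ⟨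
    fromℕ m + (0# + - fromℕ n)  ≈⟨ +-congˡ (+-congʳ (-‿inverseʳ 1#)) ⟨
    fromℕ m + (1# + - 1# + - fromℕ n)  ≈⟨ +-congˡ (+-assoc _ _ _) ⟩
    fromℕ m + (1# + (- 1# + - fromℕ n))  ≈⟨ +-assoc _ _ _ ⟨
    fromℕ m + 1# + (- 1# + - fromℕ n)  ≈⟨ +-cong (trans (+-comm _ _) (sym (fromℕ-suc m))) (trans (-‿+-comm _ _) (-‿cong (sym (fromℕ-suc n)))) ⟩
    fromℕ (suc m) + - fromℕ (suc n)  ∎

  fromℤ-neg : ∀ i → fromℤ (ℤ.- i) ≈ - fromℤ i
  fromℤ-neg (+ zero) = sym -0#≈0#
  fromℤ-neg (+ suc n) = refl
  fromℤ-neg -[1+ n ] = sym (-‿involutive _)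

  fromℤ-+ : ∀ i j → fromℤ (i ℤ.+ j) ≈ fromℤ i + fromℤ j
  fromℤ-+ (+ m) (+ n) = fromℕ-+ m n
  fromℤ-+ (+ m) -[1+ n ] = fromℤ-⊖ m (suc n)
  fromℤ-+ -[1+ m ] (+ n) = trans (fromℤ-⊖ n (suc m)) (+-comm _ _)
  fromℤ-+ -[1+ m ] -[1+ n ] = begin
    - fromℕ (suc (suc (m ℕ.+ n)))  ≈⟨ -‿cong (reflexive (≡.cong fromℕ (≡.cong suc (≡.sym (ℕ.+-suc m n))))) ⟩
    - fromℕ (suc m ℕ.+ suc n)  ≈⟨ -‿cong (fromℕ-+ (suc m) (suc n)) ⟩
    - (fromℕ (suc m) + fromℕ (suc n))  ≈⟨ -‿+-comm _ _ ⟨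
    - fromℕ (suc m) + - fromℕ (suc n)  ∎

  fromℤ-* : ∀ i j → fromℤ (i ℤ.* j) ≈ fromℤ i * fromℤ j
  fromℤ-* (+ m) (+ n) = trans (reflexive (≡.cong fromℤ (≡.sym (ℤ.pos-* m n)))) (fromℕ-* m n)
  fromℤ-* (+ m) -[1+ n ] = begin
    fromℤ (+ m ℤ.* -[1+ n ])  ≈⟨ reflexive (≡.cong fromℤ (≡.sym (ℤ.neg-distribʳ-* (+ m) (+ suc n)))) ⟩
    fromℤ (ℤ.- (+ m ℤ.* + suc n))  ≈⟨ fromℤ-neg (+ m ℤ.* + suc n) ⟩
    - fromℤ (+ m ℤ.* + suc n)  ≈⟨ -‿cong (fromℤ-* (+ m) (+ suc n)) ⟩
    - (fromℕ m * fromℕ (suc n))  ≈⟨ -‿distribʳ-* _ _ ⟩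
    fromℕ m * - fromℕ (suc n)  ∎
  fromℤ-* -[1+ m ] (+ n) = begin
    fromℤ (-[1+ m ] ℤ.* + n)  ≈⟨ reflexive (≡.cong fromℤ (≡.sym (ℤ.neg-distribˡ-* (+ suc m) (+ n)))) ⟩
    fromℤ (ℤ.- (+ suc m ℤ.* + n))  ≈⟨ fromℤ-neg (+ suc m ℤ.* + n) ⟩
    - fromℤ (+ suc m ℤ.* + n)  ≈⟨ -‿cong (fromℤ-* (+ suc m) (+ n)) ⟩
    - (fromℕ (suc m) * fromℕ n)  ≈⟨ -‿distribˡ-* _ _ ⟩
    - fromℕ (suc m) * fromℕ n  ∎
  fromℤ-* -[1+ m ] -[1+ n ] = begin
    fromℕ (suc m ℕ.* suc n)  ≈⟨ fromℕ-* (suc m) (suc n) ⟩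
    fromℕ (suc m) * fromℕ (suc n)  ≈⟨ -‿involutive _ ⟨
    - - (fromℕ (suc m) * fromℕ (suc n))  ≈⟨ -‿cong (-‿distribʳ-* _ _) ⟩
    - (fromℕ (suc m) * - fromℕ (suc n))  ≈⟨ -‿distribˡ-* _ _ ⟩
    - fromℕ (suc m) * - fromℕ (suc n)  ∎

  -- Normal forms of ring expressions

  data Expr (n : ℕ) : Set where
    var       : Fin n → Expr n
    con       : ℤ → Expr n
    _:+_ _:*_ : Expr n → Expr n → Expr n
    :-_       : Expr n → Expr n
    _:^_      : Expr n → ℕ → Expr n

  _:-_ : ∀ {n} → Expr n → Expr n → Expr n
  x :- y = x :+ :- y

  :1 : ∀ {n} → Expr n
  :1 = con (+ 1)

  _:=_ : ∀ {n} → Expr n → Expr n → Expr n × Expr n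
  x := y = x , y

  ⟦_⟧ : ∀ {n} → Expr n → Vec Carrier n → Carrier
  ⟦ var i ⟧ ρ = Vec.lookup ρ i
  ⟦ con c ⟧ ρ = fromℤ c
  ⟦ x :+ y ⟧ ρ = ⟦ x ⟧ ρ + ⟦ y ⟧ ρ
  ⟦ x :* y ⟧ ρ = ⟦ x ⟧ ρ * ⟦ y ⟧ ρ
  ⟦ :- x ⟧ ρ = - ⟦ x ⟧ ρ
  ⟦ x :^ k ⟧ ρ = ⟦ x ⟧ ρ ^ k

  +-interchange : ∀ w x y z → (w + x) + (y + z) ≈ (w + y) + (x + z)
  +-interchange w x y z = begin
    (w + x) + (y + z)  ≈⟨ +-assoc _ _ _ ⟩
    w + (x + (y + z))  ≈⟨ +-congˡ (+-assoc _ _ _) ⟨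
    w + (x + y + z)  ≈⟨ +-congˡ (+-congʳ (+-comm _ _)) ⟩
    w + (y + x + z)  ≈⟨ +-congˡ (+-assoc _ _ _) ⟩
    w + (y + (x + z))  ≈⟨ +-assoc _ _ _ ⟨
    (w + y) + (x + z)  ∎

  *-interchange : ∀ w x y z → (w * x) * (y * z) ≈ (w * y) * (x * z)
  *-interchange w x y z = begin
    (w * x) * (y * z)  ≈⟨ *-assoc _ _ _ ⟩
    w * (x * (y * z))  ≈⟨ *-congˡ (*-assoc _ _ _) ⟨
    w * (x * y * z)  ≈⟨ *-congˡ (*-congʳ (*-comm _ _)) ⟩
    w * (y * x * z)  ≈⟨ *-congˡ (*-assoc _ _ _) ⟩
    w * (y * (x * z))  ≈⟨ *-assoc _ _ _ ⟨
    (w * y) * (x * z)  ∎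

  private

    Monomial : ℕ → Set
    Monomial n = Vec ℕ n

    Sparse : ℕ → Set
    Sparse n = List (ℤ × Monomial n)

    data Order {n} (m m′ : Monomial n) : Set where
      lt gt : Order m m′
      eq : m ≡ m′ → Order m m′

    -- Only the answer `eq` carries evidence. The other two merely steer `merge`, whose value is
    -- preserved whichever of them is given, so no law of orders has to be proved.
    order : ∀ {n} (m m′ : Monomial n) → Order m m′
    order [] [] = eq ≡.refl
    order (a ∷ m) (b ∷ m′) with a ℕ.<ᵇ b | b ℕ.<ᵇ a | a ℕ.≟ b | order m m′
    ... | true  | _     | _          | _ = lt
    ... | false | true  | _          | _ = gt
    ... | false | false | no _       | _ = lt
    ... | false | false | yes _      | lt = lt
    ... | false | false | yes _      | gt = gt
    ... | false | false | yes ≡.refl | eq ≡.refl = eq ≡.refl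

    -- Dropping zero coefficients makes cancelled terms disappear, so that a valid identity
    -- normalises to the literal `[]`.
    cons : ∀ {n} → ℤ → Monomial n → Sparse n → Sparse n
    cons (+ zero) m p = p
    cons c m p = (c , m) ∷ p

    merge : ∀ {n} → Sparse n → Sparse n → Sparse n
    merge [] q = q
    -- The inner recursion on the second list, with `x ∷ p` fixed, makes each recursive call
    -- structurally smaller.
    merge {n} (x ∷ p) = go
      where
      go : Sparse n → Sparse n
      go [] = x ∷ p
      go (y ∷ q) with order (proj₂ x) (proj₂ y)
      ... | lt = x ∷ merge p (y ∷ q)
      ... | gt = y ∷ go q
      ... | eq _ = cons (proj₁ x ℤ.+ proj₁ y) (proj₂ x) (merge p q)

    scale : ∀ {n} → ℤ → Monomial n → Sparse n → Sparse n
    scale c m = map λ y → c ℤ.* proj₁ y , Vec.zipWith ℕ._+_ m (proj₂ y)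

    product : ∀ {n} → Sparse n → Sparse n → Sparse n
    product [] q = []
    product (x ∷ p) q = merge (scale (proj₁ x) (proj₂ x) q) (product p q)

    power : ∀ {n} → Sparse n → ℕ → Sparse n
    power p zero = (+ 1 , Vec.replicate _ 0) ∷ []
    power p (suc k) = product p (power p k)

    unit : ∀ {n} → Fin n → Monomial n
    unit zero = 1 ∷ Vec.replicate _ 0
    unit (suc i) = 0 ∷ unit i

    normalise : ∀ {n} → Expr n → Sparse n
    normalise (var i) = (+ 1 , unit i) ∷ []
    normalise (con c) = cons c (Vec.replicate _ 0) []
    normalise (x :+ y) = merge (normalise x) (normalise y)
    normalise (x :* y) = product (normalise x) (normalise y)
    normalise (:- x) = scale (ℤ.- (+ 1)) (Vec.replicate _ 0) (normalise x)
    normalise (x :^ k) = power (normalise x) k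

    ⟦_⟧ₘ : ∀ {n} → Monomial n → Vec Carrier n → Carrier
    ⟦ [] ⟧ₘ [] = 1#
    ⟦ e ∷ m ⟧ₘ (x ∷ ρ) = x ^ e * ⟦ m ⟧ₘ ρ

    ⟦_⟧ₛ : ∀ {n} → Sparse n → Vec Carrier n → Carrier
    ⟦ [] ⟧ₛ ρ = 0#
    ⟦ (c , m) ∷ p ⟧ₛ ρ = fromℤ c * ⟦ m ⟧ₘ ρ + ⟦ p ⟧ₛ ρ

    ⟦cons⟧ : ∀ {n} c m (p : Sparse n) ρ → ⟦ cons c m p ⟧ₛ ρ ≈ fromℤ c * ⟦ m ⟧ₘ ρ + ⟦ p ⟧ₛ ρ
    ⟦cons⟧ (+ zero) m p ρ = sym (trans (+-congʳ (zeroˡ _)) (+-identityˡ _))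
    ⟦cons⟧ (+ suc _) m p ρ = refl
    ⟦cons⟧ -[1+ _ ] m p ρ = refl

    ⟦merge⟧ : ∀ {n} (p q : Sparse n) ρ → ⟦ merge p q ⟧ₛ ρ ≈ ⟦ p ⟧ₛ ρ + ⟦ q ⟧ₛ ρ
    ⟦merge⟧ [] q ρ = sym (+-identityˡ _)
    ⟦merge⟧ {n} ((c , m) ∷ p) q ρ = go q
      where
      go : ∀ q → ⟦ merge ((c , m) ∷ p) q ⟧ₛ ρ ≈ ⟦ (c , m) ∷ p ⟧ₛ ρ + ⟦ q ⟧ₛ ρ
      go [] = sym (+-identityʳ _)
      go ((d , m′) ∷ q) with order m m′
      ... | lt = trans (+-congˡ (⟦merge⟧ p ((d , m′) ∷ q) ρ)) (sym (+-assoc _ _ _))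
      ... | gt = begin
        y + ⟦ merge ((c , m) ∷ p) q ⟧ₛ ρ  ≈⟨ +-congˡ (go q) ⟩
        y + (x + ⟦ q ⟧ₛ ρ)  ≈⟨ +-assoc _ _ _ ⟨
        y + x + ⟦ q ⟧ₛ ρ  ≈⟨ +-congʳ (+-comm _ _) ⟩
        x + y + ⟦ q ⟧ₛ ρ  ≈⟨ +-assoc _ _ _ ⟩
        x + (y + ⟦ q ⟧ₛ ρ)  ∎
        where
        x = ⟦ (c , m) ∷ p ⟧ₛ ρ
        y = fromℤ d * ⟦ m′ ⟧ₘ ρ
      ... | eq ≡.refl = begin
        ⟦ cons (c ℤ.+ d) m (merge p q) ⟧ₛ ρ  ≈⟨ ⟦cons⟧ (c ℤ.+ d) m (merge p q) ρ ⟩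
        fromℤ (c ℤ.+ d) * x + ⟦ merge p q ⟧ₛ ρ  ≈⟨ +-cong (*-congʳ (fromℤ-+ c d)) (⟦merge⟧ p q ρ) ⟩
        (fromℤ c + fromℤ d) * x + (⟦ p ⟧ₛ ρ + ⟦ q ⟧ₛ ρ)  ≈⟨ +-congʳ (distribʳ _ _ _) ⟩
        (fromℤ c * x + fromℤ d * x) + (⟦ p ⟧ₛ ρ + ⟦ q ⟧ₛ ρ)  ≈⟨ +-interchange _ _ _ _ ⟩
        (fromℤ c * x + ⟦ p ⟧ₛ ρ) + (fromℤ d * x + ⟦ q ⟧ₛ ρ)  ∎
        where x = ⟦ m ⟧ₘ ρ

    ⟦0⟧ₘ : ∀ n ρ → ⟦ Vec.replicate n 0 ⟧ₘ ρ ≈ 1#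
    ⟦0⟧ₘ zero [] = refl
    ⟦0⟧ₘ (suc n) (x ∷ ρ) = trans (*-identityˡ _) (⟦0⟧ₘ n ρ)

    ⟦+⟧ₘ : ∀ {n} (m m′ : Monomial n) ρ → ⟦ Vec.zipWith ℕ._+_ m m′ ⟧ₘ ρ ≈ ⟦ m ⟧ₘ ρ * ⟦ m′ ⟧ₘ ρ
    ⟦+⟧ₘ [] [] [] = sym (*-identityˡ _)
    ⟦+⟧ₘ (e ∷ m) (e′ ∷ m′) (x ∷ ρ) = trans (*-cong (^-homo-* x e e′) (⟦+⟧ₘ m m′ ρ)) (*-interchange _ _ _ _)

    ⟦scale⟧ : ∀ {n} c m (p : Sparse n) ρ → ⟦ scale c m p ⟧ₛ ρ ≈ fromℤ c * ⟦ m ⟧ₘ ρ * ⟦ p ⟧ₛ ρ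
    ⟦scale⟧ c m [] ρ = sym (zeroʳ _)
    ⟦scale⟧ c m ((d , m′) ∷ p) ρ = begin
      fromℤ (c ℤ.* d) * ⟦ Vec.zipWith ℕ._+_ m m′ ⟧ₘ ρ + ⟦ scale c m p ⟧ₛ ρ
        ≈⟨ +-cong (trans (*-cong (fromℤ-* c d) (⟦+⟧ₘ m m′ ρ)) (*-interchange _ _ _ _)) (⟦scale⟧ c m p ρ) ⟩
      (fromℤ c * ⟦ m ⟧ₘ ρ) * (fromℤ d * ⟦ m′ ⟧ₘ ρ) + fromℤ c * ⟦ m ⟧ₘ ρ * ⟦ p ⟧ₛ ρ
        ≈⟨ distribˡ _ _ _ ⟨
      fromℤ c * ⟦ m ⟧ₘ ρ * (fromℤ d * ⟦ m′ ⟧ₘ ρ + ⟦ p ⟧ₛ ρ)  ∎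

    ⟦product⟧ : ∀ {n} (p q : Sparse n) ρ → ⟦ product p q ⟧ₛ ρ ≈ ⟦ p ⟧ₛ ρ * ⟦ q ⟧ₛ ρ
    ⟦product⟧ [] q ρ = sym (zeroˡ _)
    ⟦product⟧ ((c , m) ∷ p) q ρ = begin
      ⟦ merge (scale c m q) (product p q) ⟧ₛ ρ  ≈⟨ ⟦merge⟧ (scale c m q) (product p q) ρ ⟩
      ⟦ scale c m q ⟧ₛ ρ + ⟦ product p q ⟧ₛ ρ  ≈⟨ +-cong (⟦scale⟧ c m q ρ) (⟦product⟧ p q ρ) ⟩
      fromℤ c * ⟦ m ⟧ₘ ρ * ⟦ q ⟧ₛ ρ + ⟦ p ⟧ₛ ρ * ⟦ q ⟧ₛ ρ  ≈⟨ distribʳ _ _ _ ⟨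
      (fromℤ c * ⟦ m ⟧ₘ ρ + ⟦ p ⟧ₛ ρ) * ⟦ q ⟧ₛ ρ  ∎

    ⟦1⟧ₛ : ∀ n ρ → ⟦ (+ 1 , Vec.replicate n 0) ∷ [] ⟧ₛ ρ ≈ 1#
    ⟦1⟧ₛ n ρ = trans (+-identityʳ _) (trans (*-identityˡ _) (⟦0⟧ₘ n ρ))

    ⟦power⟧ : ∀ {n} (p : Sparse n) k ρ → ⟦ power p k ⟧ₛ ρ ≈ ⟦ p ⟧ₛ ρ ^ k
    ⟦power⟧ p zero ρ = ⟦1⟧ₛ _ ρ
    ⟦power⟧ p (suc k) ρ = trans (⟦product⟧ p (power p k) ρ) (*-congˡ (⟦power⟧ p k ρ))

    ⟦unit⟧ : ∀ {n} (i : Fin n) ρ → ⟦ unit i ⟧ₘ ρ ≈ Vec.lookup ρ i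
    ⟦unit⟧ {suc n} zero (x ∷ ρ) = trans (*-congˡ (⟦0⟧ₘ n ρ)) (trans (*-identityʳ _) (*-identityʳ _))
    ⟦unit⟧ (suc i) (x ∷ ρ) = trans (*-identityˡ _) (⟦unit⟧ i ρ)

    ⟦normalise⟧ : ∀ {n} (e : Expr n) ρ → ⟦ normalise e ⟧ₛ ρ ≈ ⟦ e ⟧ ρ
    ⟦normalise⟧ (var i) ρ = trans (+-identityʳ _) (trans (*-identityˡ _) (⟦unit⟧ i ρ))
    ⟦normalise⟧ (con c) ρ = begin
      ⟦ cons c (Vec.replicate _ 0) [] ⟧ₛ ρ  ≈⟨ ⟦cons⟧ c _ [] ρ ⟩
      fromℤ c * ⟦ Vec.replicate _ 0 ⟧ₘ ρ + 0#  ≈⟨ +-identityʳ _ ⟩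
      fromℤ c * ⟦ Vec.replicate _ 0 ⟧ₘ ρ  ≈⟨ *-congˡ (⟦0⟧ₘ _ ρ) ⟩
      fromℤ c * 1#  ≈⟨ *-identityʳ _ ⟩
      fromℤ c  ∎
    ⟦normalise⟧ (x :+ y) ρ = trans (⟦merge⟧ (normalise x) (normalise y) ρ) (+-cong (⟦normalise⟧ x ρ) (⟦normalise⟧ y ρ))
    ⟦normalise⟧ (x :* y) ρ = trans (⟦product⟧ (normalise x) (normalise y) ρ) (*-cong (⟦normalise⟧ x ρ) (⟦normalise⟧ y ρ))
    ⟦normalise⟧ (:- x) ρ = begin
      ⟦ scale (ℤ.- (+ 1)) (Vec.replicate _ 0) (normalise x) ⟧ₛ ρ  ≈⟨ ⟦scale⟧ (ℤ.- (+ 1)) _ (normalise x) ρ ⟩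
      - 1# * ⟦ Vec.replicate _ 0 ⟧ₘ ρ * ⟦ normalise x ⟧ₛ ρ  ≈⟨ *-cong (trans (*-congˡ (⟦0⟧ₘ _ ρ)) (*-identityʳ _)) (⟦normalise⟧ x ρ) ⟩
      - 1# * ⟦ x ⟧ ρ  ≈⟨ -‿distribˡ-* _ _ ⟨
      - (1# * ⟦ x ⟧ ρ)  ≈⟨ -‿cong (*-identityˡ _) ⟩
      - ⟦ x ⟧ ρ  ∎
    ⟦normalise⟧ (x :^ k) ρ = trans (⟦power⟧ (normalise x) k ρ) (^-congˡ k (⟦normalise⟧ x ρ))

    ∀-vec : ∀ n → (Vec Carrier n → Set) → Set
    ∀-vec zero P = P []
    ∀-vec (suc n) P = ∀ x → ∀-vec n λ ρ → P (x ∷ ρ)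

    curry-vec : ∀ n {P : Vec Carrier n → Set} → (∀ ρ → P ρ) → ∀-vec n P
    curry-vec zero f = f []
    curry-vec (suc n) f x = curry-vec n λ ρ → f (x ∷ ρ)

    Curried : ℕ → ℕ → Set
    Curried zero k = Expr k × Expr k
    Curried (suc n) k = Expr k → Curried n k

    apply : ∀ {k} n → Curried n k → Vec (Expr k) n → Expr k × Expr k
    apply zero f [] = f
    apply (suc n) f (x ∷ xs) = apply n (f x) xs

    close : ∀ n → Curried n n → Expr n × Expr n
    close n f = apply n f (Vec.map var (Vec.allFin n))

  x-y≈0⇒x≈y : ∀ {x y} → x + - y ≈ 0# → x ≈ y
  x-y≈0⇒x≈y {x} {y} = x∙y⁻¹≈ε⇒x≈y x y

  -- Normalisation involves integers and exponents only, so `≡.refl` settles the hypothesis by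
  -- evaluation while the ring stays abstract.
  solve : ∀ n (f : Curried n n) →
          normalise (proj₁ (close n f) :- proj₂ (close n f)) ≡ [] →
          ∀-vec n λ ρ → ⟦ proj₁ (close n f) ⟧ ρ ≈ ⟦ proj₂ (close n f) ⟧ ρ
  solve n f p≡[] = curry-vec n λ ρ → x-y≈0⇒x≈y
    (trans (sym (⟦normalise⟧ (proj₁ (close n f) :- proj₂ (close n f)) ρ))
           (reflexive (≡.cong (λ p → ⟦ p ⟧ₛ ρ) p≡[])))

  -- Finite sums, products and q-integers

  ∑ ∏ : ℕ → (ℕ → Carrier) → Carrier
  ∑ zero f = 0#
  ∑ (suc n) f = ∑ n f + f n
  ∏ zero f = 1#
  ∏ (suc n) f = ∏ n f * f n

  ∑-cong : ∀ n {f g : ℕ → Carrier} → (∀ i → i ℕ.< n → f i ≈ g i) → ∑ n f ≈ ∑ n g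
  ∑-cong zero e = refl
  ∑-cong (suc n) e = +-cong (∑-cong n λ i i<n → e i (ℕ.m≤n⇒m≤1+n i<n)) (e n ℕ.≤-refl)

  ∏-cong : ∀ n {f g : ℕ → Carrier} → (∀ i → i ℕ.< n → f i ≈ g i) → ∏ n f ≈ ∏ n g
  ∏-cong zero e = refl
  ∏-cong (suc n) e = *-cong (∏-cong n λ i i<n → e i (ℕ.m≤n⇒m≤1+n i<n)) (e n ℕ.≤-refl)

  ∑-zero : ∀ n {f : ℕ → Carrier} → (∀ i → i ℕ.< n → f i ≈ 0#) → ∑ n f ≈ 0#
  ∑-zero zero e = refl
  ∑-zero (suc n) e = trans (+-cong (∑-zero n λ i i<n → e i (ℕ.m≤n⇒m≤1+n i<n)) (e n ℕ.≤-refl)) (+-identityʳ _)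

  ∑-distribˡ : ∀ n c (f : ℕ → Carrier) → ∑ n (λ i → c * f i) ≈ c * ∑ n f
  ∑-distribˡ zero c f = sym (zeroʳ c)
  ∑-distribˡ (suc n) c f = trans (+-congʳ (∑-distribˡ n c f)) (sym (distribˡ c _ _))

  ∑-single : ∀ n j {f : ℕ → Carrier} → j ℕ.< n → (∀ i → i ℕ.< n → i ≢ j → f i ≈ 0#) → ∑ n f ≈ f j
  ∑-single (suc n) j {f} j<1+n e with n ℕ.≟ j
  ... | yes ≡.refl = trans (+-congʳ (∑-zero n λ i i<n → e i (ℕ.m≤n⇒m≤1+n i<n) (ℕ.<⇒≢ i<n))) (+-identityˡ _)
  ... | no n≢j = trans (+-cong (∑-single n j (ℕ.≤∧≢⇒< (ℕ.s≤s⁻¹ j<1+n) (n≢j ∘ ≡.sym))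
                                 λ i i<n → e i (ℕ.m≤n⇒m≤1+n i<n))
                               (e n ℕ.≤-refl n≢j)) (+-identityʳ _)

  ∏-distrib-* : ∀ n (f g : ℕ → Carrier) → ∏ n (λ i → f i * g i) ≈ ∏ n f * ∏ n g
  ∏-distrib-* zero f g = sym (*-identityˡ _)
  ∏-distrib-* (suc n) f g = trans (*-congʳ (∏-distrib-* n f g)) (*-interchange _ _ _ _)

  ∏-zero : ∀ n j {f : ℕ → Carrier} → j ℕ.< n → f j ≈ 0# → ∏ n f ≈ 0#
  ∏-zero (suc n) j {f} j<1+n e with n ℕ.≟ j
  ... | yes ≡.refl = trans (*-congˡ e) (zeroʳ _)
  ... | no n≢j = trans (*-congʳ (∏-zero n j {f} (ℕ.≤∧≢⇒< (ℕ.s≤s⁻¹ j<1+n) (n≢j ∘ ≡.sym)) e)) (zeroˡ _)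

  ∏-+ : ∀ m n f → ∏ (m ℕ.+ n) f ≈ ∏ m f * ∏ n (λ i → f (m ℕ.+ i))
  ∏-+ m zero f = trans (reflexive (≡.cong (λ k → ∏ k f) (ℕ.+-identityʳ m))) (sym (*-identityʳ _))
  ∏-+ m (suc n) f = trans (reflexive (≡.cong (λ k → ∏ k f) (ℕ.+-suc m n)))
    (trans (*-congʳ (∏-+ m n f)) (*-assoc _ _ _))

  ∑-truncate : ∀ {m n} {f : ℕ → Carrier} → m ℕ.≤ n → (∀ k → m ℕ.≤ k → f k ≈ 0#) → ∑ n f ≈ ∑ m f
  ∑-truncate {m} {n} {f} m≤n f≈0 with ℕ.m≤n⇒m<n∨m≡n m≤n
  ... | inj₂ ≡.refl = refl
  ... | inj₁ (s≤s {n = n′} m≤n′) = trans (+-cong (∑-truncate m≤n′ f≈0) (f≈0 n′ m≤n′)) (+-identityʳ _)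

  ∏-suc : ∀ n f → ∏ (suc n) f ≈ f 0 * ∏ n (f ∘ suc)
  ∏-suc zero f = *-comm _ _
  ∏-suc (suc n) f = trans (*-congʳ (∏-suc n f)) (*-assoc _ _ _)

  ∏-reverse : ∀ n f → ∏ n f ≈ ∏ n (λ j → f (n ℕ.∸ suc j))
  ∏-reverse zero f = refl
  ∏-reverse (suc n) f = begin
    ∏ n f * f n  ≈⟨ *-comm _ _ ⟩
    f n * ∏ n f  ≈⟨ *-congˡ (∏-reverse n f) ⟩
    f n * ∏ n (λ j → f (n ℕ.∸ suc j))  ≈⟨ ∏-suc n (λ j → f (n ℕ.∸ j)) ⟨
    ∏ (suc n) (λ j → f (suc n ℕ.∸ suc j))  ∎

  [_]_ : ℕ → Carrier → Carrier
  [ n ] x = ∑ n λ i → x ^ i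

  [+] : ∀ m n x → [ m ℕ.+ n ] x ≈ [ m ] x + x ^ m * [ n ] x
  [+] m zero x = trans (reflexive (≡.cong ([_] x) (ℕ.+-identityʳ m))) (solve 2 (λ a b → a := a :+ b :* con (+ 0)) ≡.refl _ _)
  [+] m (suc n) x = begin
    [ m ℕ.+ suc n ] x  ≈⟨ reflexive (≡.cong ([_] x) (ℕ.+-suc m n)) ⟩
    [ m ℕ.+ n ] x + x ^ (m ℕ.+ n)  ≈⟨ +-cong ([+] m n x) (^-homo-* x m n) ⟩
    [ m ] x + x ^ m * [ n ] x + x ^ m * x ^ n  ≈⟨ solve 4 (λ a b c d → a :+ b :* c :+ b :* d := a :+ b :* (c :+ d)) ≡.refl _ _ _ _ ⟩
    [ m ] x + x ^ m * [ suc n ] x  ∎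

  [*] : ∀ m n x → [ m ℕ.* n ] x ≈ [ m ] x * [ n ] (x ^ m)
  [*] m zero x = trans (reflexive (≡.cong ([_] x) (ℕ.*-zeroʳ m))) (sym (zeroʳ _))
  [*] m (suc n) x = begin
    [ m ℕ.* suc n ] x  ≈⟨ reflexive (≡.cong ([_] x) (≡.trans (ℕ.*-suc m n) (ℕ.+-comm m (m ℕ.* n)))) ⟩
    [ m ℕ.* n ℕ.+ m ] x  ≈⟨ [+] (m ℕ.* n) m x ⟩
    [ m ℕ.* n ] x + x ^ (m ℕ.* n) * [ m ] x  ≈⟨ +-cong ([*] m n x) (*-congʳ (sym (^-assocʳ x m n))) ⟩
    [ m ] x * [ n ] (x ^ m) + (x ^ m) ^ n * [ m ] x  ≈⟨ solve 3 (λ a b c → a :* b :+ c :* a := a :* (b :+ c)) ≡.refl _ _ _ ⟩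
    [ m ] x * [ suc n ] (x ^ m)  ∎

  1-x*[] : ∀ n x → (1# + - x) * [ n ] x ≈ 1# + - x ^ n
  1-x*[] zero x = solve 1 (λ x → (:1 :- x) :* con (+ 0) := :1 :- :1) ≡.refl x
  1-x*[] (suc n) x = trans (distribˡ _ _ _) (trans (+-congʳ (1-x*[] n x))
    (solve 2 (λ x y → (:1 :- y) :+ (:1 :- x) :* y := :1 :- x :* y) ≡.refl x (x ^ n)))

  -- Every power of `x` is 1 modulo `1 - x`; the witness collects the quotients
  -- `(1 - x ^ i) / (1 - x) = [ i ] x`.
  []-mod : ∀ n x → ∃[ z ] [ n ] x + (1# + - x) * z ≈ fromℕ n
  []-mod zero x = 0# , solve 1 (λ x → con (+ 0) :+ (:1 :- x) :* con (+ 0) := con (+ 0)) ≡.refl x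
  []-mod (suc n) x with []-mod n x
  ... | z , e = z + [ n ] x , (begin
    [ n ] x + x ^ n + (1# + - x) * (z + [ n ] x)  ≈⟨ solve 4 (λ a y x z → a :+ y :+ (:1 :- x) :* (z :+ a) := (a :+ (:1 :- x) :* z) :+ (y :+ (:1 :- x) :* a)) ≡.refl _ _ x z ⟩
    ([ n ] x + (1# + - x) * z) + (x ^ n + (1# + - x) * [ n ] x)  ≈⟨ +-cong e (+-congˡ (1-x*[] n x)) ⟩
    fromℕ n + (x ^ n + (1# + - x ^ n))  ≈⟨ solve 2 (λ a y → a :+ (y :+ (:1 :- y)) := :1 :+ a) ≡.refl _ _ ⟩
    1# + fromℕ n  ≈⟨ fromℕ-suc n ⟨
    fromℕ (suc n)  ∎)

  -- A Bézout relation between the indices lifts: from `a m = 1 + b n` follows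
  -- `[ a m ] x = 1 + x [ b n ] x`, and the two q-integers are multiples of `[ m ] x` and `[ n ] x`.
  []-coprime : ∀ m n x → Coprime m n → ∃[ u ] ∃[ v ] [ m ] x * u + [ n ] x * v ≈ 1#
  []-coprime m n x c with coprime-Bézout c
  ... | Bézout.+- a b 1+bn≡am = [ a ] (x ^ m) , - (x * [ b ] (x ^ n)) , (begin
    [ m ] x * [ a ] (x ^ m) + [ n ] x * - (x * [ b ] (x ^ n))  ≈⟨ solve 4 (λ A N x B → A :+ N :* :- (x :* B) := A :- x :* (N :* B)) ≡.refl _ _ x _ ⟩
    [ m ] x * [ a ] (x ^ m) + - (x * ([ n ] x * [ b ] (x ^ n))) ≈⟨ +-cong (sym ([*] m a x)) (-‿cong (*-congˡ (sym ([*] n b x)))) ⟩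
    [ m ℕ.* a ] x + - (x * [ n ℕ.* b ] x)  ≈⟨ +-congʳ (reflexive (≡.cong ([_] x) (≡.trans (ℕ.*-comm m a) (≡.trans (≡.sym 1+bn≡am) (≡.cong suc (ℕ.*-comm b n)))))) ⟩
    [ 1 ℕ.+ n ℕ.* b ] x + - (x * [ n ℕ.* b ] x)  ≈⟨ +-congʳ ([+] 1 (n ℕ.* b) x) ⟩
    [ 1 ] x + x ^ 1 * [ n ℕ.* b ] x + - (x * [ n ℕ.* b ] x)  ≈⟨ solve 2 (λ x B → con (+ 0) :+ :1 :+ x :^ 1 :* B :- x :* B := :1) ≡.refl x _ ⟩
    1#  ∎)
  ... | Bézout.-+ a b 1+am≡bn = - (x * [ a ] (x ^ m)) , [ b ] (x ^ n) , (begin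
    [ m ] x * - (x * [ a ] (x ^ m)) + [ n ] x * [ b ] (x ^ n)  ≈⟨ solve 4 (λ M x A B → M :* :- (x :* A) :+ B := B :- x :* (M :* A)) ≡.refl _ x _ _ ⟩
    [ n ] x * [ b ] (x ^ n) + - (x * ([ m ] x * [ a ] (x ^ m))) ≈⟨ +-cong (sym ([*] n b x)) (-‿cong (*-congˡ (sym ([*] m a x)))) ⟩
    [ n ℕ.* b ] x + - (x * [ m ℕ.* a ] x)  ≈⟨ +-congʳ (reflexive (≡.cong ([_] x) (≡.trans (ℕ.*-comm n b) (≡.trans (≡.sym 1+am≡bn) (≡.cong suc (ℕ.*-comm a m)))))) ⟩
    [ 1 ℕ.+ m ℕ.* a ] x + - (x * [ m ℕ.* a ] x)  ≈⟨ +-congʳ ([+] 1 (m ℕ.* a) x) ⟩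
    [ 1 ] x + x ^ 1 * [ m ℕ.* a ] x + - (x * [ m ℕ.* a ] x)  ≈⟨ solve 2 (λ x B → con (+ 0) :+ :1 :+ x :^ 1 :* B :- x :* B := :1) ≡.refl x _ ⟩
    1#  ∎)

  -- With d = gcd(m d, n d), [ m ] (x ^ d) is the part of [ m d ] x that is coprime to [ n d ] x.
  []-cofactor : ∀ m n d x → Coprime m n → ∃[ u ] ∃[ v ] [ m ] (x ^ d) * u + [ d ℕ.* n ] x * v ≈ fromℕ m
  []-cofactor m n d x c with []-coprime m n (x ^ d) c | []-mod m (x ^ d)
  -- The relation `A u + N v = 1` is multiplied by `m`, and in `N v m` the integer is replaced by
  -- `A + (1 - x ^ d) z`; then `N (1 - x ^ d)` is `1 - x` times `[ d n ] x`. The factor `m` cannot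
  -- be avoided: `1 + x ^ 2` and `1 + x` only generate an ideal containing 2.
  ... | u , v , uv | z , mod = u * fromℕ m + [ n ] (x ^ d) * v , v * ((1# + - x) * z) , (begin
    A * (u * fromℕ m + N * v) + [ d ℕ.* n ] x * (v * ((1# + - x) * z))
      ≈⟨ +-congˡ (*-congʳ ([*] d n x)) ⟩
    A * (u * fromℕ m + N * v) + ([ d ] x * N) * (v * ((1# + - x) * z))
      ≈⟨ solve 8 (λ A u f N v d x z → A :* (u :* f :+ N :* v) :+ (d :* N) :* (v :* ((:1 :- x) :* z)) := A :* u :* f :+ N :* v :* (A :+ ((:1 :- x) :* d) :* z)) ≡.refl A u _ N v _ x z ⟩
    A * u * fromℕ m + N * v * (A + ((1# + - x) * [ d ] x) * z)
      ≈⟨ +-congˡ (*-congˡ (trans (+-congˡ (*-congʳ (1-x*[] d x))) mod)) ⟩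
    A * u * fromℕ m + N * v * fromℕ m
      ≈⟨ distribʳ _ _ _ ⟨
    (A * u + N * v) * fromℕ m
      ≈⟨ trans (*-congʳ uv) (*-identityˡ _) ⟩
    fromℕ m ∎)
    where
    A N : Carrier
    A = [ m ] (x ^ d)
    N = [ n ] (x ^ d)

-- Domains, homomorphisms and polynomial rings

-- Deciding whether an element vanishes is part of the structure: cancellation of polynomials skips
-- vanishing low coefficients, and inverses of fractions are defined by cases.
record IsDomain (R : CommutativeRing 0ℓ 0ℓ) : Set where
  open RingTools R
  field
    1≉0     : ¬ 1# ≈ 0#
    _≈0?    : ∀ x → Dec (x ≈ 0#)
    cancel  : ∀ {x y} → ¬ x ≈ 0# → x * y ≈ 0# → y ≈ 0#

  *-≉0 : ∀ {x y} → ¬ x ≈ 0# → ¬ y ≈ 0# → ¬ x * y ≈ 0#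
  *-≉0 x≉0 y≉0 xy≈0 = y≉0 (cancel x≉0 xy≈0)

  *-cancelˡ : ∀ {x y z} → ¬ x ≈ 0# → x * y ≈ x * z → y ≈ z
  *-cancelˡ {x} {y} {z} x≉0 e = x-y≈0⇒x≈y (cancel x≉0 (begin
    x * (y + - z)  ≈⟨ solve 3 (λ x y z → x :* (y :- z) := x :* y :- x :* z) ≡.refl x y z ⟩
    x * y + - (x * z)  ≈⟨ +-congʳ e ⟩
    x * z + - (x * z)  ≈⟨ -‿inverseʳ _ ⟩
    0#  ∎))

  ^-≉0 : ∀ {x} n → ¬ x ≈ 0# → ¬ x ^ n ≈ 0#
  ^-≉0 zero x≉0 = 1≉0
  ^-≉0 (suc n) x≉0 = *-≉0 x≉0 (^-≉0 n x≉0)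

  ∏-≉0 : ∀ n {f : ℕ → Carrier} → (∀ i → i ℕ.< n → ¬ f i ≈ 0#) → ¬ ∏ n f ≈ 0#
  ∏-≉0 zero f≉0 = 1≉0
  ∏-≉0 (suc n) f≉0 = *-≉0 (∏-≉0 n λ i i<n → f≉0 i (ℕ.m≤n⇒m≤1+n i<n)) (f≉0 n ℕ.≤-refl)

record IsHom (R S : CommutativeRing 0ℓ 0ℓ) (f : CommutativeRing.Carrier R → CommutativeRing.Carrier S) : Set where
  private
    module R = CommutativeRing R
    module S = CommutativeRing S
  field
    ⟦⟧-cong : ∀ {x y} → x R.≈ y → f x S.≈ f y
    +-homo  : ∀ x y → f (x R.+ y) S.≈ f x S.+ f y
    *-homo  : ∀ x y → f (x R.* y) S.≈ f x S.* f y
    -‿homo  : ∀ x → f (R.- x) S.≈ S.- f x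
    0#-homo : f R.0# S.≈ S.0#
    1#-homo : f R.1# S.≈ S.1#

module Polynomials (R : CommutativeRing 0ℓ 0ℓ) where

  open RingTools R

  Poly : Set
  Poly = List Carrier

  infix 9 _!_
  infix 4 _≋_

  _!_ : Poly → ℕ → Carrier
  [] ! _ = 0#
  (x ∷ p) ! zero = x
  (x ∷ p) ! suc i = p ! i

  -- Coefficientwise equality ignores trailing zeros. The record wrapper lets `p` and `q` be
  -- recovered by unification, which the bare function type would not.
  record _≋_ (p q : Poly) : Set where
    constructor coeffwise
    field _!≈_ : ∀ i → p ! i ≈ q ! i
  open _≋_ public

  -- These recursions copy those of `add1` and `mul1`, and over a second layer those of `_⊕_` and
  -- `_⊛_`, so the twofold polynomial ring over ℤ has the operations of the statement.
  add : Poly → Poly → Poly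
  add [] r = r
  add (x ∷ p) [] = x ∷ p
  add (x ∷ p) (y ∷ r) = x + y ∷ add p r

  neg : Poly → Poly
  neg = map (-_)

  mul : Poly → Poly → Poly
  mul [] r = []
  mul (x ∷ p) r = add (map (x *_) r) (0# ∷ mul p r)

  const : Carrier → Poly
  const x = x ∷ []

  add-! : ∀ p q i → add p q ! i ≈ p ! i + q ! i
  add-! [] q i = sym (+-identityˡ _)
  add-! (x ∷ p) [] i = sym (+-identityʳ _)
  add-! (x ∷ p) (y ∷ q) zero = refl
  add-! (x ∷ p) (y ∷ q) (suc i) = add-! p q i

  neg-! : ∀ p i → neg p ! i ≈ - (p ! i)
  neg-! [] i = solve 0 (con (+ 0) := :- con (+ 0)) ≡.refl
  neg-! (x ∷ p) zero = refl
  neg-! (x ∷ p) (suc i) = neg-! p i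

  scale-! : ∀ x p i → map (x *_) p ! i ≈ x * p ! i
  scale-! x [] i = sym (zeroʳ x)
  scale-! x (y ∷ p) zero = refl
  scale-! x (y ∷ p) (suc i) = scale-! x p i

  mul-!0 : ∀ x p q → mul (x ∷ p) q ! 0 ≈ x * q ! 0
  mul-!0 x p q = trans (add-! (map (x *_) q) _ 0) (trans (+-identityʳ _) (scale-! x q 0))

  mul-!suc : ∀ x p q i → mul (x ∷ p) q ! suc i ≈ x * q ! suc i + mul p q ! i
  mul-!suc x p q i = trans (add-! (map (x *_) q) _ (suc i)) (+-congʳ (scale-! x q (suc i)))

  mul-at-0 : ∀ p q → mul p q ! 0 ≈ p ! 0 * q ! 0
  mul-at-0 [] q = sym (zeroˡ _)
  mul-at-0 (x ∷ p) q = mul-!0 x p q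

  const-mul-! : ∀ x q i → mul (const x) q ! i ≈ x * q ! i
  const-mul-! x q zero = mul-!0 x [] q
  const-mul-! x q (suc i) = trans (mul-!suc x [] q i) (+-identityʳ _)

  ≋-refl : ∀ {p} → p ≋ p
  ≋-refl = coeffwise λ i → refl

  ≋-sym : ∀ {p q} → p ≋ q → q ≋ p
  ≋-sym (coeffwise e) = coeffwise λ i → sym (e i)

  ≋-trans : ∀ {p q r} → p ≋ q → q ≋ r → p ≋ r
  ≋-trans (coeffwise e) (coeffwise f) = coeffwise λ i → trans (e i) (f i)

  ∷-≋[] : ∀ {x p} → x ≈ 0# → p ≋ [] → (x ∷ p) ≋ []
  ∷-≋[] x≈0 p≋[] = coeffwise λ { zero → x≈0 ; (suc i) → p≋[] !≈ i }

  add-cong : ∀ {p p′ q q′} → p ≋ p′ → q ≋ q′ → add p q ≋ add p′ q′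
  add-cong {p} {p′} {q} {q′} e f = coeffwise λ i →
    trans (add-! p q i) (trans (+-cong (e !≈ i) (f !≈ i)) (sym (add-! p′ q′ i)))

  mul-congˡ : ∀ p {q q′} → q ≋ q′ → mul p q ≋ mul p q′
  mul-congˡ [] e = ≋-refl
  mul-congˡ (x ∷ p) {q} {q′} e = coeffwise λ
    { zero → trans (mul-!0 x p q) (trans (*-congˡ (e !≈ 0)) (sym (mul-!0 x p q′)))
    ; (suc i) → trans (mul-!suc x p q i)
        (trans (+-cong (*-congˡ (e !≈ suc i)) (mul-congˡ p e !≈ i)) (sym (mul-!suc x p q′ i))) }

  mul-[]ʳ : ∀ p → mul p [] ≋ []
  mul-[]ʳ [] = ≋-refl
  mul-[]ʳ (x ∷ p) = ∷-≋[] refl (mul-[]ʳ p)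

  mul-∷ʳ : ∀ p y q → mul p (y ∷ q) ≋ add (map (y *_) p) (0# ∷ mul p q)
  mul-∷ʳ [] y q = coeffwise λ { zero → refl ; (suc i) → refl }
  mul-∷ʳ (x ∷ p) y q = coeffwise λ
    { zero → +-congʳ (*-comm x y)
    ; (suc i) → begin
        add (map (x *_) q) (mul p (y ∷ q)) ! i
          ≈⟨ trans (add-! (map (x *_) q) _ i) (+-cong (scale-! x q i) (mul-∷ʳ p y q !≈ i)) ⟩
        x * q ! i + add (map (y *_) p) (0# ∷ mul p q) ! i
          ≈⟨ +-congˡ (add-! (map (y *_) p) _ i) ⟩
        x * q ! i + (map (y *_) p ! i + (0# ∷ mul p q) ! i)
          ≈⟨ solve 3 (λ a b c → a :+ (b :+ c) := b :+ (a :+ c)) ≡.refl _ _ _ ⟩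
        map (y *_) p ! i + (x * q ! i + (0# ∷ mul p q) ! i)
          ≈⟨ +-congˡ (trans (add-! (map (x *_) q) _ i) (+-congʳ (scale-! x q i))) ⟨
        map (y *_) p ! i + mul (x ∷ p) q ! i
          ≈⟨ add-! (map (y *_) p) _ i ⟨
        add (map (y *_) p) (mul (x ∷ p) q) ! i ∎ }

  mul-comm : ∀ p q → mul p q ≋ mul q p
  mul-comm [] q = ≋-sym (mul-[]ʳ q)
  mul-comm (x ∷ p) q = ≋-trans
    (add-cong (≋-refl {map (x *_) q}) (coeffwise λ { zero → refl ; (suc i) → mul-comm p q !≈ i }))
    (≋-sym (mul-∷ʳ q x p))

  mul-distribʳ : ∀ r p q → mul (add p q) r ≋ add (mul p r) (mul q r)
  mul-distribʳ r [] q = ≋-refl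
  mul-distribʳ r (x ∷ p) [] = coeffwise λ i → sym (trans (add-! (mul (x ∷ p) r) [] i) (+-identityʳ _))
  mul-distribʳ r (x ∷ p) (y ∷ q) = coeffwise λ
    { zero → begin
        mul (x + y ∷ add p q) r ! 0  ≈⟨ mul-!0 (x + y) (add p q) r ⟩
        (x + y) * r ! 0  ≈⟨ distribʳ _ _ _ ⟩
        x * r ! 0 + y * r ! 0  ≈⟨ +-cong (mul-!0 x p r) (mul-!0 y q r) ⟨
        mul (x ∷ p) r ! 0 + mul (y ∷ q) r ! 0  ≈⟨ add-! (mul (x ∷ p) r) _ 0 ⟨
        add (mul (x ∷ p) r) (mul (y ∷ q) r) ! 0  ∎
    ; (suc i) → begin
        mul (x + y ∷ add p q) r ! suc i
          ≈⟨ mul-!suc (x + y) (add p q) r i ⟩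
        (x + y) * r ! suc i + mul (add p q) r ! i
          ≈⟨ +-congˡ (trans (mul-distribʳ r p q !≈ i) (add-! (mul p r) _ i)) ⟩
        (x + y) * r ! suc i + (mul p r ! i + mul q r ! i)
          ≈⟨ solve 5 (λ x y z a b → (x :+ y) :* z :+ (a :+ b) := (x :* z :+ a) :+ (y :* z :+ b)) ≡.refl _ _ _ _ _ ⟩
        (x * r ! suc i + mul p r ! i) + (y * r ! suc i + mul q r ! i)
          ≈⟨ +-cong (mul-!suc x p r i) (mul-!suc y q r i) ⟨
        mul (x ∷ p) r ! suc i + mul (y ∷ q) r ! suc i
          ≈⟨ add-! (mul (x ∷ p) r) _ (suc i) ⟨
        add (mul (x ∷ p) r) (mul (y ∷ q) r) ! suc i  ∎ }

  mul-scale : ∀ x p r → mul (map (x *_) p) r ≋ map (x *_) (mul p r)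
  mul-scale x [] r = ≋-refl
  mul-scale x (y ∷ p) r = coeffwise λ
    { zero → trans (mul-!0 (x * y) (map (x *_) p) r) (trans (*-assoc _ _ _)
               (sym (trans (scale-! x (mul (y ∷ p) r) 0) (*-congˡ (mul-!0 y p r)))))
    ; (suc i) → begin
        mul (x * y ∷ map (x *_) p) r ! suc i
          ≈⟨ mul-!suc (x * y) (map (x *_) p) r i ⟩
        x * y * r ! suc i + mul (map (x *_) p) r ! i
          ≈⟨ +-congˡ (trans (mul-scale x p r !≈ i) (scale-! x (mul p r) i)) ⟩
        x * y * r ! suc i + x * mul p r ! i
          ≈⟨ solve 4 (λ x y a b → x :* y :* a :+ x :* b := x :* (y :* a :+ b)) ≡.refl _ _ _ _ ⟩
        x * (y * r ! suc i + mul p r ! i)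
          ≈⟨ *-congˡ (mul-!suc y p r i) ⟨
        x * mul (y ∷ p) r ! suc i
          ≈⟨ scale-! x (mul (y ∷ p) r) (suc i) ⟨
        map (x *_) (mul (y ∷ p) r) ! suc i ∎ }

  mul-0∷ : ∀ p r → mul (0# ∷ p) r ≋ (0# ∷ mul p r)
  mul-0∷ p r = coeffwise λ
    { zero → trans (mul-!0 0# p r) (zeroˡ _)
    ; (suc i) → trans (mul-!suc 0# p r i) (trans (+-congʳ (zeroˡ _)) (+-identityˡ _)) }

  mul-assoc : ∀ p q r → mul (mul p q) r ≋ mul p (mul q r)
  mul-assoc [] q r = ≋-refl
  mul-assoc (x ∷ p) q r = ≋-trans (mul-distribʳ r (map (x *_) q) (0# ∷ mul p q))
    (add-cong (mul-scale x q r)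
      (≋-trans (mul-0∷ (mul p q) r) (coeffwise λ { zero → refl ; (suc i) → mul-assoc p q r !≈ i })))

  add-comm : ∀ p q → add p q ≋ add q p
  add-comm p q = coeffwise λ i → trans (add-! p q i) (trans (+-comm _ _) (sym (add-! q p i)))

  add-assoc : ∀ p q r → add (add p q) r ≋ add p (add q r)
  add-assoc p q r = coeffwise λ i → begin
    add (add p q) r ! i  ≈⟨ trans (add-! (add p q) r i) (+-congʳ (add-! p q i)) ⟩
    p ! i + q ! i + r ! i  ≈⟨ +-assoc _ _ _ ⟩
    p ! i + (q ! i + r ! i)  ≈⟨ trans (add-! p (add q r) i) (+-congˡ (add-! q r i)) ⟨
    add p (add q r) ! i  ∎

  neg-inverse : ∀ p → add (neg p) p ≋ []
  neg-inverse p = coeffwise λ i → trans (add-! (neg p) p i) (trans (+-congʳ (neg-! p i)) (-‿inverseˡ _))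

  add-identityʳ : ∀ p → add p [] ≋ p
  add-identityʳ p = coeffwise λ i → trans (add-! p [] i) (+-identityʳ _)

  neg-cong : ∀ {p q} → p ≋ q → neg p ≋ neg q
  neg-cong {p} {q} e = coeffwise λ i → trans (neg-! p i) (trans (-‿cong (e !≈ i)) (sym (neg-! q i)))

  mul-identityˡ : ∀ p → mul (const 1#) p ≋ p
  mul-identityˡ p = coeffwise λ i → trans (const-mul-! 1# p i) (*-identityˡ _)

  mul-cong : ∀ {p p′ q q′} → p ≋ p′ → q ≋ q′ → mul p q ≋ mul p′ q′
  mul-cong {p} {p′} {q} {q′} e f = ≋-trans (mul-congˡ p f)
    (≋-trans (mul-comm p q′) (≋-trans (mul-congˡ q′ e) (mul-comm q′ p′)))

  polynomialRing : CommutativeRing 0ℓ 0ℓ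
  polynomialRing = record
    { Carrier = Poly
    ; _≈_ = _≋_
    ; _+_ = add
    ; _*_ = mul
    ; -_ = neg
    ; 0# = []
    ; 1# = const 1#
    ; isCommutativeRing = record
      { isRing = record
        { +-isAbelianGroup = record
          { isGroup = record
            { isMonoid = record
              { isSemigroup = record
                { isMagma = record
                  { isEquivalence = record { refl = ≋-refl ; sym = ≋-sym ; trans = ≋-trans }
                  ; ∙-cong = add-cong }
                ; assoc = add-assoc }
              ; identity = (λ p → ≋-refl) , add-identityʳ }
            ; inverse = neg-inverse , λ p → ≋-trans (add-comm p (neg p)) (neg-inverse p)
            ; ⁻¹-cong = neg-cong }
          ; comm = add-comm }
        ; *-cong = mul-cong
        ; *-assoc = mul-assoc
        ; *-identity = mul-identityˡ , λ p → ≋-trans (mul-comm p (const 1#)) (mul-identityˡ p)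
        ; distrib = (λ p q r → ≋-trans (mul-comm p (add q r)) (≋-trans (mul-distribʳ p q r) (add-cong (mul-comm q p) (mul-comm r p))))
                  , mul-distribʳ }
      ; *-comm = mul-comm } }

  const-isHom : IsHom R polynomialRing const
  const-isHom = record
    { ⟦⟧-cong = λ e → coeffwise λ { zero → e ; (suc i) → refl }
    ; +-homo = λ x y → ≋-refl
    ; *-homo = λ x y → coeffwise λ { zero → sym (mul-!0 x [] (const y)) ; (suc i) → sym (trans (mul-!suc x [] (const y) i) (trans (+-congʳ (zeroʳ _)) (+-identityˡ _))) }
    ; -‿homo = λ x → ≋-refl
    ; 0#-homo = ∷-≋[] refl ≋-refl
    ; 1#-homo = ≋-refl }

  !0-isHom : IsHom polynomialRing R (_! 0)
  !0-isHom = record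
    { ⟦⟧-cong = λ e → e !≈ 0
    ; +-homo = λ p q → add-! p q 0
    ; *-homo = mul-at-0
    ; -‿homo = λ p → neg-! p 0
    ; 0#-homo = refl
    ; 1#-homo = refl }

  X : Poly
  X = 0# ∷ 1# ∷ []

  X-mul : ∀ p → mul X p ≋ (0# ∷ p)
  X-mul p = ≋-trans (mul-0∷ (const 1#) p) (coeffwise λ { zero → refl ; (suc i) → mul-identityˡ p !≈ i })

  module _ (domain : IsDomain R) where

    open IsDomain domain

    ≋[]? : ∀ p → Dec (p ≋ [])
    ≋[]? [] = yes ≋-refl
    ≋[]? (x ∷ p) with x ≈0? | ≋[]? p
    ... | yes x≈0 | yes p≋[] = yes (∷-≋[] x≈0 p≋[])
    ... | no x≉0 | _ = no λ e → x≉0 (e !≈ 0)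
    ... | yes _ | no p≉[] = no λ e → p≉[] (coeffwise λ i → e !≈ suc i)

    -- The lowest coefficients multiply, so the head of `q` vanishes; the tail of `q` is then
    -- annihilated as well.
    mul-cancel-nonzero-head : ∀ x p q → ¬ x ≈ 0# → mul (x ∷ p) q ≋ [] → q ≋ []
    mul-cancel-nonzero-head x p [] x≉0 e = ≋-refl
    mul-cancel-nonzero-head x p (y ∷ q) x≉0 e = ∷-≋[] y≈0
      (mul-cancel-nonzero-head x p q x≉0 (coeffwise λ i → begin
        mul (x ∷ p) q ! i  ≈⟨ +-identityˡ _ ⟨
        0# + mul (x ∷ p) q ! i  ≈⟨ +-congʳ (trans (*-congʳ y≈0) (zeroˡ _)) ⟨
        y * (x ∷ p) ! suc i + mul (x ∷ p) q ! i  ≈⟨ +-congʳ (scale-! y (x ∷ p) (suc i)) ⟨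
        map (y *_) (x ∷ p) ! suc i + mul (x ∷ p) q ! i  ≈⟨ add-! (map (y *_) (x ∷ p)) (0# ∷ mul (x ∷ p) q) (suc i) ⟨
        add (map (y *_) (x ∷ p)) (0# ∷ mul (x ∷ p) q) ! suc i ≈⟨ mul-∷ʳ (x ∷ p) y q !≈ suc i ⟨
        mul (x ∷ p) (y ∷ q) ! suc i  ≈⟨ e !≈ suc i ⟩
        0# ∎))
      where
      y≈0 : y ≈ 0#
      y≈0 = cancel x≉0 (trans (sym (mul-!0 x p (y ∷ q))) (e !≈ 0))

    mul-cancel : ∀ p q → ¬ p ≋ [] → mul p q ≋ [] → q ≋ []
    mul-cancel [] q p≉[] e = ⊥-elim (p≉[] ≋-refl)
    mul-cancel (x ∷ p) q p≉[] e with x ≈0?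
    ... | no x≉0 = mul-cancel-nonzero-head x p q x≉0 e
    ... | yes x≈0 = mul-cancel p q (λ p≋[] → p≉[] (∷-≋[] x≈0 p≋[])) (coeffwise λ i → begin
        mul p q ! i  ≈⟨ +-identityˡ _ ⟨
        0# + mul p q ! i  ≈⟨ +-congʳ (trans (*-congʳ x≈0) (zeroˡ _)) ⟨
        x * q ! suc i + mul p q ! i  ≈⟨ mul-!suc x p q i ⟨
        mul (x ∷ p) q ! suc i  ≈⟨ e !≈ suc i ⟩
        0# ∎)

    polynomialDomain : IsDomain polynomialRing
    polynomialDomain = record
      { 1≉0 = λ e → 1≉0 (e !≈ 0)
      ; _≈0? = ≋[]?
      ; cancel = λ {p} {q} → mul-cancel p q }

    top-degree : ∀ p → ¬ p ≋ [] → ∃[ i ] (¬ p ! i ≈ 0# × (∀ j → i ℕ.< j → p ! j ≈ 0#))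
    top-degree [] p≉[] = ⊥-elim (p≉[] ≋-refl)
    top-degree (x ∷ p) p≉[] with ≋[]? p
    ... | yes p≋[] = 0 , (λ x≈0 → p≉[] (∷-≋[] x≈0 p≋[])) , λ { (suc j) _ → p≋[] !≈ j }
    ... | no p≉[]′ with top-degree p p≉[]′
    ...   | i , top , above = suc i , top , λ { (suc j) (s≤s i<j) → above j i<j }

    mul-top : ∀ p q i j → (∀ k → i ℕ.< k → p ! k ≈ 0#) → (∀ k → j ℕ.< k → q ! k ≈ 0#) →
              mul p q ! (i ℕ.+ j) ≈ p ! i * q ! j
    mul-top [] q i j _ _ = sym (zeroˡ _)
    mul-top (x ∷ p) q zero zero p↑ q↑ = mul-!0 x p q
    mul-top (x ∷ p) q zero (suc j) p↑ q↑ = trans (mul-!suc x p q j) (trans (+-congˡ (p≋[]⇒ !≈ j)) (+-identityʳ _))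
      where
      p≋[]⇒ : mul p q ≋ []
      p≋[]⇒ = mul-cong {p} {[]} {q} {q} (coeffwise λ k → p↑ (suc k) (s≤s z≤n)) ≋-refl
    mul-top (x ∷ p) q (suc i) j p↑ q↑ = begin
      mul (x ∷ p) q ! suc (i ℕ.+ j)  ≈⟨ mul-!suc x p q (i ℕ.+ j) ⟩
      x * q ! suc (i ℕ.+ j) + mul p q ! (i ℕ.+ j)  ≈⟨ +-cong (trans (*-congˡ (q↑ _ (s≤s (ℕ.m≤n+m j i)))) (zeroʳ _))
                                                            (mul-top p q i j (λ k i<k → p↑ (suc k) (s≤s i<k)) q↑) ⟩
      0# + p ! i * q ! j  ≈⟨ +-identityˡ _ ⟩
      p ! i * q ! j  ∎

    -- Degrees add in a domain: a top coefficient of `p` in positive degree, times that of `q`,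
    -- would be a nonzero coefficient of `r` in positive degree.
    factor-of-constant : ∀ p q r → mul p q ≋ r → ¬ r ≋ [] → (∀ k → r ! suc k ≈ 0#) → ∀ k → p ! suc k ≈ 0#
    factor-of-constant p q r e r≉[] r↑ k
      with top-degree p (λ p≋[] → r≉[] (≋-trans (≋-sym e) (mul-cong {p} {[]} {q} {q} p≋[] ≋-refl)))
         | top-degree q (λ q≋[] → r≉[] (≋-trans (≋-sym e) (≋-trans (mul-congˡ p q≋[]) (mul-[]ʳ p))))
    ... | zero , _ , p↑ | _ = p↑ (suc k) (s≤s z≤n)
    ... | suc i , pᵢ≉0 , p↑ | j , qⱼ≉0 , q↑ = ⊥-elim (*-≉0 pᵢ≉0 qⱼ≉0 (begin
      p ! suc i * q ! j  ≈⟨ mul-top p q (suc i) j p↑ q↑ ⟨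
      mul p q ! (suc i ℕ.+ j)  ≈⟨ e !≈ suc (i ℕ.+ j) ⟩
      r ! suc (i ℕ.+ j)  ≈⟨ r↑ (i ℕ.+ j) ⟩
      0# ∎))

    -- The constant coefficient of the product is zero and that of `p` is not, so that of `q` is
    -- zero and `q` can be shifted down.
    cancel-X : ∀ p q r → ¬ p ! 0 ≈ 0# → mul p q ≋ mul r X → ∃[ q′ ] mul p q′ ≋ r
    cancel-X p [] r p₀≉0 e = [] , coeffwise λ i → begin
      mul p [] ! i  ≈⟨ mul-[]ʳ p !≈ i ⟩
      0#  ≈⟨ mul-[]ʳ p !≈ suc i ⟨
      mul p [] ! suc i  ≈⟨ ≋-trans e (≋-trans (mul-comm r X) (X-mul r)) !≈ suc i ⟩
      r ! i  ∎
    cancel-X p (y ∷ q) r p₀≉0 e = q , coeffwise λ i → begin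
      mul p q ! i  ≈⟨ +-identityˡ _ ⟨
      0# + mul p q ! i  ≈⟨ +-congʳ (trans (scale-! y p (suc i)) (trans (*-congʳ y≈0) (zeroˡ _))) ⟨
      map (y *_) p ! suc i + mul p q ! i  ≈⟨ add-! (map (y *_) p) (0# ∷ mul p q) (suc i) ⟨
      add (map (y *_) p) (0# ∷ mul p q) ! suc i  ≈⟨ mul-∷ʳ p y q !≈ suc i ⟨
      mul p (y ∷ q) ! suc i  ≈⟨ e′ !≈ suc i ⟩
      r ! i  ∎
      where
      e′ : mul p (y ∷ q) ≋ (0# ∷ r)
      e′ = ≋-trans e (≋-trans (mul-comm r X) (X-mul r))
      y≈0 : y ≈ 0#
      y≈0 = cancel p₀≉0 (trans (sym (mul-at-0 p (y ∷ q))) (e′ !≈ 0))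

ℤ-isDomain : IsDomain ℤ.+-*-commutativeRing
ℤ-isDomain = record
  { 1≉0 = λ ()
  ; _≈0? = ℤ._≟ (+ 0)
  ; cancel = λ {i} {j} i≢0 ij≡0 → Sum.fromInj₂ (λ i≡0 → ⊥-elim (i≢0 i≡0)) (ℤ.i*j≡0⇒i≡0∨j≡0 i ij≡0) }

-- Fields and fields of fractions

record IsField (K : CommutativeRing 0ℓ 0ℓ) : Set where
  open RingTools K
  infix 9 _⁻¹
  field
    1≉0      : ¬ 1# ≈ 0#
    _≈0?     : ∀ x → Dec (x ≈ 0#)
    _⁻¹      : Carrier → Carrier
    inverseʳ : ∀ {x} → ¬ x ≈ 0# → x * x ⁻¹ ≈ 1#

  isDomain : IsDomain K
  isDomain = record
    { 1≉0 = 1≉0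
    ; _≈0? = _≈0?
    ; cancel = λ {x} {y} x≉0 xy≈0 → begin
        y  ≈⟨ *-identityˡ y ⟨
        1# * y  ≈⟨ *-congʳ (inverseʳ x≉0) ⟨
        x * x ⁻¹ * y  ≈⟨ solve 3 (λ x i y → x :* i :* y := i :* (x :* y)) ≡.refl x (x ⁻¹) y ⟩
        x ⁻¹ * (x * y)  ≈⟨ trans (*-congˡ xy≈0) (zeroʳ _) ⟩
        0#                 ∎ }

  open IsDomain isDomain public using (cancel; *-cancelˡ; *-≉0; ^-≉0; ∏-≉0)

  -- The inverse is a total function whose value at zero is left open, so it is compatible with
  -- equality by uniqueness of inverses, away from zero.
  ⁻¹-cong : ∀ {x y} → ¬ x ≈ 0# → x ≈ y → x ⁻¹ ≈ y ⁻¹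
  ⁻¹-cong x≉0 e = *-cancelˡ x≉0 (trans (inverseʳ x≉0)
    (trans (sym (inverseʳ λ y≈0 → x≉0 (trans e y≈0))) (*-congʳ (sym e))))

  /-* : ∀ {x y} → ¬ y ≈ 0# → x * y ⁻¹ * y ≈ x
  /-* {x} {y} y≉0 = trans (solve 3 (λ x i y → x :* i :* y := x :* (y :* i)) ≡.refl x (y ⁻¹) y)
    (trans (*-congˡ (inverseʳ y≉0)) (*-identityʳ x))

module FieldOfFractions (S : CommutativeRing 0ℓ 0ℓ) (domain : IsDomain S) where

  open RingTools S
  open IsDomain domain

  record Fraction : Set where
    constructor _/_[_]
    field
      num    : Carrier
      den    : Carrier
      den≉0  : ¬ den ≈ 0#
  open Fraction

  infix 4 _≃_
  record _≃_ (x y : Fraction) : Set where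
    constructor cross
    field cross-eq : num x * den y ≈ num y * den x
  open _≃_

  ≃-trans : ∀ {x y z} → x ≃ y → y ≃ z → x ≃ z
  ≃-trans {a / b [ _ ]} {c / d [ d≉0 ]} {e / f [ _ ]} (cross p) (cross q) = cross (*-cancelˡ d≉0 (begin
    d * (a * f)  ≈⟨ solve 3 (λ d a f → d :* (a :* f) := a :* d :* f) ≡.refl d a f ⟩
    a * d * f  ≈⟨ *-congʳ p ⟩
    c * b * f  ≈⟨ solve 3 (λ c b f → c :* b :* f := c :* f :* b) ≡.refl c b f ⟩
    c * f * b  ≈⟨ *-congʳ q ⟩
    e * d * b  ≈⟨ solve 3 (λ e d b → e :* d :* b := d :* (e :* b)) ≡.refl e d b ⟩
    d * (e * b)  ∎))

  _+ᶠ_ _*ᶠ_ : Fraction → Fraction → Fraction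
  (a / b [ b≉0 ]) +ᶠ (c / d [ d≉0 ]) = (a * d + c * b) / (b * d) [ *-≉0 b≉0 d≉0 ]
  (a / b [ b≉0 ]) *ᶠ (c / d [ d≉0 ]) = (a * c) / (b * d) [ *-≉0 b≉0 d≉0 ]

  -ᶠ_ : Fraction → Fraction
  -ᶠ (a / b [ b≉0 ]) = (- a) / b [ b≉0 ]

  embed : Carrier → Fraction
  embed a = a / 1# [ 1≉0 ]

  +ᶠ-cong : ∀ {x x′ y y′} → x ≃ x′ → y ≃ y′ → x +ᶠ y ≃ x′ +ᶠ y′
  +ᶠ-cong {a / b [ _ ]} {a′ / b′ [ _ ]} {c / d [ _ ]} {c′ / d′ [ _ ]} (cross p) (cross q) = cross (begin
    (a * d + c * b) * (b′ * d′)  ≈⟨ solve 6 (λ a d c b b′ d′ → (a :* d :+ c :* b) :* (b′ :* d′) := (a :* b′) :* (d :* d′) :+ (c :* d′) :* (b :* b′)) ≡.refl a d c b b′ d′ ⟩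
    (a * b′) * (d * d′) + (c * d′) * (b * b′) ≈⟨ +-cong (*-congʳ p) (*-congʳ q) ⟩
    (a′ * b) * (d * d′) + (c′ * d) * (b * b′) ≈⟨ solve 6 (λ a′ d c′ b b′ d′ → (a′ :* b) :* (d :* d′) :+ (c′ :* d) :* (b :* b′) := (a′ :* d′ :+ c′ :* b′) :* (b :* d)) ≡.refl a′ d c′ b b′ d′ ⟩
    (a′ * d′ + c′ * b′) * (b * d)  ∎)

  *ᶠ-cong : ∀ {x x′ y y′} → x ≃ x′ → y ≃ y′ → x *ᶠ y ≃ x′ *ᶠ y′
  *ᶠ-cong {a / b [ _ ]} {a′ / b′ [ _ ]} {c / d [ _ ]} {c′ / d′ [ _ ]} (cross p) (cross q) = cross (begin
    (a * c) * (b′ * d′)  ≈⟨ solve 4 (λ a c b′ d′ → (a :* c) :* (b′ :* d′) := (a :* b′) :* (c :* d′)) ≡.refl a c b′ d′ ⟩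
    (a * b′) * (c * d′)  ≈⟨ *-cong p q ⟩
    (a′ * b) * (c′ * d)  ≈⟨ solve 4 (λ a c b′ d′ → (a :* b′) :* (c :* d′) := (a :* c) :* (b′ :* d′)) ≡.refl a′ c′ b d ⟩
    (a′ * c′) * (b * d)  ∎)

  fractionRing : CommutativeRing 0ℓ 0ℓ
  fractionRing = record
    { Carrier = Fraction
    ; _≈_ = _≃_
    ; _+_ = _+ᶠ_
    ; _*_ = _*ᶠ_
    ; -_ = -ᶠ_
    ; 0# = embed 0#
    ; 1# = embed 1#
    ; isCommutativeRing = record
      { isRing = record
        { +-isAbelianGroup = record
          { isGroup = record
            { isMonoid = record
              { isSemigroup = record
                { isMagma = record
                  { isEquivalence = record { refl = cross refl ; sym = λ p → cross (sym (cross-eq p)) ; trans = ≃-trans }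
                  ; ∙-cong = +ᶠ-cong }
                ; assoc = λ (a / b [ _ ]) (c / d [ _ ]) (e / f [ _ ]) → cross (solve 6 (λ a b c d e f →
                    ((a :* d :+ c :* b) :* f :+ e :* (b :* d)) :* (b :* (d :* f)) := (a :* (d :* f) :+ (c :* f :+ e :* d) :* b) :* ((b :* d) :* f)) ≡.refl a b c d e f) }
              ; identity = (λ (a / b [ _ ]) → cross (solve 2 (λ a b → (con (+ 0) :* b :+ a :* :1) :* b := a :* (:1 :* b)) ≡.refl a b))
                         , (λ (a / b [ _ ]) → cross (solve 2 (λ a b → (a :* :1 :+ con (+ 0) :* b) :* b := a :* (b :* :1)) ≡.refl a b)) }
            ; inverse = (λ (a / b [ _ ]) → cross (solve 2 (λ a b → (:- a :* b :+ a :* b) :* :1 := con (+ 0) :* (b :* b)) ≡.refl a b))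
                      , (λ (a / b [ _ ]) → cross (solve 2 (λ a b → (a :* b :+ :- a :* b) :* :1 := con (+ 0) :* (b :* b)) ≡.refl a b))
            ; ⁻¹-cong = λ { {a / b [ _ ]} {c / d [ _ ]} (cross p) → cross (trans (solve 2 (λ a d → :- a :* d := :- (a :* d)) ≡.refl a d)
                          (trans (-‿cong p) (solve 2 (λ c b → :- (c :* b) := :- c :* b) ≡.refl c b))) } }
          ; comm = λ (a / b [ _ ]) (c / d [ _ ]) → cross (solve 4 (λ a b c d → (a :* d :+ c :* b) :* (d :* b) := (c :* b :+ a :* d) :* (b :* d)) ≡.refl a b c d) }
        ; *-cong = *ᶠ-cong
        ; *-assoc = λ (a / b [ _ ]) (c / d [ _ ]) (e / f [ _ ]) → cross (solve 6 (λ a b c d e f →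
            (a :* c) :* e :* (b :* (d :* f)) := a :* (c :* e) :* ((b :* d) :* f)) ≡.refl a b c d e f)
        ; *-identity = (λ (a / b [ _ ]) → cross (solve 2 (λ a b → (:1 :* a) :* b := a :* (:1 :* b)) ≡.refl a b))
                     , (λ (a / b [ _ ]) → cross (solve 2 (λ a b → (a :* :1) :* b := a :* (b :* :1)) ≡.refl a b))
        ; distrib = (λ (a / b [ _ ]) (c / d [ _ ]) (e / f [ _ ]) → cross (solve 6 (λ a b c d e f →
              a :* (c :* f :+ e :* d) :* ((b :* d) :* (b :* f)) := ((a :* c) :* (b :* f) :+ (a :* e) :* (b :* d)) :* (b :* (d :* f))) ≡.refl a b c d e f))
            , (λ (a / b [ _ ]) (c / d [ _ ]) (e / f [ _ ]) → cross (solve 6 (λ a b c d e f →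
              (c :* f :+ e :* d) :* a :* ((d :* b) :* (f :* b)) := ((c :* a) :* (f :* b) :+ (e :* a) :* (d :* b)) :* ((d :* f) :* b)) ≡.refl a b c d e f)) }
      ; *-comm = λ (a / b [ _ ]) (c / d [ _ ]) → cross (solve 4 (λ a b c d → (a :* c) :* (d :* b) := (c :* a) :* (b :* d)) ≡.refl a b c d) } }

  num≈0 : ∀ {x} → x ≃ embed 0# → num x ≈ 0#
  num≈0 (cross p) = trans (sym (*-identityʳ _)) (trans p (zeroˡ _))

  ≃0 : ∀ {x} → num x ≈ 0# → x ≃ embed 0#
  ≃0 p = cross (trans (*-identityʳ _) (trans p (sym (zeroˡ _))))

  -- The decision is an argument so that `reciprocal-inverse` can argue by cases on it. Zero is sent
  -- to zero by default.
  reciprocal : (x : Fraction) → Dec (num x ≈ 0#) → Fraction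
  reciprocal x (yes _) = embed 0#
  reciprocal x (no num≉0) = den x / num x [ num≉0 ]

  reciprocal-inverse : ∀ x d → ¬ x ≃ embed 0# → x *ᶠ reciprocal x d ≃ embed 1#
  reciprocal-inverse x (yes num≈0) x≉0 = ⊥-elim (x≉0 (≃0 num≈0))
  reciprocal-inverse (a / b [ _ ]) (no num≉0) x≉0 = cross (solve 2 (λ a b → a :* b :* :1 := :1 :* (b :* a)) ≡.refl a b)

  fractionField : IsField fractionRing
  fractionField = record
    { 1≉0 = λ e → 1≉0 (num≈0 e)
    ; _≈0? = λ x → Dec.map′ ≃0 num≈0 (num x ≈0?)
    ; _⁻¹ = λ x → reciprocal x (num x ≈0?)
    ; inverseʳ = λ {x} → reciprocal-inverse x (num x ≈0?) }

  embed-isHom : IsHom S fractionRing embed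
  embed-isHom = record
    { ⟦⟧-cong = λ e → cross (*-congʳ e)
    ; +-homo = λ x y → cross (solve 2 (λ x y → (x :+ y) :* (:1 :* :1) := (x :* :1 :+ y :* :1) :* :1) ≡.refl x y)
    ; *-homo = λ x y → cross (solve 2 (λ x y → (x :* y) :* (:1 :* :1) := (x :* y) :* :1) ≡.refl x y)
    ; -‿homo = λ x → cross refl
    ; 0#-homo = cross refl
    ; 1#-homo = cross refl }

  embed-injective : ∀ {x y} → embed x ≃ embed y → x ≈ y
  embed-injective (cross p) = trans (sym (*-identityʳ _)) (trans p (*-identityʳ _))

-- Binary forms and Lagrange interpolation

module BinaryForms (R : CommutativeRing 0ℓ 0ℓ) (domain : IsDomain R) where

  open RingTools R
  open IsDomain domain

  -- Expressions rather than coefficient vectors: linear combinations of products of linear forms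
  -- are all that occurs, and with the degree in the index zeros can be counted without leading
  -- coefficients.
  data Form : ℕ → Set where
    const : Carrier → Form 0
    lin   : ∀ {d} → Carrier → Carrier → Form d → Form (suc d)
    _⊞_   : ∀ {d} → Form d → Form d → Form d
    scale : ∀ {d} → Carrier → Form d → Form d

  eval : ∀ {d} → Form d → Carrier → Carrier → Carrier
  eval (const c) u v = c
  eval (lin α β f) u v = eval f u v * (α * u + β * v)
  eval (f ⊞ g) u v = eval f u v + eval g u v
  eval (scale c f) u v = c * eval f u v

  eval-degree-0 : (f : Form 0) → ∀ u v u′ v′ → eval f u v ≈ eval f u′ v′
  eval-degree-0 (const c) u v u′ v′ = refl
  eval-degree-0 (f ⊞ g) u v u′ v′ = +-cong (eval-degree-0 f u v u′ v′) (eval-degree-0 g u v u′ v′)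
  eval-degree-0 (scale c f) u v u′ v′ = *-congˡ (eval-degree-0 f u v u′ v′)

  -- The homogeneous factor theorem for the point `(u₀ : v₀)`. The power of `v₀` on the left keeps
  -- the division inside the ring.
  divide : ∀ {d} (f : Form (suc d)) u₀ v₀ → Σ[ g ∈ Form d ] ∀ u v →
           v₀ ^ suc d * eval f u v ≈ (v₀ * u + - (u₀ * v)) * eval g u v + v ^ suc d * eval f u₀ v₀
  divide {zero} (lin α β f) u₀ v₀ = scale α f , λ u v → begin
    v₀ ^ 1 * (eval f u v * (α * u + β * v))
      ≈⟨ solve 7 (λ u v u₀ v₀ α β F → v₀ :^ 1 :* (F :* (α :* u :+ β :* v))
                 := (v₀ :* u :- u₀ :* v) :* (α :* F) :+ v :^ 1 :* (F :* (α :* u₀ :+ β :* v₀))) ≡.refl u v u₀ v₀ α β (eval f u v) ⟩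
    (v₀ * u + - (u₀ * v)) * (α * eval f u v) + v ^ 1 * (eval f u v * (α * u₀ + β * v₀))
      ≈⟨ +-congˡ (*-congˡ (*-congʳ (eval-degree-0 f u v u₀ v₀))) ⟩
    (v₀ * u + - (u₀ * v)) * (α * eval f u v) + v ^ 1 * (eval f u₀ v₀ * (α * u₀ + β * v₀)) ∎
  divide {suc d} (lin α β f) u₀ v₀ with divide f u₀ v₀
  -- Here `v₀ (α u + β v)` is split as `α (v₀ u - u₀ v) + (α u₀ + β v₀) v`. The first part is
  -- divisible at once; the second uses the quotient of `f`, with `lin 0# 1#` multiplying it by `v`.
  ... | g , e = scale (α * v₀ ^ suc d) f ⊞ scale (α * u₀ + β * v₀) (lin 0# 1# g) , λ u v → begin
    v₀ * v₀ ^ suc d * (eval f u v * (α * u + β * v))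
      ≈⟨ solve 8 (λ u v u₀ v₀ α β F w → v₀ :* w :* (F :* (α :* u :+ β :* v))
                 := (v₀ :* u :- u₀ :* v) :* (α :* w :* F) :+ (α :* u₀ :+ β :* v₀) :* v :* (w :* F)) ≡.refl u v u₀ v₀ α β (eval f u v) (v₀ ^ suc d) ⟩
    (v₀ * u + - (u₀ * v)) * (α * v₀ ^ suc d * eval f u v) + (α * u₀ + β * v₀) * v * (v₀ ^ suc d * eval f u v)
      ≈⟨ +-congˡ (*-congˡ (e u v)) ⟩
    (v₀ * u + - (u₀ * v)) * (α * v₀ ^ suc d * eval f u v)
      + (α * u₀ + β * v₀) * v * ((v₀ * u + - (u₀ * v)) * eval g u v + v ^ suc d * eval f u₀ v₀)
      ≈⟨ solve 8 (λ k u v l aF G w F₀ → k :* aF :+ l :* v :* (k :* G :+ w :* F₀)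
                 := k :* (aF :+ l :* (G :* (con (+ 0) :* u :+ :1 :* v))) :+ v :* w :* (F₀ :* l)) ≡.refl
                 (v₀ * u + - (u₀ * v)) u v (α * u₀ + β * v₀) (α * v₀ ^ suc d * eval f u v) (eval g u v) (v ^ suc d) (eval f u₀ v₀) ⟩
    (v₀ * u + - (u₀ * v)) * (α * v₀ ^ suc d * eval f u v + (α * u₀ + β * v₀) * (eval g u v * (0# * u + 1# * v)))
      + v * v ^ suc d * (eval f u₀ v₀ * (α * u₀ + β * v₀)) ∎
  divide {d} (f₁ ⊞ f₂) u₀ v₀ with divide f₁ u₀ v₀ | divide f₂ u₀ v₀
  ... | g₁ , e₁ | g₂ , e₂ = g₁ ⊞ g₂ , λ u v → begin
    v₀ ^ suc d * (eval f₁ u v + eval f₂ u v)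
      ≈⟨ trans (distribˡ _ _ _) (+-cong (e₁ u v) (e₂ u v)) ⟩
    (k u v * eval g₁ u v + v ^ suc d * eval f₁ u₀ v₀) + (k u v * eval g₂ u v + v ^ suc d * eval f₂ u₀ v₀)
      ≈⟨ solve 6 (λ k G₁ G₂ w F₁ F₂ → (k :* G₁ :+ w :* F₁) :+ (k :* G₂ :+ w :* F₂) := k :* (G₁ :+ G₂) :+ w :* (F₁ :+ F₂)) ≡.refl
           (k u v) (eval g₁ u v) (eval g₂ u v) (v ^ suc d) (eval f₁ u₀ v₀) (eval f₂ u₀ v₀) ⟩
    k u v * (eval g₁ u v + eval g₂ u v) + v ^ suc d * (eval f₁ u₀ v₀ + eval f₂ u₀ v₀) ∎
    where
    k : Carrier → Carrier → Carrier
    k u v = v₀ * u + - (u₀ * v)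
  divide {d} (scale c f) u₀ v₀ with divide f u₀ v₀
  ... | g , e = scale c g , λ u v → begin
    v₀ ^ suc d * (c * eval f u v)
      ≈⟨ solve 3 (λ w c F → w :* (c :* F) := c :* (w :* F)) ≡.refl (v₀ ^ suc d) c (eval f u v) ⟩
    c * (v₀ ^ suc d * eval f u v)
      ≈⟨ *-congˡ (e u v) ⟩
    c * ((v₀ * u + - (u₀ * v)) * eval g u v + v ^ suc d * eval f u₀ v₀)
      ≈⟨ solve 5 (λ c k G w F → c :* (k :* G :+ w :* F) := k :* (c :* G) :+ w :* (c :* F)) ≡.refl
           c (v₀ * u + - (u₀ * v)) (eval g u v) (v ^ suc d) (eval f u₀ v₀) ⟩
    (v₀ * u + - (u₀ * v)) * (c * eval g u v) + v ^ suc d * (c * eval f u₀ v₀) ∎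

  -- Division by the linear form of the last point leaves a quotient of lower degree that still
  -- vanishes at the others, since the determinants in the second hypothesis say that no two points
  -- coincide on the projective line.
  vanishing : ∀ {d} (f : Form d) (u v : ℕ → Carrier) →
              (∀ i → i ℕ.≤ d → ¬ v i ≈ 0#) →
              (∀ i j → i ℕ.< j → j ℕ.≤ d → ¬ v j * u i + - (u j * v i) ≈ 0#) →
              (∀ i → i ℕ.≤ d → eval f (u i) (v i) ≈ 0#) →
              ∀ x y → eval f x y ≈ 0#
  vanishing {zero} f u v v≉0 distinct f≈0 x y = trans (eval-degree-0 f x y (u 0) (v 0)) (f≈0 0 z≤n)
  vanishing {suc d} f u v v≉0 distinct f≈0 x y with divide f (u (suc d)) (v (suc d))
  ... | g , e = cancel (^-≉0 (suc d) (v≉0 (suc d) ℕ.≤-refl)) (begin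
    v (suc d) ^ suc d * eval f x y
      ≈⟨ e x y ⟩
    (v (suc d) * x + - (u (suc d) * y)) * eval g x y + y ^ suc d * eval f (u (suc d)) (v (suc d))
      ≈⟨ +-cong (*-congˡ (vanishing g u v (λ i i≤d → v≉0 i (ℕ.m≤n⇒m≤1+n i≤d))
                            (λ i j i<j j≤d → distinct i j i<j (ℕ.m≤n⇒m≤1+n j≤d)) g≈0 x y))
                (*-congˡ (f≈0 (suc d) ℕ.≤-refl)) ⟩
    (v (suc d) * x + - (u (suc d) * y)) * 0# + y ^ suc d * 0#
      ≈⟨ solve 2 (λ a b → a :* con (+ 0) :+ b :* con (+ 0) := con (+ 0)) ≡.refl _ (y ^ suc d) ⟩
    0# ∎)
    where
    g≈0 : ∀ i → i ℕ.≤ d → eval g (u i) (v i) ≈ 0#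
    g≈0 i i≤d = cancel (distinct i (suc d) (s≤s i≤d) ℕ.≤-refl) (begin
      k * eval g (u i) (v i)
        ≈⟨ solve 2 (λ a b → a := a :+ b :* con (+ 0)) ≡.refl _ (v i ^ suc d) ⟩
      k * eval g (u i) (v i) + v i ^ suc d * 0#
        ≈⟨ +-congˡ (*-congˡ (f≈0 (suc d) ℕ.≤-refl)) ⟨
      k * eval g (u i) (v i) + v i ^ suc d * eval f (u (suc d)) (v (suc d))
        ≈⟨ e (u i) (v i) ⟨
      v (suc d) ^ suc d * eval f (u i) (v i)
        ≈⟨ trans (*-congˡ (f≈0 i (ℕ.m≤n⇒m≤1+n i≤d))) (zeroʳ _) ⟩
      0# ∎)
      where
      k = v (suc d) * u i + - (u (suc d) * v i)

module Interpolation (K : CommutativeRing 0ℓ 0ℓ) (field′ : IsField K) where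

  open RingTools K
  open IsField field′
  open BinaryForms K isDomain

  private
    subtract : ∀ {d} → Form d → ℕ → (ℕ → Carrier) → (ℕ → Form d) → Form d
    subtract f zero c ℓ = f
    subtract f (suc n) c ℓ = subtract f n c ℓ ⊞ scale (- c n) (ℓ n)

    eval-subtract : ∀ {d} (f : Form d) n c ℓ x y →
                    eval (subtract f n c ℓ) x y ≈ eval f x y + - ∑ n (λ i → c i * eval (ℓ i) x y)
    eval-subtract f zero c ℓ x y = solve 1 (λ F → F := F :- con (+ 0)) ≡.refl _
    eval-subtract f (suc n) c ℓ x y = trans (+-congʳ (eval-subtract f n c ℓ x y))
      (solve 4 (λ F s c l → (F :- s) :+ :- c :* l := F :- (s :+ c :* l)) ≡.refl _ _ _ _)

  -- The difference of the two sides is a form of degree `d` with `d + 1` zeros. The basis forms are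
  -- not normalised, whence the inverses of their values at their own points.
  lagrange : ∀ {d} (f : Form d) (u v : ℕ → Carrier) (ℓ : ℕ → Form d) →
             (∀ i → i ℕ.≤ d → ¬ v i ≈ 0#) →
             (∀ i j → i ℕ.< j → j ℕ.≤ d → ¬ v j * u i + - (u j * v i) ≈ 0#) →
             (∀ i j → i ≢ j → i ℕ.≤ d → j ℕ.≤ d → eval (ℓ i) (u j) (v j) ≈ 0#) →
             (∀ i → i ℕ.≤ d → ¬ eval (ℓ i) (u i) (v i) ≈ 0#) →
             ∀ x y → eval f x y ≈ ∑ (suc d) (λ i → eval f (u i) (v i) * eval (ℓ i) (u i) (v i) ⁻¹ * eval (ℓ i) x y)
  lagrange {d} f u v ℓ v≉0 distinct ℓ≈0 ℓ≉0 x y = x-y≈0⇒x≈y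
    (trans (sym (eval-subtract f (suc d) c ℓ x y)) (vanishing (subtract f (suc d) c ℓ) u v v≉0 distinct root x y))
    where
    c : ℕ → Carrier
    c i = eval f (u i) (v i) * eval (ℓ i) (u i) (v i) ⁻¹
    root : ∀ j → j ℕ.≤ d → eval (subtract f (suc d) c ℓ) (u j) (v j) ≈ 0#
    root j j≤d = begin
      eval (subtract f (suc d) c ℓ) (u j) (v j)
        ≈⟨ eval-subtract f (suc d) c ℓ (u j) (v j) ⟩
      eval f (u j) (v j) + - ∑ (suc d) (λ i → c i * eval (ℓ i) (u j) (v j))
        ≈⟨ +-congˡ (-‿cong (∑-single (suc d) j (s≤s j≤d) λ i i<1+d i≢j →
             trans (*-congˡ (ℓ≈0 i j i≢j (ℕ.s≤s⁻¹ i<1+d) j≤d)) (zeroʳ _))) ⟩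
      eval f (u j) (v j) + - (c j * eval (ℓ j) (u j) (v j))
        ≈⟨ solve 3 (λ F i l → F :- F :* i :* l := F :* (:1 :- l :* i)) ≡.refl _ _ _ ⟩
      eval f (u j) (v j) * (1# + - (eval (ℓ j) (u j) (v j) * eval (ℓ j) (u j) (v j) ⁻¹))
        ≈⟨ *-congˡ (trans (+-congˡ (-‿cong (inverseʳ (ℓ≉0 j j≤d)))) (-‿inverseʳ _)) ⟩
      eval f (u j) (v j) * 0#
        ≈⟨ zeroʳ _ ⟩
      0# ∎

-- Evaluation at odd powers of q

-- In a field these two conditions make every power of `q` and every `1 - q ^ j` with `j` positive
-- invertible.
NonTorsion : (K : CommutativeRing 0ℓ 0ℓ) → CommutativeRing.Carrier K → Set
NonTorsion K q = ∀ j → ¬ (q ^ suc j ≈ 1# ⊎ q ≈ 0#)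
  where open RingTools K

module Summation (K : CommutativeRing 0ℓ 0ℓ) (isField : IsField K)
  (q : CommutativeRing.Carrier K)
  (q-free : NonTorsion K q) where

  open RingTools K
  open IsField isField

  q≉0 : ¬ q ≈ 0#
  q≉0 e = q-free 0 (inj₂ e)

  ⟨_⟩ : ℕ → Carrier
  ⟨ j ⟩ = 1# + - q ^ j

  ⟨suc⟩≉0 : ∀ j → ¬ ⟨ suc j ⟩ ≈ 0#
  ⟨suc⟩≉0 j e = q-free j (inj₁ (sym (x-y≈0⇒x≈y e)))

  q^-split : ∀ {x y} → x ℕ.≤ y → q ^ x + - q ^ y ≈ q ^ x * ⟨ y ℕ.∸ x ⟩
  q^-split {x} {y} x≤y = begin
    q ^ x + - q ^ y  ≈⟨ +-congˡ (-‿cong (^-congʳ q (≡.sym (ℕ.m+[n∸m]≡n x≤y)))) ⟩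
    q ^ x + - q ^ (x ℕ.+ (y ℕ.∸ x))  ≈⟨ +-congˡ (-‿cong (^-homo-* q x (y ℕ.∸ x))) ⟩
    q ^ x + - (q ^ x * q ^ (y ℕ.∸ x))  ≈⟨ solve 2 (λ a b → a :- a :* b := a :* (:1 :- b)) ≡.refl _ _ ⟩
    q ^ x * ⟨ y ℕ.∸ x ⟩  ∎

  ⟨⟩≉0 : ∀ {j} → 0 ℕ.< j → ¬ ⟨ j ⟩ ≈ 0#
  ⟨⟩≉0 {suc j} _ = ⟨suc⟩≉0 j

  -‿swap : ∀ {x y} → x + - y ≈ 0# → y + - x ≈ 0#
  -‿swap {x} {y} e = trans (solve 2 (λ x y → y :- x := :- (x :- y)) ≡.refl x y) (trans (-‿cong e) (solve 0 (:- con (+ 0) := con (+ 0)) ≡.refl))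

  q^-distinct : ∀ {x y} → x ≢ y → ¬ q ^ x + - q ^ y ≈ 0#
  q^-distinct {x} {y} x≢y e with ℕ.<-cmp x y
  ... | tri< x<y _ _ = *-≉0 (^-≉0 x q≉0) (⟨⟩≉0 (ℕ.m<n⇒0<n∸m x<y)) (trans (sym (q^-split (ℕ.<⇒≤ x<y))) e)
  ... | tri≈ _ x≡y _ = x≢y x≡y
  ... | tri> _ _ y<x = *-≉0 (^-≉0 y q≉0) (⟨⟩≉0 (ℕ.m<n⇒0<n∸m y<x)) (trans (sym (q^-split (ℕ.<⇒≤ y<x))) (-‿swap e))

  -- The quadratic in `a` with roots `s` and `1/s`. It is `a` times the product of `1 - a s` and
  -- `1 - s/a`, two factors that the q-Pochhammer symbols always contribute together.
  root-pair : Carrier → Carrier → Carrier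
  root-pair s a = (1# + - (a * s)) * (a + - s)

  root-pair-congˡ : ∀ {s s′} a → s ≈ s′ → root-pair s a ≈ root-pair s′ a
  root-pair-congˡ a e = *-cong (+-congˡ (-‿cong (*-congˡ e))) (+-congˡ (-‿cong e))

  root-pair-congʳ : ∀ {a a′} s → a ≈ a′ → root-pair s a ≈ root-pair s a′
  root-pair-congʳ s e = *-cong (+-congˡ (-‿cong (*-congʳ e))) (+-congʳ e)

  -- These are `(aq;q²)ₖ (q/a;q²)ₖ` and `(aq⁶;q⁶)ₖ (q⁶/a;q⁶)ₖ`, each multiplied by `a ^ k`; the two
  -- powers cancel in `term`.
  numer denom : ℕ → Carrier → Carrier
  numer k a = ∏ k λ i → root-pair (q ^ suc (2 ℕ.* i)) a
  denom k a = ∏ k λ j → root-pair (q ^ (6 ℕ.* suc j)) a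

  -- The symbols `(q;q²)` and `(q²;q²)` of length `2k`, with their factors grouped in pairs so that
  -- a step in `k` adds one factor to each product.
  odd-factors even-factors : ℕ → Carrier
  odd-factors k = ∏ k λ i → ⟨ 1 ℕ.+ 4 ℕ.* i ⟩ * ⟨ 3 ℕ.+ 4 ℕ.* i ⟩
  even-factors k = ∏ k λ i → ⟨ 2 ℕ.+ 4 ℕ.* i ⟩ * ⟨ 4 ℕ.+ 4 ℕ.* i ⟩

  even-factors≉0 : ∀ k → ¬ even-factors k ≈ 0#
  even-factors≉0 k = ∏-≉0 k λ i _ → *-≉0 (⟨suc⟩≉0 (1 ℕ.+ 4 ℕ.* i)) (⟨suc⟩≉0 (3 ℕ.+ 4 ℕ.* i))

  weight : ℕ → Carrier
  weight k = odd-factors k * even-factors k ⁻¹ * q ^ (2 ℕ.* k ℕ.* k)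

  [8_+1] : ℕ → Carrier
  [8 k +1] = ⟨ suc (8 ℕ.* k) ⟩ * ⟨ 1 ⟩ ⁻¹

  term : ℕ → Carrier → Carrier
  term k a = weight k * [8 k +1] * numer k a * denom k a ⁻¹

  q^* : ∀ c k → q ^ (c ℕ.* k) ≈ (q ^ k) ^ c
  q^* c k = trans (^-congʳ q (ℕ.*-comm c k)) (sym (^-assocʳ q k c))

  ⟨+⟩ : ∀ d c k → ⟨ d ℕ.+ c ℕ.* k ⟩ ≈ 1# + - (q ^ d * (q ^ k) ^ c)
  ⟨+⟩ d c k = +-congˡ (-‿cong (trans (^-homo-* q d (c ℕ.* k)) (*-congˡ (q^* c k))))

  -- The power `q ^ 2 * X ^ 2` is `q ^ (4 k + 2)`, the growth of `q ^ (2 k ^ 2)`.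
  -- Cross-multiplication keeps the inverses of `even-factors` away from the certificate.
  weight-suc : ∀ k → let X = (q ^ k) ^ 2 in
    weight (suc k) * ((1# + - (q ^ 2 * X ^ 2)) * (1# + - (q ^ 4 * X ^ 2)))
    ≈ weight k * ((1# + - (q * X ^ 2)) * (1# + - (q ^ 3 * X ^ 2)) * (q ^ 2 * X ^ 2))
  weight-suc k = *-cancelˡ (even-factors≉0 k) (begin
    even-factors k * (weight (suc k) * (e₁ * e₂))
      ≈⟨ solve 6 (λ E O i p e₁ e₂ → E :* (O :* i :* p :* (e₁ :* e₂)) := O :* p :* (E :* (e₁ :* e₂) :* i)) ≡.refl _ _ _ _ _ _ ⟩
    odd-factors (suc k) * q ^ (2 ℕ.* suc k ℕ.* suc k) * (even-factors k * (e₁ * e₂) * even-factors (suc k) ⁻¹)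
      ≈⟨ *-cong (*-cong (*-congˡ (*-cong (fac 1) (fac 3))) power) (trans (*-congʳ (*-congˡ (*-cong (sym (fac 2)) (sym (fac 4))))) (inverseʳ (even-factors≉0 (suc k)))) ⟩
    odd-factors k * ((1# + - (q ^ 1 * X ^ 2)) * (1# + - (q ^ 3 * X ^ 2))) * (q ^ (2 ℕ.* k ℕ.* k) * (q ^ 2 * X ^ 2)) * 1#
      ≈⟨ *-congˡ (inverseʳ (even-factors≉0 k)) ⟨
    odd-factors k * ((1# + - (q ^ 1 * X ^ 2)) * (1# + - (q ^ 3 * X ^ 2))) * (q ^ (2 ℕ.* k ℕ.* k) * (q ^ 2 * X ^ 2)) * (even-factors k * even-factors k ⁻¹)
      ≈⟨ solve 6 (λ q X O p E i → O :* ((:1 :- q :^ 1 :* X :^ 2) :* (:1 :- q :^ 3 :* X :^ 2)) :* (p :* (q :^ 2 :* X :^ 2)) :* (E :* i)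
            := E :* (O :* i :* p :* ((:1 :- q :* X :^ 2) :* (:1 :- q :^ 3 :* X :^ 2) :* (q :^ 2 :* X :^ 2)))) ≡.refl q X _ _ _ _ ⟩
    even-factors k * (weight k * ((1# + - (q * X ^ 2)) * (1# + - (q ^ 3 * X ^ 2)) * (q ^ 2 * X ^ 2))) ∎)
    where
    x = q ^ k
    X = x ^ 2
    e₁ = 1# + - (q ^ 2 * X ^ 2)
    e₂ = 1# + - (q ^ 4 * X ^ 2)
    x⁴≈X² : x ^ 4 ≈ X ^ 2
    x⁴≈X² = sym (^-assocʳ x 2 2)
    fac : ∀ d → ⟨ d ℕ.+ 4 ℕ.* k ⟩ ≈ 1# + - (q ^ d * X ^ 2)
    fac d = trans (⟨+⟩ d 4 k) (+-congˡ (-‿cong (*-congˡ x⁴≈X²)))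
    power : q ^ (2 ℕ.* suc k ℕ.* suc k) ≈ q ^ (2 ℕ.* k ℕ.* k) * (q ^ 2 * X ^ 2)
    power = begin
      q ^ (2 ℕ.* suc k ℕ.* suc k)  ≈⟨ ^-congʳ q (exponent k) ⟩
      q ^ (2 ℕ.* k ℕ.* k ℕ.+ (2 ℕ.+ 4 ℕ.* k))  ≈⟨ ^-homo-* q (2 ℕ.* k ℕ.* k) (2 ℕ.+ 4 ℕ.* k) ⟩
      q ^ (2 ℕ.* k ℕ.* k) * q ^ (2 ℕ.+ 4 ℕ.* k)  ≈⟨ *-congˡ (trans (^-homo-* q 2 (4 ℕ.* k)) (*-congˡ (trans (q^* 4 k) x⁴≈X²))) ⟩
      q ^ (2 ℕ.* k ℕ.* k) * (q ^ 2 * X ^ 2)  ∎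
      where
      exponent : ∀ k → 2 ℕ.* suc k ℕ.* suc k ≡ 2 ℕ.* k ℕ.* k ℕ.+ (2 ℕ.+ 4 ℕ.* k)
      exponent = ℕ-solve-∀

  -- A Wilf–Zeilberger certificate for the shift a ↦ a q⁶, where X stands for q²ᵏ.
  certificate : ∀ a q X → let
      u = (a * q + - X) * (a * q ^ 3 + - X) * (a * q ^ 5 + - X)
      w = (1# + - (a * q * X)) * (1# + - (a * q ^ 3 * X)) * (1# + - (a * q ^ 5 * X))
      in q * (1# + - (a ^ 2 * q ^ 6)) * (X ^ 2 * (1# + - (q * X ^ 2)) * (1# + - (q ^ 3 * X ^ 2)) * (1# + - (a * q * X)) * (a * q ^ 6 + - (q * X))
           + - (q ^ 2 * (1# + - X ^ 2) * (q ^ 2 + - X ^ 2) * (1# + - (a * q ^ 6 * X ^ 3)) * (a + - X ^ 3)))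
        ≈ q ^ 2 * (1# + - (q * X ^ 4)) * (u * (1# + - (a * q ^ 6 * X ^ 3)) + - (q ^ 3 * w * (a + - X ^ 3)))
  certificate = solve 3 (λ a q X → let
      u = (a :* q :- X) :* (a :* q :^ 3 :- X) :* (a :* q :^ 5 :- X)
      w = (:1 :- a :* q :* X) :* (:1 :- a :* q :^ 3 :* X) :* (:1 :- a :* q :^ 5 :* X)
      in q :* (:1 :- a :^ 2 :* q :^ 6) :* (X :^ 2 :* (:1 :- q :* X :^ 2) :* (:1 :- q :^ 3 :* X :^ 2) :* (:1 :- a :* q :* X) :* (a :* q :^ 6 :- q :* X)
           :- q :^ 2 :* (:1 :- X :^ 2) :* (q :^ 2 :- X :^ 2) :* (:1 :- a :* q :^ 6 :* X :^ 3) :* (a :- X :^ 3))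
        := q :^ 2 :* (:1 :- q :* X :^ 4) :* (u :* (:1 :- a :* q :^ 6 :* X :^ 3) :- q :^ 3 :* w :* (a :- X :^ 3))) ≡.refl

  -- The recurrence under `a ↦ a q⁶`

  module Recurrence (a : Carrier)
    (denom-factor≉0 : ∀ j → ¬ root-pair (q ^ (6 ℕ.* suc j)) a ≈ 0#)
    (denom-factor′≉0 : ∀ j → ¬ root-pair (q ^ (6 ℕ.* suc j)) (a * q ^ 6) ≈ 0#) where

    -- The factor common to the numerators of term k a and term k (a * q ^ 6).
    shared : ℕ → Carrier
    shared k = ∏ k λ i → (1# + - (a * q ^ suc (2 ℕ.* i))) * (a * q ^ 6 + - q ^ suc (2 ℕ.* i))

    -- The exponents in `numer` advance by 2, so a shift by `q ^ 6` moves them three places and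
    -- changes three factors at each end: `π` collects those at the beginning, `lower` and `upper`
    -- those at the end, with `X = q ^ (2 k)`.
    π : Carrier
    π = (1# + - (a * q)) * (1# + - (a * q ^ 3)) * (1# + - (a * q ^ 5))

    lower upper : Carrier → Carrier
    lower X = (a * q + - X) * (a * q ^ 3 + - X) * (a * q ^ 5 + - X)
    upper X = (1# + - (a * q * X)) * (1# + - (a * q ^ 3 * X)) * (1# + - (a * q ^ 5 * X))

    X⟨_⟩ : ℕ → Carrier
    X⟨ k ⟩ = (q ^ k) ^ 2

    q^odd : ∀ k → q ^ suc (2 ℕ.* k) ≈ q * X⟨ k ⟩
    q^odd k = *-congˡ (q^* 2 k)

    q^6suc : ∀ k → q ^ (6 ℕ.* suc k) ≈ q ^ 6 * X⟨ k ⟩ ^ 3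
    q^6suc k = trans (q^* 6 (suc k)) (solve 2 (λ q x → (q :* x) :^ 6 := q :^ 6 :* (x :^ 2) :^ 3) ≡.refl q (q ^ k))

    shared-lower : ∀ k → shared k * lower X⟨ k ⟩ ≈ - (π * X⟨ k ⟩ ^ 3 * numer k a)
    shared-lower zero = solve 2 (λ a q → let X = :1 :^ 2 in
      :1 :* ((a :* q :- X) :* (a :* q :^ 3 :- X) :* (a :* q :^ 5 :- X))
        := :- ((:1 :- a :* q) :* (:1 :- a :* q :^ 3) :* (:1 :- a :* q :^ 5) :* X :^ 3 :* :1)) ≡.refl a q
    shared-lower (suc k) = begin
      shared k * ((1# + - (a * q ^ suc (2 ℕ.* k))) * (a * q ^ 6 + - q ^ suc (2 ℕ.* k))) * lower ((q * x) ^ 2)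
        ≈⟨ *-congʳ (*-congˡ (*-cong (+-congˡ (-‿cong (*-congˡ (q^odd k)))) (+-congˡ (-‿cong (q^odd k))))) ⟩
      shared k * ((1# + - (a * (q * x ^ 2))) * (a * q ^ 6 + - (q * x ^ 2))) * lower ((q * x) ^ 2)
        ≈⟨ solve 4 (λ a q x S → let low = λ X → (a :* q :- X) :* (a :* q :^ 3 :- X) :* (a :* q :^ 5 :- X) in
             S :* ((:1 :- a :* (q :* x :^ 2)) :* (a :* q :^ 6 :- q :* x :^ 2)) :* low ((q :* x) :^ 2)
             := S :* low (x :^ 2) :* ((:1 :- a :* (q :* x :^ 2)) :* (q :^ 6 :* (a :- q :* x :^ 2)))) ≡.refl a q x (shared k) ⟩
      shared k * lower (x ^ 2) * ((1# + - (a * (q * x ^ 2))) * (q ^ 6 * (a + - (q * x ^ 2))))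
        ≈⟨ *-congʳ (shared-lower k) ⟩
      - (π * (x ^ 2) ^ 3 * numer k a) * ((1# + - (a * (q * x ^ 2))) * (q ^ 6 * (a + - (q * x ^ 2))))
        ≈⟨ solve 5 (λ a q x P N → :- (P :* (x :^ 2) :^ 3 :* N) :* ((:1 :- a :* (q :* x :^ 2)) :* (q :^ 6 :* (a :- q :* x :^ 2)))
             := :- (P :* ((q :* x) :^ 2) :^ 3 :* (N :* ((:1 :- a :* (q :* x :^ 2)) :* (a :- q :* x :^ 2))))) ≡.refl a q x π (numer k a) ⟩
      - (π * ((q * x) ^ 2) ^ 3 * (numer k a * root-pair (q * x ^ 2) a))
        ≈⟨ -‿cong (*-congˡ (*-congˡ (root-pair-congˡ a (q^odd k)))) ⟨
      - (π * ((q * x) ^ 2) ^ 3 * numer (suc k) a) ∎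
      where x = q ^ k

    shared-upper : ∀ k → numer k (a * q ^ 6) * π ≈ shared k * upper X⟨ k ⟩
    shared-upper zero = solve 2 (λ a q → let X = :1 :^ 2 in
      :1 :* ((:1 :- a :* q) :* (:1 :- a :* q :^ 3) :* (:1 :- a :* q :^ 5))
        := :1 :* ((:1 :- a :* q :* X) :* (:1 :- a :* q :^ 3 :* X) :* (:1 :- a :* q :^ 5 :* X))) ≡.refl a q
    shared-upper (suc k) = begin
      numer k (a * q ^ 6) * root-pair (q ^ suc (2 ℕ.* k)) (a * q ^ 6) * π
        ≈⟨ *-congʳ (*-congˡ (root-pair-congˡ (a * q ^ 6) (q^odd k))) ⟩
      numer k (a * q ^ 6) * root-pair (q * x ^ 2) (a * q ^ 6) * π
        ≈⟨ solve 3 (λ N r P → N :* r :* P := N :* P :* r) ≡.refl _ _ _ ⟩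
      numer k (a * q ^ 6) * π * root-pair (q * x ^ 2) (a * q ^ 6)
        ≈⟨ *-congʳ (shared-upper k) ⟩
      shared k * upper (x ^ 2) * root-pair (q * x ^ 2) (a * q ^ 6)
        ≈⟨ solve 4 (λ a q x S → let up = λ X → (:1 :- a :* q :* X) :* (:1 :- a :* q :^ 3 :* X) :* (:1 :- a :* q :^ 5 :* X) in
             S :* up (x :^ 2) :* ((:1 :- a :* q :^ 6 :* (q :* x :^ 2)) :* (a :* q :^ 6 :- q :* x :^ 2))
             := S :* ((:1 :- a :* (q :* x :^ 2)) :* (a :* q :^ 6 :- q :* x :^ 2)) :* up ((q :* x) :^ 2)) ≡.refl a q x (shared k) ⟩
      shared k * ((1# + - (a * (q * x ^ 2))) * (a * q ^ 6 + - (q * x ^ 2))) * upper ((q * x) ^ 2)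
        ≈⟨ *-congʳ (*-congˡ (*-cong (+-congˡ (-‿cong (*-congˡ (q^odd k)))) (+-congˡ (-‿cong (q^odd k))))) ⟨
      shared (suc k) * upper ((q * x) ^ 2) ∎
      where x = q ^ k

    -- The exponents in `denom` advance by 6, so the shift moves them by a single place and all but
    -- the end factors cancel.
    denom-shift : ∀ k → let Y = X⟨ k ⟩ ^ 3 in
      denom k (a * q ^ 6) * ((1# + - (a * q ^ 6)) * (a + - Y)) ≈ Y * (1# + - (a * q ^ 6 * Y)) * (a + - 1#) * denom k a
    denom-shift zero = solve 2 (λ a q → let Y = (:1 :^ 2) :^ 3 in
      :1 :* ((:1 :- a :* q :^ 6) :* (a :- Y)) := Y :* (:1 :- a :* q :^ 6 :* Y) :* (a :- :1) :* :1) ≡.refl a q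
    denom-shift (suc k) = begin
      denom k (a * q ^ 6) * root-pair (q ^ (6 ℕ.* suc k)) (a * q ^ 6) * ((1# + - (a * q ^ 6)) * (a + - Y′))
        ≈⟨ *-cong (*-congˡ (root-pair-congˡ (a * q ^ 6) (q^6suc k))) (*-congˡ (+-congˡ (-‿cong Y′≈))) ⟩
      denom k (a * q ^ 6) * root-pair (q ^ 6 * Y) (a * q ^ 6) * ((1# + - (a * q ^ 6)) * (a + - (q ^ 6 * Y)))
        ≈⟨ solve 4 (λ a q Y D → D :* ((:1 :- a :* q :^ 6 :* (q :^ 6 :* Y)) :* (a :* q :^ 6 :- q :^ 6 :* Y)) :* ((:1 :- a :* q :^ 6) :* (a :- q :^ 6 :* Y))
             := D :* ((:1 :- a :* q :^ 6) :* (a :- Y)) :* ((:1 :- a :* q :^ 6 :* (q :^ 6 :* Y)) :* (q :^ 6 :* (a :- q :^ 6 :* Y)))) ≡.refl a q Y _ ⟩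
      denom k (a * q ^ 6) * ((1# + - (a * q ^ 6)) * (a + - Y)) * ((1# + - (a * q ^ 6 * (q ^ 6 * Y))) * (q ^ 6 * (a + - (q ^ 6 * Y))))
        ≈⟨ *-congʳ (denom-shift k) ⟩
      Y * (1# + - (a * q ^ 6 * Y)) * (a + - 1#) * denom k a * ((1# + - (a * q ^ 6 * (q ^ 6 * Y))) * (q ^ 6 * (a + - (q ^ 6 * Y))))
        ≈⟨ solve 4 (λ a q Y D → Y :* (:1 :- a :* q :^ 6 :* Y) :* (a :- :1) :* D :* ((:1 :- a :* q :^ 6 :* (q :^ 6 :* Y)) :* (q :^ 6 :* (a :- q :^ 6 :* Y)))
             := (q :^ 6 :* Y) :* (:1 :- a :* q :^ 6 :* (q :^ 6 :* Y)) :* (a :- :1) :* (D :* ((:1 :- a :* (q :^ 6 :* Y)) :* (a :- q :^ 6 :* Y)))) ≡.refl a q Y _ ⟩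
      (q ^ 6 * Y) * (1# + - (a * q ^ 6 * (q ^ 6 * Y))) * (a + - 1#) * (denom k a * root-pair (q ^ 6 * Y) a)
        ≈⟨ *-cong (*-congʳ (*-cong Y′≈ (+-congˡ (-‿cong (*-congˡ Y′≈))))) (*-congˡ (root-pair-congˡ a (q^6suc k))) ⟨
      Y′ * (1# + - (a * q ^ 6 * Y′)) * (a + - 1#) * denom (suc k) a ∎
      where
      Y Y′ : Carrier
      Y = X⟨ k ⟩ ^ 3
      Y′ = X⟨ suc k ⟩ ^ 3
      Y′≈ : Y′ ≈ q ^ 6 * Y
      Y′≈ = solve 2 (λ q x → ((q :* x) :^ 2) :^ 3 := q :^ 6 :* (x :^ 2) :^ 3) ≡.refl q (q ^ k)

    x≉0 : ∀ k → ¬ X⟨ k ⟩ ^ 3 ≈ 0#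
    x≉0 k = ^-≉0 3 (^-≉0 2 (^-≉0 k q≉0))

    denom≉0 : ∀ k → ¬ denom k a ≈ 0#
    denom≉0 k = ∏-≉0 k λ j _ → denom-factor≉0 j

    denom′≉0 : ∀ k → ¬ denom k (a * q ^ 6) ≈ 0#
    denom′≉0 k = ∏-≉0 k λ j _ → denom-factor′≉0 j

    δ : ℕ → Carrier
    δ k = 1# + - (a * q ^ 6 * X⟨ k ⟩ ^ 3)

    δ≉0 : ∀ k → ¬ δ k ≈ 0#
    δ≉0 k e = denom-factor≉0 k (trans (*-congʳ (trans (+-congˡ (-‿cong (trans (*-congˡ (q^6suc k)) (sym (*-assoc _ _ _))))) e)) (zeroˡ _))

    -- `G` is the companion in the Wilf-Zeilberger pair. Its factor `1 - X ^ 2` vanishes at `k = 0`,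
    -- so telescoping has no lower boundary term. `W` is `V` divided by `δ`, a new factor of
    -- `denom (suc k)`, and serves as common measure of both terms and of `G` at `k` and `k + 1`.
    W V G : ℕ → Carrier
    W k = weight k * shared k * (X⟨ k ⟩ ^ 3 * denom k a * δ k) ⁻¹
    V k = weight k * shared k * (X⟨ k ⟩ ^ 3 * denom k a) ⁻¹
    G k = q * (1# + - (a ^ 2 * q ^ 6)) * ((1# + - X⟨ k ⟩ ^ 2) * (q ^ 2 + - X⟨ k ⟩ ^ 2) * (a + - X⟨ k ⟩ ^ 3)) * V k

    W-spec : ∀ k → W k * (X⟨ k ⟩ ^ 3 * denom k a * δ k) ≈ weight k * shared k
    W-spec k = /-* (*-≉0 (*-≉0 (x≉0 k) (denom≉0 k)) (δ≉0 k))

    V-spec : ∀ k → V k * (X⟨ k ⟩ ^ 3 * denom k a) ≈ weight k * shared k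
    V-spec k = /-* (*-≉0 (x≉0 k) (denom≉0 k))

    V≈Wδ : ∀ k → V k ≈ W k * δ k
    V≈Wδ k = *-cancelˡ (*-≉0 (x≉0 k) (denom≉0 k))
      (trans (*-comm _ _) (trans (V-spec k) (trans (sym (W-spec k))
        (solve 3 (λ W Y d → W :* (Y :* d) := Y :* (W :* d)) ≡.refl (W k) (X⟨ k ⟩ ^ 3 * denom k a) (δ k)))))

    bracket-spec : ∀ k → [8 k +1] * ⟨ 1 ⟩ ≈ 1# + - (q * X⟨ k ⟩ ^ 4)
    bracket-spec k = trans (/-* (⟨suc⟩≉0 0)) (+-congˡ (-‿cong (*-congˡ
      (trans (q^* 8 k) (solve 1 (λ x → x :^ 8 := (x :^ 2) :^ 4) ≡.refl (q ^ k))))))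

    -- Writing this term and the shifted one as multiples of the same `W k` leaves a polynomial
    -- identity in `a`, `q` and `X`, the one that `certificate` verifies.
    term-lower : ∀ k → π * (term k a * ⟨ 1 ⟩) ≈ - (W k * (1# + - (q * X⟨ k ⟩ ^ 4)) * lower X⟨ k ⟩ * δ k)
    term-lower k = *-cancelˡ (*-≉0 (x≉0 k) (denom≉0 k)) (begin
      Y * D * (π * (weight k * b * N * D ⁻¹ * ⟨ 1 ⟩))
        ≈⟨ solve 8 (λ Y D P w b N i o → Y :* D :* (P :* (w :* b :* N :* i :* o)) := w :* (b :* o) :* (P :* Y :* N) :* (D :* i)) ≡.refl Y D π (weight k) b N (D ⁻¹) ⟨ 1 ⟩ ⟩
      weight k * (b * ⟨ 1 ⟩) * (π * Y * N) * (D * D ⁻¹)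
        ≈⟨ trans (*-congˡ (inverseʳ (denom≉0 k))) (*-identityʳ _) ⟩
      weight k * (b * ⟨ 1 ⟩) * (π * Y * N)
        ≈⟨ *-congʳ (*-congˡ (bracket-spec k)) ⟩
      weight k * B * (π * Y * N)
        ≈⟨ solve 3 (λ w B Z → w :* B :* Z := :- (w :* B :* :- Z)) ≡.refl (weight k) B (π * Y * N) ⟩
      - (weight k * B * - (π * Y * N))
        ≈⟨ -‿cong (*-congˡ (shared-lower k)) ⟨
      - (weight k * B * (shared k * lower X))
        ≈⟨ solve 4 (λ w B S l → :- (w :* B :* (S :* l)) := :- (w :* S :* B :* l)) ≡.refl (weight k) B (shared k) (lower X) ⟩
      - (weight k * shared k * B * lower X)
        ≈⟨ -‿cong (*-congʳ (*-congʳ (W-spec k))) ⟨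
      - (W k * (Y * D * δ k) * B * lower X)
        ≈⟨ solve 5 (λ W Z d B l → :- (W :* (Z :* d) :* B :* l) := Z :* :- (W :* B :* l :* d)) ≡.refl (W k) (Y * D) (δ k) B (lower X) ⟩
      Y * D * - (W k * B * lower X * δ k) ∎)
      where
      X Y D N B b : Carrier
      X = X⟨ k ⟩
      Y = X ^ 3
      D = denom k a
      N = numer k a
      B = 1# + - (q * X ^ 4)
      b = [8 k +1]

    term-upper : ∀ k → π * ((1# + - a) * term k (a * q ^ 6) * ⟨ 1 ⟩)
                 ≈ - (W k * (1# + - (q * X⟨ k ⟩ ^ 4)) * upper X⟨ k ⟩ * ((1# + - (a * q ^ 6)) * (a + - X⟨ k ⟩ ^ 3)))
    term-upper k = *-cancelˡ (denom′≉0 k) (begin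
      D′ * (π * ((1# + - a) * (weight k * b * N′ * D′ ⁻¹) * ⟨ 1 ⟩))
        ≈⟨ solve 8 (λ a D P w b N i o → D :* (P :* ((:1 :- a) :* (w :* b :* N :* i) :* o)) := (:1 :- a) :* w :* (b :* o) :* (N :* P) :* (D :* i)) ≡.refl a D′ π (weight k) b N′ (D′ ⁻¹) ⟨ 1 ⟩ ⟩
      (1# + - a) * weight k * (b * ⟨ 1 ⟩) * (N′ * π) * (D′ * D′ ⁻¹)
        ≈⟨ trans (*-congˡ (inverseʳ (denom′≉0 k))) (*-identityʳ _) ⟩
      (1# + - a) * weight k * (b * ⟨ 1 ⟩) * (N′ * π)
        ≈⟨ *-cong (*-congˡ (bracket-spec k)) (shared-upper k) ⟩
      (1# + - a) * weight k * B * (shared k * upper X)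
        ≈⟨ solve 5 (λ a w B S u → (:1 :- a) :* w :* B :* (S :* u) := :- ((w :* S) :* (a :- :1) :* B :* u)) ≡.refl a (weight k) B (shared k) (upper X) ⟩
      - (weight k * shared k * (a + - 1#) * B * upper X)
        ≈⟨ -‿cong (*-congʳ (*-congʳ (*-congʳ (W-spec k)))) ⟨
      - (W k * (Y * D * δ k) * (a + - 1#) * B * upper X)
        ≈⟨ solve 7 (λ a W Y D d B u → :- (W :* (Y :* D :* d) :* (a :- :1) :* B :* u) := :- (W :* B :* u :* (Y :* d :* (a :- :1) :* D))) ≡.refl a (W k) Y D (δ k) B (upper X) ⟩
      - (W k * B * upper X * (Y * δ k * (a + - 1#) * D))
        ≈⟨ -‿cong (*-congˡ (denom-shift k)) ⟨
      - (W k * B * upper X * (D′ * ((1# + - (a * q ^ 6)) * (a + - Y))))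
        ≈⟨ solve 3 (λ Z D f → :- (Z :* (D :* f)) := D :* :- (Z :* f)) ≡.refl (W k * B * upper X) D′ _ ⟩
      D′ * - (W k * B * upper X * ((1# + - (a * q ^ 6)) * (a + - Y))) ∎)
      where
      X Y D D′ N′ B b : Carrier
      X = X⟨ k ⟩
      Y = X ^ 3
      D = denom k a
      D′ = denom k (a * q ^ 6)
      N′ = numer k (a * q ^ 6)
      B = 1# + - (q * X ^ 4)
      b = [8 k +1]

    G-suc : ∀ k → let X = X⟨ k ⟩ in
      q ^ 2 * G (suc k) ≈ W k * (q * (1# + - (a ^ 2 * q ^ 6)) *
        (X ^ 2 * (1# + - (q * X ^ 2)) * (1# + - (q ^ 3 * X ^ 2)) * (1# + - (a * q * X)) * (a * q ^ 6 + - (q * X))))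
    G-suc k = *-cancelˡ (*-≉0 (^-≉0 6 q≉0) (*-≉0 (*-≉0 (x≉0 k) (denom≉0 k)) (δ≉0 k))) (begin
      q ^ 6 * (Y * D * δ k) * (q ^ 2 * (s * ((1# + - X⟨ suc k ⟩ ^ 2) * (q ^ 2 + - X⟨ suc k ⟩ ^ 2) * (a + - X⟨ suc k ⟩ ^ 3)) * V (suc k)))
        ≈⟨ solve 7 (λ a q x s V D d → let X = x :^ 2 ; X′ = (q :* x) :^ 2 in
             q :^ 6 :* (X :^ 3 :* D :* d) :* (q :^ 2 :* (s :* ((:1 :- X′ :^ 2) :* (q :^ 2 :- X′ :^ 2) :* (a :- X′ :^ 3)) :* V))
             := q :^ 4 :* s :* ((:1 :- q :^ 2 :* X :^ 2) :* (:1 :- q :^ 4 :* X :^ 2)) :* (V :* (X′ :^ 3 :* (D :* (d :* (a :- q :^ 6 :* X :^ 3)))))) ≡.refl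
             a q (q ^ k) s (V (suc k)) D (δ k) ⟩
      q ^ 4 * s * E * (V (suc k) * (X⟨ suc k ⟩ ^ 3 * (D * (δ k * (a + - (q ^ 6 * Y))))))
        ≈⟨ *-congˡ (*-congˡ (*-congˡ (*-congˡ (*-cong (+-congˡ (-‿cong (trans (*-congˡ (q^6suc k)) (sym (*-assoc _ _ _))))) (+-congˡ (-‿cong (q^6suc k))))))) ⟨
      q ^ 4 * s * E * (V (suc k) * (X⟨ suc k ⟩ ^ 3 * denom (suc k) a))
        ≈⟨ *-congˡ (V-spec (suc k)) ⟩
      q ^ 4 * s * E * (weight (suc k) * (shared k * ((1# + - (a * q ^ suc (2 ℕ.* k))) * (a * q ^ 6 + - q ^ suc (2 ℕ.* k)))))
        ≈⟨ *-congˡ (*-congˡ (*-congˡ (*-cong (+-congˡ (-‿cong (*-congˡ (q^odd k)))) (+-congˡ (-‿cong (q^odd k)))))) ⟩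
      q ^ 4 * s * E * (weight (suc k) * (shared k * F))
        ≈⟨ solve 6 (λ q s E w S F → q :^ 4 :* s :* E :* (w :* (S :* F)) := (w :* E) :* (q :^ 4 :* s :* S :* F)) ≡.refl q s E (weight (suc k)) (shared k) F ⟩
      weight (suc k) * E * (q ^ 4 * s * shared k * F)
        ≈⟨ *-congʳ (weight-suc k) ⟩
      weight k * (O * (q ^ 2 * X ^ 2)) * (q ^ 4 * s * shared k * F)
        ≈⟨ solve 7 (λ q w O X s S F → w :* (O :* (q :^ 2 :* X :^ 2)) :* (q :^ 4 :* s :* S :* F) := (w :* S) :* (q :^ 6 :* s :* (X :^ 2 :* O :* F))) ≡.refl q (weight k) O X s (shared k) F ⟩
      weight k * shared k * (q ^ 6 * s * (X ^ 2 * O * F))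
        ≈⟨ *-congʳ (W-spec k) ⟨
      W k * (Y * D * δ k) * (q ^ 6 * s * (X ^ 2 * O * F))
        ≈⟨ solve 6 (λ a q X W Z s → let o₁ = :1 :- q :* X :^ 2 ; o₂ = :1 :- q :^ 3 :* X :^ 2
                                        f₁ = :1 :- a :* (q :* X) ; f₁′ = :1 :- a :* q :* X ; f₂ = a :* q :^ 6 :- q :* X in
             W :* Z :* (q :^ 6 :* s :* (X :^ 2 :* (o₁ :* o₂) :* (f₁ :* f₂)))
             := q :^ 6 :* Z :* (W :* (s :* (X :^ 2 :* o₁ :* o₂ :* f₁′ :* f₂)))) ≡.refl a q X (W k) (Y * D * δ k) s ⟩
      q ^ 6 * (Y * D * δ k) * (W k * (s * (X ^ 2 * (1# + - (q * X ^ 2)) * (1# + - (q ^ 3 * X ^ 2)) * (1# + - (a * q * X)) * (a * q ^ 6 + - (q * X))))) ∎)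
      where
      X Y D s E O F : Carrier
      X = X⟨ k ⟩
      Y = X ^ 3
      D = denom k a
      s = q * (1# + - (a ^ 2 * q ^ 6))
      E = (1# + - (q ^ 2 * X ^ 2)) * (1# + - (q ^ 4 * X ^ 2))
      O = (1# + - (q * X ^ 2)) * (1# + - (q ^ 3 * X ^ 2))
      F = (1# + - (a * (q * X))) * (a * q ^ 6 + - (q * X))

    -- The prefactors are chosen for `a = q ^ m`, where `1 - a` and `1 - a q⁶` become `⟨ m ⟩` and
    -- `⟨ m + 6 ⟩`: the recurrence then transports the sum divided by its expected factor `⟨ m ⟩`.
    -- Multiplication by `π` clears what `shared-lower` and `shared-upper` introduce.
    telescope : ∀ k → π * (q ^ 3 * ((1# + - a) * term k (a * q ^ 6) * ⟨ 1 ⟩) + - ((1# + - (a * q ^ 6)) * (term k a * ⟨ 1 ⟩)))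
                ≈ (1# + - (a * q ^ 6)) * (G (suc k) + - G k)
    telescope k = *-cancelˡ (^-≉0 2 q≉0) (begin
      q ^ 2 * (π * (q ^ 3 * T′ + - ((1# + - (a * q ^ 6)) * T)))
        ≈⟨ solve 5 (λ q P T′ f T → q :^ 2 :* (P :* (q :^ 3 :* T′ :- f :* T)) := q :^ 2 :* (q :^ 3 :* (P :* T′) :- f :* (P :* T))) ≡.refl q π T′ _ T ⟩
      q ^ 2 * (q ^ 3 * (π * T′) + - ((1# + - (a * q ^ 6)) * (π * T)))
        ≈⟨ *-congˡ (+-cong (*-congˡ (term-upper k)) (-‿cong (*-congˡ (term-lower k)))) ⟩
      q ^ 2 * (q ^ 3 * - (W k * B * upper X * ((1# + - (a * q ^ 6)) * (a + - X ^ 3))) + - ((1# + - (a * q ^ 6)) * - (W k * B * lower X * δ k)))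
        ≈⟨ solve 8 (λ q W B u f g l d → q :^ 2 :* (q :^ 3 :* :- (W :* B :* u :* (f :* g)) :- f :* :- (W :* B :* l :* d))
             := f :* (W :* (q :^ 2 :* B :* (l :* d :- q :^ 3 :* u :* g)))) ≡.refl q (W k) B (upper X) (1# + - (a * q ^ 6)) (a + - X ^ 3) (lower X) (δ k) ⟩
      (1# + - (a * q ^ 6)) * (W k * (q ^ 2 * B * (lower X * δ k + - (q ^ 3 * upper X * (a + - X ^ 3)))))
        ≈⟨ *-congˡ (*-congˡ (certificate a q X)) ⟨
      (1# + - (a * q ^ 6)) * (W k * (s * (Z + - (q ^ 2 * (1# + - X ^ 2) * (q ^ 2 + - X ^ 2) * δ k * (a + - X ^ 3)))))
        ≈⟨ solve 9 (λ f W s Z q e₁ e₂ d g → f :* (W :* (s :* (Z :- q :^ 2 :* e₁ :* e₂ :* d :* g)))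
             := f :* (W :* (s :* Z) :- q :^ 2 :* (s :* (e₁ :* e₂ :* g) :* (W :* d)))) ≡.refl
             (1# + - (a * q ^ 6)) (W k) s Z q (1# + - X ^ 2) (q ^ 2 + - X ^ 2) (δ k) (a + - X ^ 3) ⟩
      (1# + - (a * q ^ 6)) * (W k * (s * Z) + - (q ^ 2 * (s * ((1# + - X ^ 2) * (q ^ 2 + - X ^ 2) * (a + - X ^ 3)) * (W k * δ k))))
        ≈⟨ *-congˡ (+-cong (G-suc k) (-‿cong (*-congˡ (*-congˡ (V≈Wδ k))))) ⟨
      (1# + - (a * q ^ 6)) * (q ^ 2 * G (suc k) + - (q ^ 2 * G k))
        ≈⟨ solve 4 (λ f q g h → f :* (q :^ 2 :* g :- q :^ 2 :* h) := q :^ 2 :* (f :* (g :- h))) ≡.refl _ q _ _ ⟩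
      q ^ 2 * ((1# + - (a * q ^ 6)) * (G (suc k) + - G k)) ∎)
      where
      X T T′ B s Z : Carrier
      X = X⟨ k ⟩
      T = term k a * ⟨ 1 ⟩
      T′ = (1# + - a) * term k (a * q ^ 6) * ⟨ 1 ⟩
      B = 1# + - (q * X ^ 4)
      s = q * (1# + - (a ^ 2 * q ^ 6))
      Z = X ^ 2 * (1# + - (q * X ^ 2)) * (1# + - (q ^ 3 * X ^ 2)) * (1# + - (a * q * X)) * (a * q ^ 6 + - (q * X))

    telescope-sum : ∀ n → π * (q ^ 3 * ((1# + - a) * ∑ n (λ k → term k (a * q ^ 6)) * ⟨ 1 ⟩) + - ((1# + - (a * q ^ 6)) * (∑ n (λ k → term k a) * ⟨ 1 ⟩)))
                    ≈ (1# + - (a * q ^ 6)) * G n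
    telescope-sum zero = solve 7 (λ a q P o e₂ e₃ V → let z = con (+ 0) in
      P :* (q :^ 3 :* ((:1 :- a) :* z :* o) :- (:1 :- a :* q :^ 6) :* (z :* o))
        := (:1 :- a :* q :^ 6) :* (q :* (:1 :- a :^ 2 :* q :^ 6) :* ((:1 :- (:1 :^ 2) :^ 2) :* e₂ :* e₃) :* V)) ≡.refl a q π ⟨ 1 ⟩ _ _ (V 0)
    telescope-sum (suc n) = begin
      π * (q ^ 3 * ((1# + - a) * (S′ + t′) * ⟨ 1 ⟩) + - (f * ((S + t) * ⟨ 1 ⟩)))
        ≈⟨ solve 9 (λ P q b S′ t′ o f S t → P :* (q :^ 3 :* (b :* (S′ :+ t′) :* o) :- f :* ((S :+ t) :* o))
             := P :* (q :^ 3 :* (b :* S′ :* o) :- f :* (S :* o)) :+ P :* (q :^ 3 :* (b :* t′ :* o) :- f :* (t :* o))) ≡.refl π q (1# + - a) S′ t′ ⟨ 1 ⟩ f S t ⟩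
      π * (q ^ 3 * ((1# + - a) * S′ * ⟨ 1 ⟩) + - (f * (S * ⟨ 1 ⟩))) + π * (q ^ 3 * ((1# + - a) * t′ * ⟨ 1 ⟩) + - (f * (t * ⟨ 1 ⟩)))
        ≈⟨ +-cong (telescope-sum n) (telescope n) ⟩
      f * G n + f * (G (suc n) + - G n)
        ≈⟨ solve 3 (λ f g h → f :* g :+ f :* (h :- g) := f :* h) ≡.refl f (G n) (G (suc n)) ⟩
      f * G (suc n) ∎
      where
      f S S′ t t′ : Carrier
      f = 1# + - (a * q ^ 6)
      S = ∑ n (λ k → term k a)
      S′ = ∑ n (λ k → term k (a * q ^ 6))
      t = term n a
      t′ = term n (a * q ^ 6)

    -- The upper boundary term `G n` contains `shared n`, which vanishes as soon as the shifted sum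
    -- terminates before `n`.
    sum-shift : ∀ n → ¬ π ≈ 0# → shared n ≈ 0# →
      q ^ 3 * ((1# + - a) * ∑ n (λ k → term k (a * q ^ 6)) * ⟨ 1 ⟩) ≈ (1# + - (a * q ^ 6)) * (∑ n (λ k → term k a) * ⟨ 1 ⟩)
    sum-shift n π≉0 shared≈0 = x-y≈0⇒x≈y (cancel π≉0 (trans (telescope-sum n)
      (trans (*-congˡ (*-congˡ (*-congʳ (trans (*-congˡ shared≈0) (zeroʳ _)))))
        (solve 3 (λ f s i → f :* (s :* (con (+ 0) :* i)) := con (+ 0)) ≡.refl _ _ _))))

-- The nontrivial character modulo 3. The recurrence produces the sign in this periodic form;
-- `jacobi-3-χ` identifies it with the Jacobi symbol.
χ : ℕ → ℤ
χ 0 = + 0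
χ 1 = + 1
χ 2 = -[1+ 0 ]
χ (suc (suc (suc n))) = χ n

-- Parity keeps the points `q ^ (2 i + 1)`, and `qⁿ` among them, away from the zeros of `denom`.
odd≢6* : ∀ i j → suc (2 ℕ.* i) ≢ 6 ℕ.* j
odd≢6* i j e = ℕ.even≢odd (3 ℕ.* j) i (≡.trans (≡.sym (ℕ.*-assoc 2 3 j)) (≡.sym e))

-- Values of the terminating sums

module Evaluation (K : CommutativeRing 0ℓ 0ℓ) (isField : IsField K)
  (q : CommutativeRing.Carrier K)
  (q-free : NonTorsion K q) where

  open RingTools K
  open IsField isField
  open Summation K isField q q-free

  1-qˣqʸ : ∀ x y → 1# + - (q ^ x * q ^ y) ≈ ⟨ x ℕ.+ y ⟩
  1-qˣqʸ x y = +-congˡ (-‿cong (sym (^-homo-* q x y)))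

  denom-factor≉0 : ∀ i j → ¬ root-pair (q ^ (6 ℕ.* suc j)) (q ^ suc (2 ℕ.* i)) ≈ 0#
  denom-factor≉0 i j = *-≉0
    (λ e → ⟨suc⟩≉0 (2 ℕ.* i ℕ.+ 6 ℕ.* suc j) (trans (sym (1-qˣqʸ (suc (2 ℕ.* i)) (6 ℕ.* suc j))) e))
    (q^-distinct (odd≢6* i (suc j)))

  denom-at-odd≉0 : ∀ k i → ¬ denom k (q ^ suc (2 ℕ.* i)) ≈ 0#
  denom-at-odd≉0 k i = ∏-≉0 k λ j _ → denom-factor≉0 i j

  term-cong : ∀ k {a a′} → ¬ denom k a ≈ 0# → a ≈ a′ → term k a ≈ term k a′
  term-cong k D≉0 e = *-cong
    (*-congˡ (∏-cong k λ i _ → root-pair-congʳ (q ^ suc (2 ℕ.* i)) e))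
    (⁻¹-cong D≉0 (∏-cong k λ j _ → root-pair-congʳ (q ^ (6 ℕ.* suc j)) e))

  term-vanish : ∀ i k → i ℕ.< k → term k (q ^ suc (2 ℕ.* i)) ≈ 0#
  term-vanish i k i<k = trans (*-congʳ (trans (*-congˡ (∏-zero k i i<k
    (trans (*-congˡ (-‿inverseʳ _)) (zeroʳ _)))) (zeroʳ _))) (zeroˡ _)

  term-spec : ∀ k a → ¬ denom k a ≈ 0# →
    term k a * (⟨ 1 ⟩ * even-factors k * denom k a) ≈ odd-factors k * q ^ (2 ℕ.* k ℕ.* k) * ⟨ suc (8 ℕ.* k) ⟩ * numer k a
  term-spec k a D≉0 = begin
    term k a * (⟨ 1 ⟩ * even-factors k * denom k a)
      ≈⟨ solve 10 (λ O E iE p B o io N D iD → (O :* iE :* p) :* (B :* io) :* N :* iD :* (o :* E :* D) := O :* p :* B :* N :* ((E :* iE) :* (o :* io) :* (D :* iD))) ≡.refl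
           (odd-factors k) (even-factors k) _ _ _ ⟨ 1 ⟩ _ _ (denom k a) _ ⟩
    odd-factors k * q ^ (2 ℕ.* k ℕ.* k) * ⟨ suc (8 ℕ.* k) ⟩ * numer k a * ((even-factors k * even-factors k ⁻¹) * (⟨ 1 ⟩ * ⟨ 1 ⟩ ⁻¹) * (denom k a * denom k a ⁻¹))
      ≈⟨ *-congˡ (*-cong (*-cong (inverseʳ (even-factors≉0 k)) (inverseʳ (⟨suc⟩≉0 0))) (inverseʳ D≉0)) ⟩
    odd-factors k * q ^ (2 ℕ.* k ℕ.* k) * ⟨ suc (8 ℕ.* k) ⟩ * numer k a * (1# * 1# * 1#)
      ≈⟨ solve 1 (λ x → x :* (:1 :* :1 :* :1) := x) ≡.refl _ ⟩
    odd-factors k * q ^ (2 ℕ.* k ℕ.* k) * ⟨ suc (8 ℕ.* k) ⟩ * numer k a ∎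

  ⟨1⟩*term-0 : ∀ a → term 0 a * ⟨ 1 ⟩ ≈ ⟨ 1 ⟩
  ⟨1⟩*term-0 a = trans (solve 2 (λ t o → t :* o := t :* (o :* :1 :* :1)) ≡.refl _ _)
    (trans (term-spec 0 a 1≉0) (solve 1 (λ q → :1 :* q :^ 0 :* (:1 :- q :^ 1) :* :1 := :1 :- q :^ 1) ≡.refl q))

  truncated : ∀ n i → i ℕ.< n → ∑ n (λ k → term k (q ^ suc (2 ℕ.* i))) ≈ ∑ (suc i) (λ k → term k (q ^ suc (2 ℕ.* i)))
  truncated n i i<n = ∑-truncate i<n (term-vanish i)

  -- The shift by `q ^ 6` raises `i` by 3, so `i = 0, 1, 2` are summed directly and yield the signs
  -- 1, 0, -1; the step then follows from `sum-shift` and the periodicity of `χ`. The factors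
  -- `q ^ i` and `⟨ 1 ⟩` avoid division.
  value : ∀ i → q ^ i * (∑ (suc i) (λ k → term k (q ^ suc (2 ℕ.* i))) * ⟨ 1 ⟩) ≈ fromℤ (χ (suc (2 ℕ.* i))) * ⟨ suc (2 ℕ.* i) ⟩
  value 0 = begin
    1# * ((0# + term 0 (q ^ 1)) * ⟨ 1 ⟩)  ≈⟨ solve 2 (λ t o → :1 :* ((con (+ 0) :+ t) :* o) := t :* o) ≡.refl _ _ ⟩
    term 0 (q ^ 1) * ⟨ 1 ⟩  ≈⟨ ⟨1⟩*term-0 (q ^ 1) ⟩
    ⟨ 1 ⟩  ≈⟨ *-identityˡ _ ⟨
    1# * ⟨ 1 ⟩  ∎
  value 1 = *-cancelˡ (*-≉0 (even-factors≉0 1) (denom-at-odd≉0 1 1)) (begin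
    E * D * (q ^ 1 * ((0# + term 0 a + term 1 a) * ⟨ 1 ⟩))
      ≈⟨ solve 6 (λ E D q t₀ t₁ o → E :* D :* (q :^ 1 :* ((con (+ 0) :+ t₀ :+ t₁) :* o)) := q :* (t₀ :* o :* (E :* D) :+ t₁ :* (o :* E :* D))) ≡.refl E D q _ _ _ ⟩
    q * (term 0 a * ⟨ 1 ⟩ * (E * D) + term 1 a * (⟨ 1 ⟩ * E * D))
      ≈⟨ *-congˡ (+-cong (*-congʳ (⟨1⟩*term-0 a)) (term-spec 1 a (denom-at-odd≉0 1 1))) ⟩
    q * (⟨ 1 ⟩ * (E * D) + odd-factors 1 * q ^ 2 * ⟨ 9 ⟩ * numer 1 a)
      ≈⟨ solve 1 (λ q → let
           a = q :^ 3
           ⟨_⟩′ = λ k → :1 :- q :^ k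
           pair = λ k → (:1 :- a :* q :^ k) :* (a :- q :^ k)
           E = :1 :* (⟨ 2 ⟩′ :* ⟨ 4 ⟩′)
           D = :1 :* pair 6
           in q :* (⟨ 1 ⟩′ :* (E :* D) :+ (:1 :* (⟨ 1 ⟩′ :* ⟨ 3 ⟩′)) :* q :^ 2 :* ⟨ 9 ⟩′ :* (:1 :* pair 1))
           := E :* D :* (con (+ 0) :* ⟨ 3 ⟩′)) ≡.refl q ⟩
    E * D * (0# * ⟨ 3 ⟩) ∎)
    where
    a E D : Carrier
    a = q ^ 3
    E = even-factors 1
    D = denom 1 a
  value 2 = *-cancelˡ (*-≉0 (even-factors≉0 2) (denom-at-odd≉0 2 2)) (begin
    E * e * (D * d) * (q ^ 2 * ((0# + term 0 a + term 1 a + term 2 a) * ⟨ 1 ⟩))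
      ≈⟨ solve 9 (λ E e D d q t₀ t₁ t₂ o → E :* e :* (D :* d) :* (q :^ 2 :* ((con (+ 0) :+ t₀ :+ t₁ :+ t₂) :* o))
           := q :^ 2 :* (t₀ :* o :* (E :* e :* (D :* d)) :+ t₁ :* (o :* E :* D) :* (e :* d) :+ t₂ :* (o :* (E :* e) :* (D :* d)))) ≡.refl E e D d q _ _ _ _ ⟩
    q ^ 2 * (term 0 a * ⟨ 1 ⟩ * (E * e * (D * d)) + term 1 a * (⟨ 1 ⟩ * E * D) * (e * d) + term 2 a * (⟨ 1 ⟩ * (E * e) * (D * d)))
      ≈⟨ *-congˡ (+-cong (+-cong (*-congʳ (⟨1⟩*term-0 a)) (*-congʳ (term-spec 1 a (denom-at-odd≉0 1 2)))) (term-spec 2 a (denom-at-odd≉0 2 2))) ⟩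
    q ^ 2 * (⟨ 1 ⟩ * (E * e * (D * d)) + odd-factors 1 * q ^ 2 * ⟨ 9 ⟩ * numer 1 a * (e * d) + odd-factors 2 * q ^ 8 * ⟨ 17 ⟩ * numer 2 a)
      ≈⟨ solve 1 (λ q → let
           a = q :^ 5
           ⟨_⟩′ = λ k → :1 :- q :^ k
           pair = λ k → (:1 :- a :* q :^ k) :* (a :- q :^ k)
           E = :1 :* (⟨ 2 ⟩′ :* ⟨ 4 ⟩′)
           e = ⟨ 6 ⟩′ :* ⟨ 8 ⟩′
           D = :1 :* pair 6
           d = pair 12
           O = :1 :* (⟨ 1 ⟩′ :* ⟨ 3 ⟩′)
           in q :^ 2 :* (⟨ 1 ⟩′ :* (E :* e :* (D :* d)) :+ O :* q :^ 2 :* ⟨ 9 ⟩′ :* (:1 :* pair 1) :* (e :* d)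
                :+ O :* (⟨ 5 ⟩′ :* ⟨ 7 ⟩′) :* q :^ 8 :* ⟨ 17 ⟩′ :* (:1 :* pair 1 :* pair 3))
           := E :* e :* (D :* d) :* (:- :1 :* ⟨ 5 ⟩′)) ≡.refl q ⟩
    E * e * (D * d) * (- 1# * ⟨ 5 ⟩) ∎)
    where
    a E e D d : Carrier
    a = q ^ 5
    E = even-factors 1
    e = ⟨ 6 ⟩ * ⟨ 8 ⟩
    D = denom 1 a
    d = root-pair (q ^ 12) a
  value (suc (suc (suc i))) = *-cancelˡ (⟨suc⟩≉0 (2 ℕ.* i)) (begin
    ⟨ m ⟩ * (q * (q * (q * q ^ i)) * (S′ * ⟨ 1 ⟩))
      ≈⟨ solve 5 (λ a q p S o → (:1 :- a) :* (q :* (q :* (q :* p)) :* (S :* o)) := p :* (q :^ 3 :* ((:1 :- a) :* S :* o))) ≡.refl (q ^ m) q (q ^ i) _ _ ⟩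
    q ^ i * (q ^ 3 * ((1# + - q ^ m) * S′ * ⟨ 1 ⟩))
      ≈⟨ *-congˡ (*-congˡ (*-congʳ (*-congˡ (∑-cong n λ k _ → term-cong k (denom-at-odd≉0 k (3 ℕ.+ i)) q^m′)))) ⟩
    q ^ i * (q ^ 3 * ((1# + - q ^ m) * ∑ n (λ k → term k (q ^ m * q ^ 6)) * ⟨ 1 ⟩))
      ≈⟨ *-congˡ (Recurrence.sum-shift (q ^ m) (denom-factor≉0 i) factor′≉0 n π≉0 shared≈0) ⟩
    q ^ i * ((1# + - (q ^ m * q ^ 6)) * (∑ n (λ k → term k (q ^ m)) * ⟨ 1 ⟩))
      ≈⟨ *-congˡ (*-cong (+-congˡ (-‿cong (sym q^m′))) (*-congʳ (truncated n i (s≤s (ℕ.m≤n+m i 3))))) ⟩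
    q ^ i * (⟨ m′ ⟩ * (∑ (suc i) (λ k → term k (q ^ m)) * ⟨ 1 ⟩))
      ≈⟨ solve 3 (λ p f S → p :* (f :* S) := f :* (p :* S)) ≡.refl _ _ _ ⟩
    ⟨ m′ ⟩ * (q ^ i * (∑ (suc i) (λ k → term k (q ^ m)) * ⟨ 1 ⟩))
      ≈⟨ *-congˡ (value i) ⟩
    ⟨ m′ ⟩ * (fromℤ (χ m) * ⟨ m ⟩)
      ≈⟨ solve 3 (λ f c g → f :* (c :* g) := g :* (c :* f)) ≡.refl _ _ _ ⟩
    ⟨ m ⟩ * (fromℤ (χ m) * ⟨ m′ ⟩)
      ≈⟨ *-congˡ (*-congʳ (reflexive (≡.cong (λ k → fromℤ (χ k)) m′≡))) ⟨
    ⟨ m ⟩ * (fromℤ (χ m′) * ⟨ m′ ⟩) ∎)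
    where
    m m′ n : ℕ
    m = suc (2 ℕ.* i)
    m′ = suc (2 ℕ.* (3 ℕ.+ i))
    -- The sum at `q ^ m′` ends with `k = 3 + i`. The sum at `q ^ m` has ended before, and the
    -- factor of index `3 + i` makes `shared n` vanish.
    n = 4 ℕ.+ i
    S′ : Carrier
    S′ = ∑ n (λ k → term k (q ^ m′))
    m′≡ : m′ ≡ 6 ℕ.+ m
    m′≡ = ≡.trans (≡.cong suc (ℕ.*-distribˡ-+ 2 3 i)) (≡.sym (ℕ.+-suc 6 (2 ℕ.* i)))
    q^m′ : q ^ m′ ≈ q ^ m * q ^ 6
    q^m′ = trans (^-congʳ q m′≡) (trans (^-homo-* q 6 m) (*-comm _ _))
    factor′≉0 : ∀ j → ¬ root-pair (q ^ (6 ℕ.* suc j)) (q ^ m * q ^ 6) ≈ 0#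
    factor′≉0 j e = denom-factor≉0 (3 ℕ.+ i) j (trans (root-pair-congʳ (q ^ (6 ℕ.* suc j)) q^m′) e)
    open Recurrence (q ^ m) (denom-factor≉0 i) factor′≉0 using (π; shared)
    π≉0 : ¬ π ≈ 0#
    π≉0 = *-≉0 (*-≉0 (λ e → factor 1 (trans (+-congˡ (-‿cong (*-congˡ (*-identityʳ q)))) e)) (factor 3)) (factor 5)
      where
      factor : ∀ j → ¬ 1# + - (q ^ m * q ^ j) ≈ 0#
      factor j e = ⟨suc⟩≉0 (2 ℕ.* i ℕ.+ j) (trans (sym (1-qˣqʸ m j)) e)
    shared≈0 : shared n ≈ 0#
    shared≈0 = ∏-zero n (3 ℕ.+ i) ℕ.≤-refl (trans (*-congˡ (trans (+-congʳ (sym q^m′)) (-‿inverseʳ _))) (zeroʳ _))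

-- Transport along ring homomorphisms

module Homomorphism {A B : CommutativeRing 0ℓ 0ℓ} {f : CommutativeRing.Carrier A → CommutativeRing.Carrier B}
                    (hom : IsHom A B f) where

  open IsHom hom public
  private
    module A = RingTools A
    open RingTools B

  ^-homo : ∀ x n → f (x A.^ n) ≈ f x ^ n
  ^-homo x zero = 1#-homo
  ^-homo x (suc n) = trans (*-homo _ _) (*-congˡ (^-homo x n))

  ∑-homo : ∀ n g → f (A.∑ n g) ≈ ∑ n (f ∘ g)
  ∑-homo zero g = 0#-homo
  ∑-homo (suc n) g = trans (+-homo _ _) (+-congʳ (∑-homo n g))

  ∏-homo : ∀ n g → f (A.∏ n g) ≈ ∏ n (f ∘ g)
  ∏-homo zero g = 1#-homo
  ∏-homo (suc n) g = trans (*-homo _ _) (*-congʳ (∏-homo n g))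

  []-homo : ∀ n x → f (A.[ n ] x) ≈ [ n ] (f x)
  []-homo n x = trans (∑-homo n (x A.^_)) (∑-cong n λ i _ → ^-homo x i)

  fromℕ-homo : ∀ n → f (A.fromℕ n) ≈ fromℕ n
  fromℕ-homo zero = 0#-homo
  fromℕ-homo (suc n) = trans (⟦⟧-cong (A.fromℕ-suc n)) (trans (+-homo _ _)
    (trans (+-cong 1#-homo (fromℕ-homo n)) (sym (fromℕ-suc n))))

  fromℤ-homo : ∀ i → f (A.fromℤ i) ≈ fromℤ i
  fromℤ-homo (+ n) = fromℕ-homo n
  fromℤ-homo -[1+ n ] = trans (-‿homo _) (-‿cong (fromℕ-homo (suc n)))

∘-isHom : ∀ {A B C : CommutativeRing 0ℓ 0ℓ} {f g} → IsHom A B f → IsHom B C g → IsHom A C (g ∘ f)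
∘-isHom {C = C} F G = record
  { ⟦⟧-cong = G.⟦⟧-cong ∘ F.⟦⟧-cong
  ; +-homo = λ x y → trans (G.⟦⟧-cong (F.+-homo x y)) (G.+-homo _ _)
  ; *-homo = λ x y → trans (G.⟦⟧-cong (F.*-homo x y)) (G.*-homo _ _)
  ; -‿homo = λ x → trans (G.⟦⟧-cong (F.-‿homo x)) (G.-‿homo _)
  ; 0#-homo = trans (G.⟦⟧-cong F.0#-homo) G.0#-homo
  ; 1#-homo = trans (G.⟦⟧-cong F.1#-homo) G.1#-homo }
  where
  open CommutativeRing C using (trans)
  module F = IsHom F
  module G = IsHom G

-- Localisation at [ n ]

-- The greatest common divisor, sealed so that conversion checking never evaluates it.
abstract

  common : ℕ → ℕ → ℕ
  common = gcd

  common∣ˡ : ∀ m n → common m n ∣ m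
  common∣ˡ = gcd[m,n]∣m

  common∣ʳ : ∀ m n → common m n ∣ n
  common∣ʳ = gcd[m,n]∣n

  common-greatest : ∀ {m n c} → c ∣ m → c ∣ n → c ∣ common m n
  common-greatest = gcd-greatest

-- `R`, `S` and `K` stand for ℤ[q], ℤ[a , q] and the field of fractions of the latter. Denominators
-- are sought in `R`, where `[ n ] x` lives.
module Localisation {R S K : CommutativeRing 0ℓ 0ℓ}
  {κ : CommutativeRing.Carrier R → CommutativeRing.Carrier S}
  {ι : CommutativeRing.Carrier S → CommutativeRing.Carrier K}
  (κ-hom : IsHom R S κ) (ι-hom : IsHom S K ι) (isField : IsField K)
  (x : CommutativeRing.Carrier R)
  (q-free : NonTorsion K (ι (κ x)))
  (n : ℕ) (0<n : 0 ℕ.< n) where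

  private
    module R = RingTools R
    module S = RingTools S
    module ι = Homomorphism ι-hom
    module η = Homomorphism (∘-isHom κ-hom ι-hom)
  open RingTools K
  open IsField isField

  η : R.Carrier → Carrier
  η = ι ∘ κ

  q : Carrier
  q = η x

  open Summation K isField q q-free using (⟨_⟩; ⟨⟩≉0; q≉0; q^-split; q^-distinct; -‿swap)

  -- Denominators coprime to [ n ] x, witnessed by a Bézout identity up to a positive integer.
  record Good (E : R.Carrier) : Set where
    field
      {u v}   : R.Carrier
      {c}     : ℕ
      bezout  : E R.* u R.+ R.[ n ] x R.* v R.≈ R.fromℕ (suc c)
      nonzero : ¬ η E ≈ 0#

  good-1 : Good R.1#
  good-1 = record
    { c = 0
    ; bezout = R.solve 1 (λ N → R.:1 R.:* R.:1 R.:+ N R.:* R.con (+ 0) R.:= R.:1) ≡.refl _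
    ; nonzero = λ e → 1≉0 (trans (sym η.1#-homo) e) }

  good-neg1 : Good (R.- R.1#)
  good-neg1 = record
    { c = 0
    ; bezout = R.solve 1 (λ N → R.:- R.:1 R.:* R.:- R.:1 R.:+ N R.:* R.con (+ 0) R.:= R.:1) ≡.refl _
    ; nonzero = λ e → 1≉0 (begin
        1#  ≈⟨ solve 0 (:1 := :- :- :1) ≡.refl ⟩
        - - 1#  ≈⟨ -‿cong (trans (-‿cong (sym η.1#-homo)) (trans (sym (η.-‿homo _)) e)) ⟩
        - 0#  ≈⟨ solve 0 (:- con (+ 0) := con (+ 0)) ≡.refl ⟩
        0#  ∎) }

  good-* : ∀ {E F} → Good E → Good F → Good (E R.* F)
  good-* {E} {F} g h = record
    { c = h.c ℕ.+ g.c ℕ.* suc h.c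
    ; bezout = R.trans
        (R.solve 7 (λ E F u v u′ v′ N → E R.:* F R.:* (u R.:* u′) R.:+ N R.:* (E R.:* u R.:* v′ R.:+ v R.:* (F R.:* u′ R.:+ N R.:* v′))
                       R.:= (E R.:* u R.:+ N R.:* v) R.:* (F R.:* u′ R.:+ N R.:* v′)) ≡.refl E F g.u g.v h.u h.v (R.[ n ] x))
        (R.trans (R.*-cong g.bezout h.bezout) (R.sym (R.fromℕ-* (suc g.c) (suc h.c))))
    ; nonzero = λ e → *-≉0 g.nonzero h.nonzero (trans (sym (η.*-homo _ _)) e) }
    where
    module g = Good g
    module h = Good h

  -- The Bézout identity is `x · x ^ (n - 1) + (1 - x) [ n ] x = 1`.
  good-x : ∀ k → n ≡ suc k → Good x
  good-x k ≡.refl = record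
    { c = 0
    ; bezout = R.trans (R.solve 3 (λ x y N → x R.:* y R.:+ N R.:* (R.:1 R.:- x) R.:= x R.:* y R.:+ (R.:1 R.:- x) R.:* N) ≡.refl x (x R.^ k) (R.[ n ] x))
        (R.trans (R.+-congˡ (R.1-x*[] n x)) (R.solve 1 (λ y → y R.:+ (R.:1 R.:- y) R.:= R.:1) ≡.refl (x R.^ n)))
    ; nonzero = q≉0 }

  good-^ : ∀ k → Good (x R.^ k)
  good-^ zero = good-1
  good-^ (suc k) = good-* (good-x (ℕ.pred n) (≡.sym (ℕ.suc-pred n {{ℕ.>-nonZero 0<n}}))) (good-^ k)

  infix 4 _≐_
  -- Equality up to a unit of the localisation of `R` at its good elements, written without
  -- inverses.
  record _≐_ (y z : Carrier) : Set where
    field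
      {E F}  : R.Carrier
      good-E : Good E
      good-F : Good F
      ratio  : η E * y ≈ η F * z

  ≈⇒≐ : ∀ {y z} → y ≈ z → y ≐ z
  ≈⇒≐ e = record { good-E = good-1 ; good-F = good-1 ; ratio = *-congˡ e }

  ≐-sym : ∀ {y z} → y ≐ z → z ≐ y
  ≐-sym p = record { good-E = _≐_.good-F p ; good-F = _≐_.good-E p ; ratio = sym (_≐_.ratio p) }

  ≐-trans : ∀ {y z w} → y ≐ z → z ≐ w → y ≐ w
  ≐-trans {y} {z} {w} p r = record
    { good-E = good-* p.good-E r.good-E
    ; good-F = good-* p.good-F r.good-F
    ; ratio = begin
        η (p.E R.* r.E) * y  ≈⟨ trans (*-congʳ (η.*-homo _ _)) (solve 3 (λ a b y → a :* b :* y := b :* (a :* y)) ≡.refl _ _ y) ⟩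
        η r.E * (η p.E * y)  ≈⟨ *-congˡ p.ratio ⟩
        η r.E * (η p.F * z)  ≈⟨ solve 3 (λ a b y → a :* (b :* y) := b :* (a :* y)) ≡.refl _ _ z ⟩
        η p.F * (η r.E * z)  ≈⟨ *-congˡ r.ratio ⟩
        η p.F * (η r.F * w)  ≈⟨ trans (*-congʳ (η.*-homo _ _)) (*-assoc _ _ _) ⟨
        η (p.F R.* r.F) * w     ∎ }
    where
    module p = _≐_ p
    module r = _≐_ r

  ≐-* : ∀ {y z y′ z′} → y ≐ z → y′ ≐ z′ → y * y′ ≐ z * z′
  ≐-* {y} {z} {y′} {z′} p r = record
    { good-E = good-* p.good-E r.good-E
    ; good-F = good-* p.good-F r.good-F
    ; ratio = begin
        η (p.E R.* r.E) * (y * y′)  ≈⟨ trans (*-congʳ (η.*-homo _ _)) (*-interchange _ _ _ _) ⟩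
        (η p.E * y) * (η r.E * y′)  ≈⟨ *-cong p.ratio r.ratio ⟩
        (η p.F * z) * (η r.F * z′)  ≈⟨ trans (*-congʳ (η.*-homo _ _)) (*-interchange _ _ _ _) ⟨
        η (p.F R.* r.F) * (z * z′)        ∎ }
    where
    module p = _≐_ p
    module r = _≐_ r

  ≐-∏ : ∀ k {f g : ℕ → Carrier} → (∀ i → i ℕ.< k → f i ≐ g i) → ∏ k f ≐ ∏ k g
  ≐-∏ zero p = ≈⇒≐ refl
  ≐-∏ (suc k) p = ≐-* (≐-∏ k λ i i<k → p i (ℕ.m≤n⇒m≤1+n i<k)) (p k ℕ.≤-refl)

  good-absorb : ∀ {E} → Good E → ∀ y → η E * y ≐ y
  good-absorb {E} g y = record { good-E = good-1 ; good-F = g ; ratio = trans (*-congʳ η.1#-homo) (*-identityˡ _) }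

  -- Up to good factors, ⟨ w ⟩ depends on gcd(w , n) only.
  h : ℕ → Carrier
  h w = ⟨ common w n ⟩

  common>0 : ∀ w → 0 ℕ.< common w n
  common>0 w with common w n | common∣ʳ w n
  ... | zero | divides k n≡k*0 = ⊥-elim (ℕ.<-irrefl (≡.sym (≡.trans n≡k*0 (ℕ.*-zeroʳ k))) 0<n)
  ... | suc _ | _ = s≤s z≤n

  h≉0 : ∀ w → ¬ h w ≈ 0#
  h≉0 w = ⟨⟩≉0 (common>0 w)

  h-cong : ∀ a b → (∀ {d} → d ∣ n → d ∣ a → d ∣ b) → (∀ {d} → d ∣ n → d ∣ b → d ∣ a) → h a ≈ h b
  h-cong a b a⇒b b⇒a = reflexive (≡.cong ⟨_⟩ (∣.∣-antisym
    (common-greatest (a⇒b (common∣ʳ a n) (common∣ˡ a n)) (common∣ʳ a n))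
    (common-greatest (b⇒a (common∣ʳ b n) (common∣ˡ b n)) (common∣ʳ b n))))

  -- With `w = a g`, `n = b g` and `g` their greatest common divisor, `⟨ w ⟩` is `⟨ g ⟩` times
  -- `[ a ] (q ^ g)`. As `a` and `b` are coprime, `[]-cofactor` makes that factor good, with the
  -- integer `a` on the right of its Bézout identity.
  ⟨⟩≐h : ∀ w → 0 ℕ.< w → ⟨ w ⟩ ≐ h w
  ⟨⟩≐h w 0<w with common∣ˡ w n | common∣ʳ w n
  ... | divides a w≡ag | divides b n≡bg = record
    { good-E = good-1
    ; good-F = record { c = a-1 ; bezout = bezout ; nonzero = λ e → ⟨⟩≉0 0<w (trans ⟨w⟩≈ (trans (*-congʳ e) (zeroˡ _))) }
    ; ratio = trans (*-congʳ η.1#-homo) (trans (*-identityˡ _) ⟨w⟩≈) }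
    where
    g a-1 : ℕ
    g = common w n
    a-1 = ℕ.pred a
    1+a-1≡a : suc a-1 ≡ a
    1+a-1≡a = ℕ.suc-pred a {{ℕ.≢-nonZero λ { ≡.refl → ℕ.<-irrefl (≡.sym w≡ag) 0<w }}}
    a⊥b : Coprime a b
    a⊥b {d} (d∣a , d∣b) = ∣.∣1⇒≡1 (∣.*-cancelʳ-∣ g {{ℕ.>-nonZero (common>0 w)}} (≡.subst (d ℕ.* g ∣_) (≡.sym (ℕ.*-identityˡ g))
      (common-greatest (≡.subst (d ℕ.* g ∣_) (≡.sym w≡ag) (∣.*-monoˡ-∣ g d∣a)) (≡.subst (d ℕ.* g ∣_) (≡.sym n≡bg) (∣.*-monoˡ-∣ g d∣b)))))
    cofactor = R.[]-cofactor a b g x a⊥b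
    bezout : R.[ a ] (x R.^ g) R.* proj₁ cofactor R.+ R.[ n ] x R.* proj₁ (proj₂ cofactor) R.≈ R.fromℕ (suc a-1)
    bezout = R.trans (R.+-congˡ (R.*-congʳ (R.reflexive (≡.cong (R.[_] x) (≡.trans n≡bg (ℕ.*-comm b g))))))
      (R.trans (proj₂ (proj₂ cofactor)) (R.reflexive (≡.cong R.fromℕ (≡.sym 1+a-1≡a))))
    ⟨w⟩≈ : ⟨ w ⟩ ≈ η (R.[ a ] (x R.^ g)) * ⟨ g ⟩
    ⟨w⟩≈ = begin
      1# + - q ^ w  ≈⟨ +-congˡ (-‿cong (trans (^-congʳ q (≡.trans w≡ag (ℕ.*-comm a g))) (sym (^-assocʳ q g a)))) ⟩
      1# + - (q ^ g) ^ a  ≈⟨ 1-x*[] a (q ^ g) ⟨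
      (1# + - q ^ g) * [ a ] (q ^ g)  ≈⟨ *-comm _ _ ⟩
      [ a ] (q ^ g) * ⟨ g ⟩  ≈⟨ *-congʳ (trans (η.[]-homo a (x R.^ g)) (∑-cong a λ i _ → ^-congˡ i (η.^-homo x g))) ⟨
      η (R.[ a ] (x R.^ g)) * ⟨ g ⟩  ∎

  h-n : h n ≈ ⟨ n ⟩
  h-n = reflexive (≡.cong ⟨_⟩ (∣.∣-antisym (common∣ˡ n n) (common-greatest ∣.∣-refl ∣.∣-refl)))

  q^k*≐ : ∀ k y → q ^ k * y ≐ y
  q^k*≐ k y = ≐-trans (≈⇒≐ (*-congʳ (sym (η.^-homo x k)))) (good-absorb (good-^ k) y)

  -≐ : ∀ y → - y ≐ y
  -≐ y = ≐-trans (≈⇒≐ (begin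
    - y  ≈⟨ solve 1 (λ y → :- y := :- :1 :* y) ≡.refl y ⟩
    - 1# * y  ≈⟨ *-congʳ (trans (-‿cong (sym η.1#-homo)) (sym (η.-‿homo _))) ⟩
    η (R.- R.1#) * y  ∎)) (good-absorb good-neg1 y)

  private
    ∣-≡ : ∀ {d m m′} → m ≡ m′ → d ∣ m → d ∣ m′
    ∣-≡ ≡.refl d∣m = d∣m

  -- Modulo `n` the number `b′` is `- b`, so `a + b′` is the difference of the exponents without
  -- subtraction. The sign and the power of `q` that split off are good.
  q^-q^≐h : ∀ a b b′ → a ≢ b → n ∣ b ℕ.+ b′ → q ^ a + - q ^ b ≐ h (a ℕ.+ b′)
  q^-q^≐h a b b′ a≢b n∣b+b′ with ℕ.<-cmp a b
  ... | tri≈ _ a≡b _ = ⊥-elim (a≢b a≡b)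
  ... | tri< a<b _ _ = ≐-trans (≈⇒≐ (q^-split (ℕ.<⇒≤ a<b)))
    (≐-trans (q^k*≐ a _) (≐-trans (⟨⟩≐h (b ℕ.∸ a) (ℕ.m<n⇒0<n∸m a<b)) (≈⇒≐ (h-cong (b ℕ.∸ a) (a ℕ.+ b′)
      (λ d∣n d∣b-a → ∣.∣m+n∣m⇒∣n (∣-≡ sum (∣.∣-trans d∣n n∣b+b′)) d∣b-a)
      (λ d∣n d∣a+b′ → ∣.∣m+n∣m⇒∣n (∣-≡ (≡.trans sum (ℕ.+-comm (b ℕ.∸ a) (a ℕ.+ b′))) (∣.∣-trans d∣n n∣b+b′)) d∣a+b′)))))
    where
    sum : b ℕ.+ b′ ≡ (b ℕ.∸ a) ℕ.+ (a ℕ.+ b′)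
    sum = ≡.trans (≡.cong (ℕ._+ b′) (≡.sym (ℕ.m∸n+n≡m (ℕ.<⇒≤ a<b)))) (ℕ.+-assoc (b ℕ.∸ a) a b′)
  ... | tri> _ _ b<a = ≐-trans (≈⇒≐ (solve 2 (λ a b → a :- b := :- (b :- a)) ≡.refl (q ^ a) (q ^ b)))
    (≐-trans (-≐ _) (≐-trans (≈⇒≐ (q^-split (ℕ.<⇒≤ b<a)))
      (≐-trans (q^k*≐ b _) (≐-trans (⟨⟩≐h (a ℕ.∸ b) (ℕ.m<n⇒0<n∸m b<a)) (≈⇒≐ (h-cong (a ℕ.∸ b) (a ℕ.+ b′)
        (λ d∣n d∣a-b → ∣-≡ (≡.sym sum) (∣.∣m∣n⇒∣m+n d∣a-b (∣.∣-trans d∣n n∣b+b′)))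
        (λ d∣n d∣a+b′ → ∣.∣m+n∣m⇒∣n (∣-≡ (≡.trans sum (ℕ.+-comm (a ℕ.∸ b) (b ℕ.+ b′))) d∣a+b′) (∣.∣-trans d∣n n∣b+b′))))))))
    where
    sum : a ℕ.+ b′ ≡ (a ℕ.∸ b) ℕ.+ (b ℕ.+ b′)
    sum = ≡.trans (≡.cong (ℕ._+ b′) (≡.sym (ℕ.m∸n+n≡m (ℕ.<⇒≤ b<a)))) (ℕ.+-assoc (a ℕ.∸ b) b b′)

-- Omitting one index, and congruences modulo n

skip : ℕ → ℕ → ℕ
skip i j with j ℕ.<? i
... | yes _ = j
... | no _ = suc j

skip-< : ∀ {i j} → j ℕ.< i → skip i j ≡ j
skip-< {i} {j} j<i with j ℕ.<? i
... | yes _ = ≡.refl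
... | no j≮i = ⊥-elim (j≮i j<i)

skip-≥ : ∀ {i j} → i ℕ.≤ j → skip i j ≡ suc j
skip-≥ {i} {j} i≤j with j ℕ.<? i
... | yes j<i = ⊥-elim (ℕ.<-irrefl ≡.refl (ℕ.<-≤-trans j<i i≤j))
... | no _ = ≡.refl

skip-≢ : ∀ i j → skip i j ≢ i
skip-≢ i j e with j ℕ.<? i
... | yes j<i = ℕ.<-irrefl e j<i
... | no j≮i = j≮i (ℕ.≤-reflexive e)

skip-≤ : ∀ i {j d} → j ℕ.< d → skip i j ℕ.≤ d
skip-≤ i {j} j<d with j ℕ.<? i
... | yes _ = ℕ.<⇒≤ j<d
... | no _ = j<d

skip-surjective : ∀ {i k d} → i ≢ k → i ℕ.≤ d → k ℕ.≤ d → ∃[ j ] (j ℕ.< d × skip i j ≡ k)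
skip-surjective {i} {k} i≢k i≤d k≤d with ℕ.<-cmp k i
... | tri< k<i _ _ = k , ℕ.<-≤-trans k<i i≤d , skip-< k<i
... | tri≈ _ k≡i _ = ⊥-elim (i≢k (≡.sym k≡i))
... | tri> _ _ (s≤s {n = j} i≤j) = j , k≤d , skip-≥ i≤j

module _ (R : CommutativeRing 0ℓ 0ℓ) where
  open RingTools R

  ∏-skip : ∀ d i f → i ℕ.≤ d → ∏ d (f ∘ skip i) * f i ≈ ∏ (suc d) f
  ∏-skip d i f i≤d with ℕ.m≤n⇒m<n∨m≡n i≤d
  ... | inj₂ ≡.refl = *-congʳ (∏-cong d λ j j<d → reflexive (≡.cong f (skip-< j<d)))
  ... | inj₁ (s≤s {n = d′} i≤d′) = begin
    ∏ d′ (f ∘ skip i) * f (skip i d′) * f i  ≈⟨ solve 3 (λ a b c → a :* b :* c := a :* c :* b) ≡.refl _ _ _ ⟩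
    ∏ d′ (f ∘ skip i) * f i * f (skip i d′)  ≈⟨ *-cong (∏-skip d′ i f i≤d′) (reflexive (≡.cong f (skip-≥ i≤d′))) ⟩
    ∏ (suc (suc d′)) f  ∎

-- Congruence modulo `n` is expressed by adding natural multiples of `n` on both sides, which
-- replaces signed quotients.
∣-resp-mod : ∀ {d n} x y c c′ → x ℕ.+ c ℕ.* n ≡ y ℕ.+ c′ ℕ.* n → d ∣ n → d ∣ x → d ∣ y
∣-resp-mod {d} {n} x y c c′ e d∣n d∣x = ∣.∣m+n∣m⇒∣n
  (≡.subst (λ z → d ∣ z) (≡.trans e (ℕ.+-comm y (c′ ℕ.* n))) (∣.∣m∣n⇒∣m+n d∣x (∣.∣n⇒∣m*n c d∣n)))
  (∣.∣n⇒∣m*n c′ d∣n)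

inverse-mod : ∀ {d k} m → Coprime (suc d) k → ∃[ t ] ∃[ c ] ∃[ c′ ] k ℕ.* t ℕ.+ c ℕ.* suc d ≡ m ℕ.+ c′ ℕ.* suc d
inverse-mod {d} {k} m n⊥k with coprime-Bézout n⊥k
... | Bézout.-+ a b 1+an≡bk = m ℕ.* b , 0 , m ℕ.* a , ≡.trans (lemma₁ k m b)
  (≡.trans (≡.cong (m ℕ.*_) (≡.sym 1+an≡bk)) (lemma₂ m a (suc d)))
  where
  lemma₁ : ∀ k m b → k ℕ.* (m ℕ.* b) ℕ.+ 0 ≡ m ℕ.* (b ℕ.* k)
  lemma₁ = ℕ-solve-∀
  lemma₂ : ∀ m a n → m ℕ.* (1 ℕ.+ a ℕ.* n) ≡ m ℕ.+ m ℕ.* a ℕ.* n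
  lemma₂ = ℕ-solve-∀
-- Here `b` is the negative of an inverse of `k`; multiplication by `d`, which is -1 modulo `suc d`,
-- corrects the sign.
... | Bézout.+- a b 1+bk≡an = m ℕ.* b ℕ.* d , m , m ℕ.* a ℕ.* d , ≡.trans (lemma₁ k m b d)
  (≡.trans (≡.cong (λ z → m ℕ.* (z ℕ.* d ℕ.+ 1)) 1+bk≡an) (lemma₂ m a d))
  where
  lemma₁ : ∀ k m b d → k ℕ.* (m ℕ.* b ℕ.* d) ℕ.+ m ℕ.* suc d ≡ m ℕ.* (suc (b ℕ.* k) ℕ.* d ℕ.+ 1)
  lemma₁ = ℕ-solve-∀
  lemma₂ : ∀ m a d → m ℕ.* (a ℕ.* suc d ℕ.* d ℕ.+ 1) ≡ m ℕ.+ m ℕ.* a ℕ.* d ℕ.* suc d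
  lemma₂ = ℕ-solve-∀

-- The interpolation coefficients up to good factors

module NodeValues {R S K : CommutativeRing 0ℓ 0ℓ}
  {κ : CommutativeRing.Carrier R → CommutativeRing.Carrier S}
  {ι : CommutativeRing.Carrier S → CommutativeRing.Carrier K}
  (κ-hom : IsHom R S κ) (ι-hom : IsHom S K ι) (isField : IsField K)
  (x : CommutativeRing.Carrier R)
  (q-free : NonTorsion K (ι (κ x)))
  (d : ℕ) (n⊥6 : Coprime (suc d) 6) where

  n : ℕ
  n = suc d

  open RingTools K
  open IsField isField
  open Localisation κ-hom ι-hom isField x q-free n (s≤s z≤n)
  open Summation K isField q q-free
  open Evaluation K isField q q-free

  ∣n⇒⊥6 : ∀ {e} → e ∣ n → Coprime e 6
  ∣n⇒⊥6 e∣n (f∣e , f∣6) = n⊥6 (∣.∣-trans f∣e e∣n , f∣6)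

  ∣n⇒⊥2 : ∀ {e} → e ∣ n → Coprime e 2
  ∣n⇒⊥2 e∣n (f∣e , f∣2) = ∣n⇒⊥6 e∣n (f∣e , ∣.∣-trans f∣2 (divides 3 ≡.refl))

  h-mod : ∀ a b c c′ → a ℕ.+ c ℕ.* n ≡ b ℕ.+ c′ ℕ.* n → h a ≈ h b
  h-mod a b c c′ e = h-cong a b (∣-resp-mod a b c c′ e) (∣-resp-mod b a c′ c (≡.sym e))

  -- Divisors of `n` are coprime with 6, so the factor 6 does not affect the greatest common divisor
  -- with `n`.
  h-6* : ∀ y → h (6 ℕ.* y) ≈ h y
  h-6* y = h-cong (6 ℕ.* y) y (λ e∣n → coprime-divisor (∣n⇒⊥6 e∣n)) (λ _ → ∣.∣n⇒∣m*n 6)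

  h-2* : ∀ y → h (2 ℕ.* y) ≈ h y
  h-2* y = h-cong (2 ℕ.* y) y (λ e∣n → coprime-divisor (∣n⇒⊥2 e∣n)) (λ _ → ∣.∣n⇒∣m*n 2)

  H : Carrier
  H = ∏ n h

  -- Moving the window of residues by one place exchanges `h t` for `h (t + n)`, and `h` has period
  -- `n`.
  H-shift : ∀ t → ∏ n (λ j → h (t ℕ.+ j)) ≈ H
  H-shift zero = refl
  H-shift (suc t) = trans (*-cancelˡ (h≉0 t) (begin
    h t * ∏ n (λ j → h (suc t ℕ.+ j))  ≈⟨ *-cong (reflexive (≡.cong h (≡.sym (ℕ.+-identityʳ t)))) (∏-cong n λ j _ → reflexive (≡.cong h (≡.sym (ℕ.+-suc t j)))) ⟩
    h (t ℕ.+ 0) * ∏ n (λ j → h (t ℕ.+ suc j))  ≈⟨ ∏-suc n (λ j → h (t ℕ.+ j)) ⟨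
    ∏ n (λ j → h (t ℕ.+ j)) * h (t ℕ.+ n)  ≈⟨ trans (*-comm _ _) (*-congʳ (h-mod (t ℕ.+ n) t 0 1 (≡.trans (ℕ.+-identityʳ _) (≡.cong (t ℕ.+_) (≡.sym (ℕ.*-identityˡ n)))))) ⟩
    h t * ∏ n (λ j → h (t ℕ.+ j))  ∎)) (H-shift t)

  ⟨_+_⟩≐h : ∀ a b → 0 ℕ.< a → 1# + - (q ^ a * q ^ b) ≐ h (a ℕ.+ b)
  ⟨ a + b ⟩≐h 0<a = ≐-trans (≈⇒≐ (1-qˣqʸ a b)) (⟨⟩≐h (a ℕ.+ b) (ℕ.<-≤-trans 0<a (ℕ.m≤m+n a b)))

  node : ℕ → Carrier
  node i = q ^ suc (2 ℕ.* i)

  lagrange-denom : ℕ → Carrier → Carrier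
  lagrange-denom i a = ∏ d λ j → root-pair (node (skip i j)) a

  -- Modulo n the exponents of denom, and of each half of lagrange-denom, run through all residues but one.
  denom-at-node : ∀ i → ∃[ A ] (denom d (node i) ≐ A * A × A * h (suc (2 ℕ.* i)) ≈ H)
  -- With `6 t` congruent to `m`, the exponents `m + 6 s` and `m - 6 s` become `6 (t + s)` and
  -- `6 (t - s)`. For `s = 1, …, n - 1` both families miss only the residue `t`, where `h t = h m`.
  denom-at-node i with inverse-mod (suc (2 ℕ.* i)) n⊥6
  ... | t , c , c′ , 6t≡m = A , ≐-trans factors (≈⇒≐ (*-congˡ (sym reversed))) , (begin
      A * h m  ≈⟨ *-comm _ _ ⟩
      h m * A  ≈⟨ *-congʳ (trans (h-mod m (6 ℕ.* t) c′ c (≡.sym 6t≡m)) (trans (h-6* t) (reflexive (≡.cong h (≡.sym (ℕ.+-identityʳ t)))))) ⟩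
      h (t ℕ.+ 0) * A  ≈⟨ ∏-suc d (λ j → h (t ℕ.+ j)) ⟨
      ∏ n (λ j → h (t ℕ.+ j))  ≈⟨ H-shift t ⟩
      H  ∎)
    where
    m : ℕ
    m = suc (2 ℕ.* i)
    A : Carrier
    A = ∏ d λ j → h (t ℕ.+ suc j)
    shift : ∀ s → h (m ℕ.+ 6 ℕ.* s) ≈ h (t ℕ.+ s)
    shift s = trans (h-mod (m ℕ.+ 6 ℕ.* s) (6 ℕ.* (t ℕ.+ s)) c′ c
      (≡.trans (rearrange m (6 ℕ.* s) (c′ ℕ.* n)) (≡.trans (≡.cong (ℕ._+ 6 ℕ.* s) (≡.sym 6t≡m)) (rearrange′ t s (c ℕ.* n))))) (h-6* (t ℕ.+ s))
      where
      rearrange : ∀ a b c → a ℕ.+ b ℕ.+ c ≡ a ℕ.+ c ℕ.+ b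
      rearrange = ℕ-solve-∀
      rearrange′ : ∀ t s c → 6 ℕ.* t ℕ.+ c ℕ.+ 6 ℕ.* s ≡ 6 ℕ.* (t ℕ.+ s) ℕ.+ c
      rearrange′ = ℕ-solve-∀
    factors : denom d (node i) ≐ A * ∏ d (λ j → h (t ℕ.+ (n ℕ.∸ suc j)))
    factors = ≐-trans (≐-∏ d λ j j<d → ≐-* (≐-trans (⟨ m + 6 ℕ.* suc j ⟩≐h (s≤s z≤n)) (≈⇒≐ (shift (suc j))))
        (≐-trans (q^-q^≐h m (6 ℕ.* suc j) (6 ℕ.* (n ℕ.∸ suc j)) (odd≢6* i (suc j)) (divides 6 (≡.trans (≡.sym (ℕ.*-distribˡ-+ 6 (suc j) (n ℕ.∸ suc j)))
            (≡.cong (6 ℕ.*_) (ℕ.m+[n∸m]≡n (s≤s (ℕ.<⇒≤ j<d)))))))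
          (≈⇒≐ (shift (n ℕ.∸ suc j)))))
      (≈⇒≐ (∏-distrib-* d _ _))
    reversed : A ≈ ∏ d (λ j → h (t ℕ.+ (n ℕ.∸ suc j)))
    reversed = trans (∏-reverse d (λ j → h (t ℕ.+ suc j))) (∏-cong d λ j j<d →
      reflexive (≡.cong (λ z → h (t ℕ.+ z)) (≡.sym (ℕ.+-∸-assoc 1 j<d))))

  -- The sums of exponents, collected in `B`, are twice `i + 1 + s` with `s ≠ i` and omit the
  -- residue of `2 i + 1`, just as in `denom`. The differences, collected in `C`, omit the residue
  -- 0, whose value of `h` is all of `⟨ n ⟩`; this is where the factor `[ n ]` originates.
  lagrange-denom-at-node : ∀ i → i ℕ.≤ d → ∃[ B ] ∃[ C ]
    (lagrange-denom i (node i) ≐ B * C × B * h (suc (2 ℕ.* i)) ≈ H × C * ⟨ n ⟩ ≈ H)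
  lagrange-denom-at-node i i≤d = B , C , factors
    , trans (*-congˡ (reflexive (≡.cong (λ z → h (suc (i ℕ.+ z))) (ℕ.+-identityʳ i)))) (trans (∏-skip K d i (λ s → h (suc i ℕ.+ s)) i≤d) (H-shift (suc i)))
    , (begin
      C * ⟨ n ⟩  ≈⟨ *-congˡ (trans (sym h-n) (reflexive (≡.cong (h ∘ suc) (≡.sym (ℕ.m+[n∸m]≡n i≤d))))) ⟩
      C * h (suc i ℕ.+ (d ℕ.∸ i))  ≈⟨ ∏-skip K d i (λ s → h (suc i ℕ.+ (d ℕ.∸ s))) i≤d ⟩
      ∏ n (λ s → h (suc i ℕ.+ (n ℕ.∸ suc s)))  ≈⟨ ∏-reverse n (λ s → h (suc i ℕ.+ s)) ⟨
      ∏ n (λ s → h (suc i ℕ.+ s))  ≈⟨ H-shift (suc i) ⟩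
      H  ∎)
    where
    m : ℕ
    m = suc (2 ℕ.* i)
    B C : Carrier
    B = ∏ d λ j → h (suc i ℕ.+ skip i j)
    C = ∏ d λ j → h (suc i ℕ.+ (d ℕ.∸ skip i j))
    factors : lagrange-denom i (node i) ≐ B * C
    factors = ≐-trans (≐-∏ d λ j j<d → ≐-*
        (≐-trans (⟨ m + suc (2 ℕ.* skip i j) ⟩≐h (s≤s z≤n)) (≈⇒≐ (twice (skip i j))))
        (≐-trans (q^-q^≐h m (suc (2 ℕ.* skip i j)) (suc (2 ℕ.* (d ℕ.∸ skip i j)))
            (λ e → skip-≢ i j (≡.sym (ℕ.*-cancelˡ-≡ i (skip i j) 2 (ℕ.suc-injective e))))
            (divides 2 (≡.trans (double (skip i j) (d ℕ.∸ skip i j)) (≡.cong (λ z → 2 ℕ.* suc z) (ℕ.m+[n∸m]≡n (skip-≤ i j<d))))))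
          (≈⇒≐ (twice (d ℕ.∸ skip i j)))))
      (≈⇒≐ (∏-distrib-* d _ _))
      where
      double : ∀ a b → suc (2 ℕ.* a) ℕ.+ suc (2 ℕ.* b) ≡ 2 ℕ.* suc (a ℕ.+ b)
      double = ℕ-solve-∀
      twice : ∀ s → h (m ℕ.+ suc (2 ℕ.* s)) ≈ h (suc i ℕ.+ s)
      twice s = trans (reflexive (≡.cong h (double i s))) (h-2* (suc i ℕ.+ s))

  lagrange-denom-at-node≉0 : ∀ i → ¬ lagrange-denom i (node i) ≈ 0#
  lagrange-denom-at-node≉0 i = ∏-≉0 d λ j _ → *-≉0
    (λ e → ⟨suc⟩≉0 (2 ℕ.* i ℕ.+ suc (2 ℕ.* skip i j)) (trans (sym (1-qˣqʸ (suc (2 ℕ.* i)) (suc (2 ℕ.* skip i j)))) e))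
    (q^-distinct (λ e → skip-≢ i j (≡.sym (ℕ.*-cancelˡ-≡ i (skip i j) 2 (ℕ.suc-injective e)))))

  node-ratio : ℕ → Carrier
  node-ratio i = denom d (node i) * lagrange-denom i (node i) ⁻¹

  -- `denom` is `A * A`, the Lagrange denominator is `B * C`, and `A = B`. What remains of the
  -- quotient is `A / C`, that is `⟨ n ⟩` over `h m`.
  node-ratio≐ : ∀ i → i ℕ.≤ d → node-ratio i * h (suc (2 ℕ.* i)) ≐ ⟨ n ⟩
  node-ratio≐ i i≤d = combine (denom-at-node i) (lagrange-denom-at-node i i≤d)
   where
   combine : ∃[ A ] (denom d (node i) ≐ A * A × A * h (suc (2 ℕ.* i)) ≈ H) →
             ∃[ B ] ∃[ C ] (lagrange-denom i (node i) ≐ B * C × B * h (suc (2 ℕ.* i)) ≈ H × C * ⟨ n ⟩ ≈ H) →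
             node-ratio i * h (suc (2 ℕ.* i)) ≐ ⟨ n ⟩
   combine (A , D≐AA , Ah≈H) (B , C , ℓ≐BC , Bh≈H , Cn≈H) =
    ≐-trans (≈⇒≐ (exchange D (ℓ ⁻¹) hm)) (≐-trans (≐-* Dh≐ℓn (≈⇒≐ refl)) (≈⇒≐ ℓnℓ⁻¹≈n))
    where
    D ℓ hm : Carrier
    D = denom d (node i)
    ℓ = lagrange-denom i (node i)
    hm = h (suc (2 ℕ.* i))
    exchange : ∀ a b c → a * b * c ≈ a * c * b
    exchange = solve 3 (λ a b c → a :* b :* c := a :* c :* b) ≡.refl
    A≈B : A ≈ B
    A≈B = *-cancelˡ (h≉0 (suc (2 ℕ.* i))) (trans (*-comm hm A) (trans Ah≈H (trans (sym Bh≈H) (*-comm B hm))))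
    AAh≈BCn : A * A * hm ≈ B * C * ⟨ n ⟩
    AAh≈BCn = begin
      A * A * hm  ≈⟨ *-assoc A A hm ⟩
      A * (A * hm)  ≈⟨ *-cong A≈B (trans Ah≈H (sym Cn≈H)) ⟩
      B * (C * ⟨ n ⟩)  ≈⟨ *-assoc B C ⟨ n ⟩ ⟨
      B * C * ⟨ n ⟩  ∎
    Dh≐ℓn : D * hm ≐ ℓ * ⟨ n ⟩
    Dh≐ℓn = ≐-trans (≐-* D≐AA (≈⇒≐ refl)) (≐-trans (≈⇒≐ AAh≈BCn) (≐-* (≐-sym ℓ≐BC) (≈⇒≐ refl)))
    ℓnℓ⁻¹≈n : ℓ * ⟨ n ⟩ * ℓ ⁻¹ ≈ ⟨ n ⟩
    ℓnℓ⁻¹≈n = begin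
      ℓ * ⟨ n ⟩ * ℓ ⁻¹  ≈⟨ exchange ℓ ⟨ n ⟩ (ℓ ⁻¹) ⟩
      ℓ * ℓ ⁻¹ * ⟨ n ⟩  ≈⟨ *-congʳ (inverseʳ (lagrange-denom-at-node≉0 i)) ⟩
      1# * ⟨ n ⟩  ≈⟨ *-identityˡ ⟨ n ⟩ ⟩
      ⟨ n ⟩  ∎

-- The congruence in the localised ring

module Congruence {R S K : CommutativeRing 0ℓ 0ℓ}
  {κ : CommutativeRing.Carrier R → CommutativeRing.Carrier S}
  {ι : CommutativeRing.Carrier S → CommutativeRing.Carrier K}
  (κ-hom : IsHom R S κ) (ι-hom : IsHom S K ι) (isField : IsField K)
  (x : CommutativeRing.Carrier R)
  (q-free : NonTorsion K (ι (κ x)))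
  (i₀ : ℕ) (n⊥6 : Coprime (suc (2 ℕ.* i₀)) 6) where

  -- With `n = d + 1 = 2 i₀ + 1`, the node of index `i₀` is `qⁿ` itself.
  d : ℕ
  d = 2 ℕ.* i₀

  private
    module R = RingTools R
    module S = RingTools S
    module ι = Homomorphism ι-hom
    module κ = Homomorphism κ-hom
    module η = Homomorphism (∘-isHom κ-hom ι-hom)

  open RingTools K
  open IsField isField
  open BinaryForms K isDomain
  open Interpolation K isField
  open NodeValues κ-hom ι-hom isField x q-free d n⊥6
  open Localisation κ-hom ι-hom isField x q-free n (s≤s z≤n)
  open Summation K isField q q-free
  open Evaluation K isField q q-free

  -- Divisibility of `y` by `z` in the localisation of `S` at the good elements of `R`.
  record InLoc (z y : Carrier) : Set where
    constructor inLoc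
    field
      {E}    : R.Carrier
      good-E : Good E
      s      : S.Carrier
      clear  : η E * y ≈ z * ι s
  open InLoc

  inLoc-resp : ∀ {z y y′} → y ≈ y′ → InLoc z y → InLoc z y′
  inLoc-resp e (inLoc g s c) = inLoc g s (trans (*-congˡ (sym e)) c)

  inLoc-0 : ∀ {z} → InLoc z 0#
  inLoc-0 = inLoc good-1 S.0# (trans (zeroʳ _) (sym (trans (*-congˡ ι.0#-homo) (zeroʳ _))))

  inLoc-+ : ∀ {z y y′} → InLoc z y → InLoc z y′ → InLoc z (y + y′)
  inLoc-+ {z} {y} {y′} (inLoc {E} g s c) (inLoc {E′} g′ s′ c′) = inLoc (good-* g g′) (κ E′ S.* s S.+ κ E S.* s′) (begin
    η (E R.* E′) * (y + y′)  ≈⟨ *-congʳ (η.*-homo E E′) ⟩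
    η E * η E′ * (y + y′)  ≈⟨ solve 4 (λ a b y y′ → a :* b :* (y :+ y′) := b :* (a :* y) :+ a :* (b :* y′)) ≡.refl _ _ _ _ ⟩
    η E′ * (η E * y) + η E * (η E′ * y′)  ≈⟨ +-cong (*-congˡ c) (*-congˡ c′) ⟩
    η E′ * (z * ι s) + η E * (z * ι s′)  ≈⟨ solve 5 (λ a b z s s′ → b :* (z :* s) :+ a :* (z :* s′) := z :* (b :* s :+ a :* s′)) ≡.refl _ _ _ _ _ ⟩
    z * (η E′ * ι s + η E * ι s′)  ≈⟨ *-congˡ (trans (ι.+-homo _ _) (+-cong (ι.*-homo _ _) (ι.*-homo _ _))) ⟨
    z * ι (κ E′ S.* s S.+ κ E S.* s′)  ∎)

  inLoc-neg : ∀ {z y} → InLoc z y → InLoc z (- y)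
  inLoc-neg (inLoc g s c) = inLoc g (S.- s) (trans (solve 2 (λ a y → a :* :- y := :- (a :* y)) ≡.refl _ _)
    (trans (-‿cong c) (trans (solve 2 (λ a y → :- (a :* y) := a :* :- y) ≡.refl _ _) (*-congˡ (sym (ι.-‿homo s))))))

  inLoc-* : ∀ {z z′ y y′} → InLoc z y → InLoc z′ y′ → InLoc (z * z′) (y * y′)
  inLoc-* {z} {z′} {y} {y′} (inLoc {E} g s c) (inLoc {E′} g′ s′ c′) = inLoc (good-* g g′) (s S.* s′) (begin
    η (E R.* E′) * (y * y′)  ≈⟨ *-congʳ (η.*-homo E E′) ⟩
    η E * η E′ * (y * y′)  ≈⟨ *-interchange _ _ _ _ ⟩
    (η E * y) * (η E′ * y′)  ≈⟨ *-cong c c′ ⟩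
    (z * ι s) * (z′ * ι s′)  ≈⟨ *-interchange _ _ _ _ ⟩
    z * z′ * (ι s * ι s′)  ≈⟨ *-congˡ (ι.*-homo s s′) ⟨
    z * z′ * ι (s S.* s′)  ∎)

  inLoc-∑ : ∀ k {z} {f : ℕ → Carrier} → (∀ i → i ℕ.< k → InLoc z (f i)) → InLoc z (∑ k f)
  inLoc-∑ zero p = inLoc-0
  inLoc-∑ (suc k) p = inLoc-+ (inLoc-∑ k λ i i<k → p i (ℕ.m≤n⇒m≤1+n i<k)) (p k ℕ.≤-refl)

  Integral : Carrier → Set
  Integral y = ∃[ s ] y ≈ ι s

  integral-* : ∀ {y y′} → Integral y → Integral y′ → Integral (y * y′)
  integral-* (s , e) (s′ , e′) = s S.* s′ , trans (*-cong e e′) (sym (ι.*-homo s s′))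

  integral-- : ∀ {y y′} → Integral y → Integral y′ → Integral (y + - y′)
  integral-- (s , e) (s′ , e′) = s S.+ S.- s′ , trans (+-cong e (-‿cong e′)) (sym (trans (ι.+-homo _ _) (+-congˡ (ι.-‿homo s′))))

  integral-1 : Integral 1#
  integral-1 = S.1# , sym ι.1#-homo

  integral-root-pair : ∀ {y} k → Integral y → Integral (root-pair (q ^ k) y)
  integral-root-pair k y = integral-* (integral-- integral-1 (integral-* y q^k)) (integral-- y q^k)
    where
    q^k : Integral (q ^ k)
    q^k = κ (x R.^ k) , sym (η.^-homo x k)

  ∏-extract : ∀ k j {f : ℕ → Carrier} → j ℕ.< k → (∀ i → Integral (f i)) → InLoc (f j) (∏ k f)
  ∏-extract (suc k) j {f} j<1+k int with k ℕ.≟ j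
  ... | yes ≡.refl with ∏-integral k
    where
    ∏-integral : ∀ k → Integral (∏ k f)
    ∏-integral zero = integral-1
    ∏-integral (suc k) = integral-* (∏-integral k) (int k)
  ...   | s , e = inLoc good-1 s (trans (*-congʳ η.1#-homo) (trans (*-identityˡ _) (trans (*-comm _ _) (*-congˡ e))))
  ∏-extract (suc k) j {f} j<1+k int | no k≢j
    with ∏-extract k j {f} (ℕ.≤∧≢⇒< (ℕ.s≤s⁻¹ j<1+k) (k≢j ∘ ≡.sym)) int | int k
  ... | inLoc {E} g s c | s′ , e = inLoc g (s S.* s′) (begin
    η E * (∏ k f * f k)  ≈⟨ *-assoc _ _ _ ⟨
    η E * ∏ k f * f k  ≈⟨ *-cong c e ⟩
    f j * ι s * ι s′  ≈⟨ trans (*-assoc _ _ _) (*-congˡ (sym (ι.*-homo s s′))) ⟩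
    f j * ι (s S.* s′)  ∎)

  ⟨n⟩≈ : ⟨ n ⟩ ≈ ⟨ 1 ⟩ * [ n ] q
  ⟨n⟩≈ = trans (sym (1-x*[] n q)) (*-congʳ (+-congˡ (-‿cong (sym (*-identityʳ q)))))

  sum : Carrier → Carrier
  sum a = ∑ n λ k → term k a

  sum-at-node : ∀ i → i ℕ.≤ d → q ^ i * (sum (node i) * ⟨ 1 ⟩) ≈ fromℤ (χ (suc (2 ℕ.* i))) * ⟨ suc (2 ℕ.* i) ⟩
  sum-at-node i i≤d = trans (*-congˡ (*-congʳ (truncated n i (s≤s i≤d)))) (value i)

  i₀≤d : i₀ ℕ.≤ d
  i₀≤d = ℕ.m≤m+n i₀ _

  -- This identifies the right-hand side of the theorem with the sum at `a = qⁿ`, so the theorem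
  -- compares two values of one function.
  q^i₀*sum : q ^ i₀ * sum (node i₀) ≈ fromℤ (χ n) * [ n ] q
  q^i₀*sum = *-cancelˡ (⟨suc⟩≉0 0) (begin
    ⟨ 1 ⟩ * (q ^ i₀ * sum (node i₀))  ≈⟨ solve 3 (λ o p s → o :* (p :* s) := p :* (s :* o)) ≡.refl ⟨ 1 ⟩ (q ^ i₀) (sum (node i₀)) ⟩
    q ^ i₀ * (sum (node i₀) * ⟨ 1 ⟩)  ≈⟨ sum-at-node i₀ i₀≤d ⟩
    fromℤ (χ n) * ⟨ n ⟩  ≈⟨ *-congˡ ⟨n⟩≈ ⟩
    fromℤ (χ n) * (⟨ 1 ⟩ * [ n ] q)  ≈⟨ solve 3 (λ c o b → c :* (o :* b) := o :* (c :* b)) ≡.refl (fromℤ (χ n)) ⟨ 1 ⟩ ([ n ] q) ⟩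
    ⟨ 1 ⟩ * (fromℤ (χ n) * [ n ] q)  ∎)

  -- The sum at node `m` brings the factor `⟨ m ⟩`, which cancels the `h m` below `⟨ n ⟩` in
  -- `node-ratio` up to good factors.
  sum*ratio : ∀ i → i ℕ.≤ d → InLoc ([ n ] q) (sum (node i) * node-ratio i)
  sum*ratio i i≤d = go (≐-trans (≐-* (≈⇒≐ refl) (⟨⟩≐h (suc (2 ℕ.* i)) (s≤s z≤n))) (node-ratio≐ i i≤d))
    where
    r Λ c : Carrier
    r = sum (node i)
    Λ = node-ratio i
    c = fromℤ (χ (suc (2 ℕ.* i)))
    go : Λ * ⟨ suc (2 ℕ.* i) ⟩ ≐ ⟨ n ⟩ → InLoc ([ n ] q) (r * Λ)
    go p = inLoc (good-* p.good-E (good-^ i)) (S.fromℤ (χ (suc (2 ℕ.* i))) S.* κ p.F) (*-cancelˡ (⟨suc⟩≉0 0) (begin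
      ⟨ 1 ⟩ * (η (p.E R.* x R.^ i) * (r * Λ))
        ≈⟨ *-congˡ (*-congʳ (trans (η.*-homo _ _) (*-congˡ (η.^-homo x i)))) ⟩
      ⟨ 1 ⟩ * (η p.E * q ^ i * (r * Λ))
        ≈⟨ solve 5 (λ o E p r l → o :* (E :* p :* (r :* l)) := E :* l :* (p :* (r :* o))) ≡.refl ⟨ 1 ⟩ (η p.E) (q ^ i) r Λ ⟩
      η p.E * Λ * (q ^ i * (r * ⟨ 1 ⟩))
        ≈⟨ *-congˡ (sum-at-node i i≤d) ⟩
      η p.E * Λ * (c * ⟨ suc (2 ℕ.* i) ⟩)
        ≈⟨ solve 4 (λ E l c m → E :* l :* (c :* m) := c :* (E :* (l :* m))) ≡.refl (η p.E) Λ c ⟨ suc (2 ℕ.* i) ⟩ ⟩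
      c * (η p.E * (Λ * ⟨ suc (2 ℕ.* i) ⟩))
        ≈⟨ *-congˡ (trans p.ratio (*-congˡ ⟨n⟩≈)) ⟩
      c * (η p.F * (⟨ 1 ⟩ * [ n ] q))
        ≈⟨ solve 4 (λ c F o b → c :* (F :* (o :* b)) := o :* (b :* (c :* F))) ≡.refl c (η p.F) ⟨ 1 ⟩ ([ n ] q) ⟩
      ⟨ 1 ⟩ * ([ n ] q * (c * η p.F))
        ≈⟨ *-congˡ (*-congˡ (trans (ι.*-homo _ _) (*-congʳ (ι.fromℤ-homo (χ (suc (2 ℕ.* i))))))) ⟨
      ⟨ 1 ⟩ * ([ n ] q * ι (S.fromℤ (χ (suc (2 ℕ.* i))) S.* κ p.F)) ∎))
      where module p = _≐_ p

  -- Now `[ n ] q` comes from the sum itself, and `node-ratio` is integral up to good factors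
  -- because `gcd(m , n)` divides `n`, so that `h m` divides `⟨ n ⟩`.
  sum₀*ratio : ∀ i → i ℕ.≤ d → InLoc ([ n ] q) (sum (node i₀) * node-ratio i)
  sum₀*ratio i i≤d = go (common∣ʳ m n) (node-ratio≐ i i≤d)
    where
    m : ℕ
    m = suc (2 ℕ.* i)
    r Λ c : Carrier
    r = sum (node i₀)
    Λ = node-ratio i
    c = fromℤ (χ n)
    go : common m n ∣ n → Λ * h m ≐ ⟨ n ⟩ → InLoc ([ n ] q) (r * Λ)
    go (divides b n≡bg) p = inLoc (good-* p.good-E (good-^ i₀)) (S.fromℤ (χ n) S.* κ (p.F R.* B)) (begin
      η (p.E R.* x R.^ i₀) * (r * Λ)
        ≈⟨ *-congʳ (trans (η.*-homo _ _) (*-congˡ (η.^-homo x i₀))) ⟩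
      η p.E * q ^ i₀ * (r * Λ)
        ≈⟨ solve 4 (λ E p r l → E :* p :* (r :* l) := p :* r :* (E :* l)) ≡.refl (η p.E) (q ^ i₀) r Λ ⟩
      q ^ i₀ * r * (η p.E * Λ)
        ≈⟨ *-cong q^i₀*sum EΛ≈ ⟩
      c * [ n ] q * η (p.F R.* B)
        ≈⟨ solve 3 (λ c b F → c :* b :* F := b :* (c :* F)) ≡.refl c ([ n ] q) (η (p.F R.* B)) ⟩
      [ n ] q * (c * η (p.F R.* B))
        ≈⟨ *-congˡ (trans (ι.*-homo _ _) (*-congʳ (ι.fromℤ-homo (χ n)))) ⟨
      [ n ] q * ι (S.fromℤ (χ n) S.* κ (p.F R.* B)) ∎)
      where
      module p = _≐_ p
      g : ℕ
      g = common m n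
      B : R.Carrier
      B = R.[ b ] (x R.^ g)
      ⟨n⟩≈hB : ⟨ n ⟩ ≈ h m * η B
      ⟨n⟩≈hB = begin
        1# + - q ^ n  ≈⟨ +-congˡ (-‿cong (trans (^-congʳ q (≡.trans n≡bg (ℕ.*-comm b g))) (sym (^-assocʳ q g b)))) ⟩
        1# + - (q ^ g) ^ b  ≈⟨ 1-x*[] b (q ^ g) ⟨
        ⟨ g ⟩ * [ b ] (q ^ g)  ≈⟨ *-congˡ (trans (η.[]-homo b (x R.^ g)) (∑-cong b λ i _ → ^-congˡ i (η.^-homo x g))) ⟨
        ⟨ g ⟩ * η B  ∎
      EΛ≈ : η p.E * Λ ≈ η (p.F R.* B)
      EΛ≈ = *-cancelˡ (h≉0 m) (begin
        h m * (η p.E * Λ)  ≈⟨ solve 3 (λ h E l → h :* (E :* l) := E :* (l :* h)) ≡.refl (h m) (η p.E) Λ ⟩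
        η p.E * (Λ * h m)  ≈⟨ trans p.ratio (*-congˡ ⟨n⟩≈hB) ⟩
        η p.F * (h m * η B)  ≈⟨ solve 3 (λ h E l → E :* (h :* l) := h :* (E :* l)) ≡.refl (h m) (η p.F) (η B) ⟩
        h m * (η p.F * η B)  ≈⟨ *-congˡ (η.*-homo _ _) ⟨
        h m * η (p.F R.* B)  ∎)

  product-form : ∀ k → (ℕ → Carrier) → Form k
  product-form zero s = const 1#
  product-form (suc k) s = lin (1# + s k * s k) (- s k) (product-form k s)

  -- On the curve (u , v) = (a , 1 + a²) the linear form (1 + s²) u - s v becomes (1 - a s)(a - s).
  at : ∀ {k} → Form k → Carrier → Carrier
  at f a = eval f a (1# + a * a)

  at-product : ∀ k s a → at (product-form k s) a ≈ ∏ k λ i → root-pair (s i) a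
  at-product zero s a = refl
  at-product (suc k) s a = *-cong (at-product k s a)
    (solve 2 (λ s a → (:1 :+ s :* s) :* a :+ :- s :* (:1 :+ a :* a) := (:1 :- a :* s) :* (a :- s)) ≡.refl (s k) a)

  -- The linear factors left in the k-th summand once it is multiplied by denom d.
  mixed : ℕ → ℕ → Carrier
  mixed k j with j ℕ.<? k
  ... | yes _ = node j
  ... | no _ = q ^ (6 ℕ.* suc j)

  mixed-< : ∀ {k j} → j ℕ.< k → mixed k j ≈ node j
  mixed-< {k} {j} j<k with j ℕ.<? k
  ... | yes _ = refl
  ... | no j≮k = ⊥-elim (j≮k j<k)

  mixed-≥ : ∀ {k j} → k ℕ.≤ j → mixed k j ≈ q ^ (6 ℕ.* suc j)
  mixed-≥ {k} {j} k≤j with j ℕ.<? k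
  ... | yes j<k = ⊥-elim (ℕ.<-irrefl ≡.refl (ℕ.<-≤-trans j<k k≤j))
  ... | no _ = refl

  term-cleared : ∀ k a → k ℕ.≤ d → ¬ denom k a ≈ 0# →
    weight k * [8 k +1] * at (product-form d (mixed k)) a ≈ denom d a * term k a
  term-cleared k a k≤d D≉0 = begin
    w * at (product-form d (mixed k)) a  ≈⟨ *-congˡ (trans (at-product d (mixed k) a) (split (λ j → root-pair (mixed k j) a))) ⟩
    w * (∏ k (λ i → root-pair (mixed k i) a) * ∏ (d ℕ.∸ k) (λ j → root-pair (mixed k (k ℕ.+ j)) a))
      ≈⟨ *-congˡ (*-cong (∏-cong k λ i i<k → root-pair-congˡ a (mixed-< i<k)) (∏-cong (d ℕ.∸ k) λ j _ → root-pair-congˡ a (mixed-≥ (ℕ.m≤m+n k j)))) ⟩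
    w * (numer k a * rest)  ≈⟨ *-identityˡ _ ⟨
    1# * (w * (numer k a * rest))  ≈⟨ *-congʳ (inverseʳ D≉0) ⟨
    denom k a * denom k a ⁻¹ * (w * (numer k a * rest))
      ≈⟨ solve 5 (λ D i w N r → D :* i :* (w :* (N :* r)) := D :* r :* (w :* N :* i)) ≡.refl _ _ w _ rest ⟩
    denom k a * rest * term k a  ≈⟨ *-congʳ (split (λ j → root-pair (q ^ (6 ℕ.* suc j)) a)) ⟨
    denom d a * term k a  ∎
    where
    w rest : Carrier
    w = weight k * [8 k +1]
    rest = ∏ (d ℕ.∸ k) λ j → root-pair (q ^ (6 ℕ.* suc (k ℕ.+ j))) a
    split : ∀ f → ∏ d f ≈ ∏ k f * ∏ (d ℕ.∸ k) (λ j → f (k ℕ.+ j))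
    split f = trans (reflexive (≡.cong (λ z → ∏ z f) (≡.sym (ℕ.m+[n∸m]≡n k≤d)))) (∏-+ k (d ℕ.∸ k) f)

  sum-form : ℕ → Form d
  -- `Form` has no zero constructor; a zero multiple of any form of degree `d` serves.
  sum-form zero = scale 0# (product-form d node)
  sum-form (suc k) = sum-form k ⊞ scale (weight k * [8 k +1]) (product-form d (mixed k))

  at-sum : ∀ k a → k ℕ.≤ n → (∀ k → ¬ denom k a ≈ 0#) → at (sum-form k) a ≈ denom d a * ∑ k (λ k → term k a)
  at-sum zero a k≤n D≉0 = trans (zeroˡ _) (sym (zeroʳ _))
  at-sum (suc k) a (s≤s k≤d) D≉0 = trans (+-cong (at-sum k a (ℕ.m≤n⇒m≤1+n k≤d) D≉0) (term-cleared k a k≤d (D≉0 k))) (sym (distribˡ _ _ _))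

  difference : Form d
  difference = sum-form n ⊞ scale (- sum (node i₀)) (product-form d (λ j → q ^ (6 ℕ.* suc j)))

  at-difference : ∀ a → (∀ k → ¬ denom k a ≈ 0#) → at difference a ≈ denom d a * (sum a + - sum (node i₀))
  at-difference a D≉0 = begin
    at (sum-form n) a + - sum (node i₀) * at (product-form d (λ j → q ^ (6 ℕ.* suc j))) a
      ≈⟨ +-cong (at-sum n a ℕ.≤-refl D≉0) (*-congˡ (at-product d _ a)) ⟩
    denom d a * sum a + - sum (node i₀) * denom d a
      ≈⟨ solve 3 (λ D s r → D :* s :+ :- r :* D := D :* (s :- r)) ≡.refl (denom d a) (sum a) (sum (node i₀)) ⟩
    denom d a * (sum a + - sum (node i₀)) ∎

  basis : ℕ → Form d
  basis i = product-form d (node ∘ skip i)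

  -- `1 + a²` divides `1 - a⁴`, and a power of `q` is not a root of unity.
  abscissa≉0 : ∀ i → ¬ 1# + node i * node i ≈ 0#
  abscissa≉0 i e = ⟨suc⟩≉0 (2 ℕ.* i ℕ.+ m ℕ.+ (m ℕ.+ m)) (trans (sym (1-qˣqʸ (m ℕ.+ m) (m ℕ.+ m))) (begin
    1# + - (q ^ (m ℕ.+ m) * q ^ (m ℕ.+ m))  ≈⟨ +-congˡ (-‿cong (*-cong (^-homo-* q m m) (^-homo-* q m m))) ⟩
    1# + - (q ^ m * q ^ m * (q ^ m * q ^ m))  ≈⟨ solve 1 (λ a → :1 :- a :* a :* (a :* a) := (:1 :+ a :* a) :* (:1 :- a :* a)) ≡.refl (q ^ m) ⟩
    (1# + q ^ m * q ^ m) * (1# + - (q ^ m * q ^ m))  ≈⟨ trans (*-congʳ e) (zeroˡ _) ⟩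
    0#  ∎))
    where
    m : ℕ
    m = suc (2 ℕ.* i)

  node-distinct : ∀ i j → i ≢ j → ¬ root-pair (node i) (node j) ≈ 0#
  node-distinct i j i≢j = *-≉0
    (λ e → ⟨suc⟩≉0 (2 ℕ.* j ℕ.+ suc (2 ℕ.* i)) (trans (sym (1-qˣqʸ (suc (2 ℕ.* j)) (suc (2 ℕ.* i)))) e))
    (q^-distinct λ e → i≢j (≡.sym (ℕ.*-cancelˡ-≡ j i 2 (ℕ.suc-injective e))))

  at-basis : ∀ i a → at (basis i) a ≈ lagrange-denom i a
  at-basis i a = at-product d (node ∘ skip i) a

  expansion : ∀ a → at difference a ≈ ∑ n λ i → at difference (node i) * at (basis i) (node i) ⁻¹ * at (basis i) a
  expansion a = lagrange difference node (λ i → 1# + node i * node i) basis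
    (λ i _ → abscissa≉0 i)
    -- The determinant of the points belonging to `s` and `t` factors as `(1 - s t)(s - t)`, again a
    -- root pair.
    (λ i j i<j _ e → node-distinct j i (ℕ.<⇒≢ i<j ∘ ≡.sym) (trans
      (solve 2 (λ s t → (:1 :- s :* t) :* (s :- t) := (:1 :+ t :* t) :* s :- t :* (:1 :+ s :* s)) ≡.refl (node i) (node j)) e))
    (λ i j i≢j i≤d j≤d → trans (at-basis i (node j)) (vanish i j (skip-surjective i≢j i≤d j≤d)))
    (λ i _ e → lagrange-denom-at-node≉0 i (trans (sym (at-basis i (node i))) e))
    a (1# + a * a)
    where
    vanish : ∀ i j → ∃[ k ] (k ℕ.< d × skip i k ≡ j) → lagrange-denom i (node j) ≈ 0#
    vanish i j (k , k<d , ≡.refl) = ∏-zero d k k<d (trans (*-congˡ (-‿inverseʳ _)) (zeroʳ _))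

  -- At `i = i₀` the coefficient is zero. Every other basis form keeps the node `i₀` among its
  -- factors, which yields the root pair of `qⁿ`, while the coefficient yields `[ n ] q`.
  summand : ∀ i → i ℕ.≤ d → ∀ {a} → Integral a →
    InLoc ([ n ] q * root-pair (node i₀) a) (at difference (node i) * at (basis i) (node i) ⁻¹ * at (basis i) a)
  summand i i≤d {a} int = inLoc-resp (*-congʳ (sym coefficient)) (go (i ℕ.≟ i₀))
    where
    coefficient : at difference (node i) * at (basis i) (node i) ⁻¹ ≈ (sum (node i) + - sum (node i₀)) * node-ratio i
    coefficient = begin
      at difference (node i) * at (basis i) (node i) ⁻¹
        ≈⟨ *-cong (at-difference (node i) (λ k → denom-at-odd≉0 k i))
                  (⁻¹-cong (λ e → lagrange-denom-at-node≉0 i (trans (sym (at-basis i (node i))) e)) (at-basis i (node i))) ⟩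
      denom d (node i) * (sum (node i) + - sum (node i₀)) * lagrange-denom i (node i) ⁻¹
        ≈⟨ solve 3 (λ D s l → D :* s :* l := s :* (D :* l)) ≡.refl _ _ _ ⟩
      (sum (node i) + - sum (node i₀)) * node-ratio i ∎
    go : Dec (i ≡ i₀) → InLoc ([ n ] q * root-pair (node i₀) a) ((sum (node i) + - sum (node i₀)) * node-ratio i * at (basis i) a)
    go (yes ≡.refl) = inLoc-resp (sym (trans (*-congʳ (trans (*-congʳ (-‿inverseʳ _)) (zeroˡ _))) (zeroˡ _))) inLoc-0
    go (no i≢i₀) = inLoc-*
      (inLoc-resp (solve 3 (λ r r₀ l → r :* l :- r₀ :* l := (r :- r₀) :* l) ≡.refl _ _ _)
        (inLoc-+ (sum*ratio i i≤d) (inLoc-neg (sum₀*ratio i i≤d))))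
      (inLoc-resp (sym (at-basis i a)) (factor (skip-surjective i≢i₀ i≤d i₀≤d)))
      where
      factor : ∃[ k ] (k ℕ.< d × skip i k ≡ i₀) → InLoc (root-pair (node i₀) a) (lagrange-denom i a)
      factor (k , k<d , skip≡) = ≡.subst (λ z → InLoc (root-pair (node z) a) (lagrange-denom i a)) skip≡
        (∏-extract d k {λ j → root-pair (node (skip i j)) a} k<d λ j → integral-root-pair (suc (2 ℕ.* skip i j)) int)

  congruence : ∀ {a} → Integral a → (∀ k → ¬ denom k a ≈ 0#) →
    InLoc ([ n ] q * root-pair (node i₀) a) (denom d a * (sum a + - sum (node i₀)))
  congruence {a} int D≉0 = inLoc-resp (trans (sym (expansion a)) (at-difference a D≉0))
    (inLoc-∑ n λ i i<n → summand i (ℕ.s≤s⁻¹ i<n) int)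

-- The Jacobi symbol (-3/n)

open import Defs using (legendre-3; findDiv; spf; jac; jacobi-3)
import Data.Bool as Bool
open import Data.Bool.ListAction using (any)
open import Data.List using (upTo)
import Data.List.Relation.Unary.Any as Any
import Data.List.Relation.Unary.Any.Properties as Any
open import Data.List.Membership.Propositional.Properties using (∈-upTo⁺)
import Data.List.Membership.Propositional as Membership
open import Data.Nat.Combinatorics using (_C_; nCk+nC[k+1]≡[n+1]C[k+1]; k>n⇒nCk≡0; nCn≡1)
open import Data.Nat.Primality using (Prime; prime; euclidsLemma; prime⇒nonTrivial; _Rough_; 2-rough; ∤⇒rough-suc; rough∧∣⇒rough)
open import Data.Nat.DivMod using (_/_; _%_; m≡m%n+[m/n]*n; m%n<n; m/n<m; m/n*n≡m)
import Data.Integer.Divisibility.Signed as ℤ∣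
import Data.Integer.DivMod as ℤ
import Data.List.Properties as List

-- The carrier is kept and only the equality is coarsened, so representatives and ring operations
-- need no translation.
module Quotient (R : CommutativeRing 0ℓ 0ℓ) (m : CommutativeRing.Carrier R) where

  open RingTools R

  infix 4 _≈ₘ_
  record _≈ₘ_ (x y : Carrier) : Set where
    constructor multiple
    field
      factor     : Carrier
      difference : x + - y ≈ factor * m
  open _≈ₘ_

  lift : ∀ {x y} → x ≈ y → x ≈ₘ y
  lift e = multiple 0# (trans (+-congʳ e) (trans (-‿inverseʳ _) (sym (zeroˡ _))))

  quotientRing : CommutativeRing 0ℓ 0ℓ
  quotientRing = record
    { Carrier = Carrier
    ; _≈_ = _≈ₘ_
    ; _+_ = _+_
    ; _*_ = _*_
    ; -_ = -_
    ; 0# = 0#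
    ; 1# = 1#
    ; isCommutativeRing = record
      { isRing = record
        { +-isAbelianGroup = record
          { isGroup = record
            { isMonoid = record
              { isSemigroup = record
                { isMagma = record
                  { isEquivalence = record
                    { refl = lift refl
                    ; sym = λ {x} {y} (multiple k e) → multiple (- k) (trans (solve 2 (λ x y → y :- x := :- (x :- y)) ≡.refl x y)
                        (trans (-‿cong e) (solve 2 (λ k m → :- (k :* m) := :- k :* m) ≡.refl k m)))
                    ; trans = λ {x} {y} {z} (multiple k e) (multiple l f) → multiple (k + l)
                        (trans (solve 3 (λ x y z → x :- z := (x :- y) :+ (y :- z)) ≡.refl x y z)
                          (trans (+-cong e f) (sym (distribʳ m k l)))) }
                  ; ∙-cong = λ {x} {y} {u} {v} (multiple k e) (multiple l f) → multiple (k + l)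
                      (trans (solve 4 (λ x y u v → (x :+ u) :- (y :+ v) := (x :- y) :+ (u :- v)) ≡.refl x y u v)
                        (trans (+-cong e f) (sym (distribʳ m k l)))) }
                ; assoc = λ x y z → lift (+-assoc x y z) }
              ; identity = (λ x → lift (+-identityˡ x)) , (λ x → lift (+-identityʳ x)) }
            ; inverse = (λ x → lift (-‿inverseˡ x)) , (λ x → lift (-‿inverseʳ x))
            ; ⁻¹-cong = λ {x} {y} (multiple k e) → multiple (- k) (trans (solve 2 (λ x y → :- x :- :- y := :- (x :- y)) ≡.refl x y)
                (trans (-‿cong e) (solve 2 (λ k m → :- (k :* m) := :- k :* m) ≡.refl k m))) }
          ; comm = λ x y → lift (+-comm x y) }
        ; *-cong = λ {x} {y} {u} {v} (multiple k e) (multiple l f) → multiple (k * u + y * l)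
            (trans (solve 4 (λ x y u v → x :* u :- y :* v := (x :- y) :* u :+ y :* (u :- v)) ≡.refl x y u v)
              (trans (+-cong (*-congʳ e) (*-congˡ f))
                (solve 5 (λ k l m u y → k :* m :* u :+ y :* (l :* m) := (k :* u :+ y :* l) :* m) ≡.refl k l m u y)))
        ; *-assoc = λ x y z → lift (*-assoc x y z)
        ; *-identity = (λ x → lift (*-identityˡ x)) , (λ x → lift (*-identityʳ x))
        ; distrib = (λ x y z → lift (distribˡ x y z)) , (λ x y z → lift (distribʳ x y z)) }
      ; *-comm = λ x y → lift (*-comm x y) } }

-- For a prime `suc n` this leads, by Euclid's lemma, to the divisibility of the inner binomial
-- coefficients on which `frobenius` rests.
absorption : ∀ n k → suc k ℕ.* (suc n C suc k) ≡ suc n ℕ.* (n C k)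
absorption zero zero = ≡.refl
absorption zero (suc k) = ≡.trans (≡.cong (suc (suc k) ℕ.*_) (k>n⇒nCk≡0 {1} {2 ℕ.+ k} (s≤s (s≤s z≤n))))
  (≡.trans (ℕ.*-zeroʳ (2 ℕ.+ k)) (≡.sym (≡.trans (ℕ.+-identityʳ _) (k>n⇒nCk≡0 {0} {suc k} (s≤s z≤n)))))
absorption (suc n) zero = begin
  1 ℕ.* (suc (suc n) C 1)  ≡⟨ ≡.cong (1 ℕ.*_) (nCk+nC[k+1]≡[n+1]C[k+1] (suc n) 0) ⟨
  1 ℕ.* ((suc n C 0) ℕ.+ (suc n C 1))  ≡⟨ ℕ.*-distribˡ-+ 1 (suc n C 0) (suc n C 1) ⟩
  1 ℕ.* (suc n C 0) ℕ.+ 1 ℕ.* (suc n C 1)  ≡⟨ ≡.cong (1 ℕ.* (suc n C 0) ℕ.+_) (absorption n 0) ⟩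
  1 ℕ.* (suc n C 0) ℕ.+ suc n ℕ.* (n C 0)  ≡⟨ ≡.refl ⟩
  suc (suc n) ℕ.* (suc n C 0)  ∎
  where open ≡.≡-Reasoning
absorption (suc n) (suc k) = begin
  suc (suc k) ℕ.* (suc (suc n) C suc (suc k))
    ≡⟨ ≡.cong (suc (suc k) ℕ.*_) (nCk+nC[k+1]≡[n+1]C[k+1] (suc n) (suc k)) ⟨
  suc (suc k) ℕ.* (a ℕ.+ b)
    ≡⟨ lemma₁ k a b ⟩
  a ℕ.+ (suc k ℕ.* a ℕ.+ suc (suc k) ℕ.* b)
    ≡⟨ ≡.cong (a ℕ.+_) (≡.cong₂ ℕ._+_ (absorption n k) (absorption n (suc k))) ⟩
  a ℕ.+ (suc n ℕ.* (n C k) ℕ.+ suc n ℕ.* (n C suc k))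
    ≡⟨ ≡.cong (a ℕ.+_) (≡.trans (≡.sym (ℕ.*-distribˡ-+ (suc n) (n C k) (n C suc k))) (≡.cong (suc n ℕ.*_) (nCk+nC[k+1]≡[n+1]C[k+1] n k))) ⟩
  suc (suc n) ℕ.* a ∎
  where
  open ≡.≡-Reasoning
  a b : ℕ
  a = suc n C suc k
  b = suc n C suc (suc k)
  lemma₁ : ∀ k a b → suc (suc k) ℕ.* (a ℕ.+ b) ≡ a ℕ.+ (suc k ℕ.* a ℕ.+ suc (suc k) ℕ.* b)
  lemma₁ = ℕ-solve-∀

module _ (R : CommutativeRing 0ℓ 0ℓ) where

  open RingTools R

  ∑-suc : ∀ n f → ∑ (suc n) f ≈ f 0 + ∑ n (f ∘ suc)
  ∑-suc zero f = +-comm _ _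
  ∑-suc (suc n) f = trans (+-congʳ (∑-suc n f)) (+-assoc _ _ _)

  ∑-+ : ∀ n (f g : ℕ → Carrier) → ∑ n (λ k → f k + g k) ≈ ∑ n f + ∑ n g
  ∑-+ zero f g = sym (+-identityʳ _)
  ∑-+ (suc n) f g = trans (+-congʳ (∑-+ n f g)) (+-interchange _ _ _ _)

  binomial : ∀ n y → (1# + y) ^ n ≈ ∑ (suc n) (λ k → fromℕ (n C k) * y ^ k)
  binomial zero y = solve 0 (:1 := con (+ 0) :+ :1 :* :1) ≡.refl
  binomial (suc n) y = begin
    (1# + y) * (1# + y) ^ n  ≈⟨ *-congˡ (binomial n y) ⟩
    (1# + y) * ∑ (suc n) f  ≈⟨ solve 2 (λ y s → (:1 :+ y) :* s := s :+ y :* s) ≡.refl _ _ ⟩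
    ∑ (suc n) f + y * ∑ (suc n) f  ≈⟨ +-cong lower (sym (∑-distribˡ (suc n) y f)) ⟩
    1# + ∑ (suc n) (f ∘ suc) + ∑ (suc n) (λ k → y * f k)
      ≈⟨ trans (+-assoc _ _ _) (+-congˡ (sym (∑-+ (suc n) (f ∘ suc) (λ k → y * f k)))) ⟩
    1# + ∑ (suc n) (λ k → f (suc k) + y * f k)  ≈⟨ +-cong (sym (trans (*-identityʳ _) refl)) (∑-cong (suc n) λ k _ → pascal k) ⟩
    g 0 + ∑ (suc n) (g ∘ suc)  ≈⟨ ∑-suc (suc n) g ⟨
    ∑ (suc (suc n)) g  ∎
    where
    f g : ℕ → Carrier
    f k = fromℕ (n C k) * y ^ k
    g k = fromℕ (suc n C k) * y ^ k
    lower : ∑ (suc n) f ≈ 1# + ∑ (suc n) (f ∘ suc)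
    lower = begin
      ∑ (suc n) f  ≈⟨ +-identityʳ _ ⟨
      ∑ (suc n) f + 0#  ≈⟨ +-congˡ (trans (*-congʳ (reflexive (≡.cong fromℕ (k>n⇒nCk≡0 {n} {suc n} ℕ.≤-refl)))) (zeroˡ _)) ⟨
      ∑ (suc (suc n)) f  ≈⟨ ∑-suc (suc n) f ⟩
      f 0 + ∑ (suc n) (f ∘ suc)  ≈⟨ +-congʳ (*-identityʳ _) ⟩
      1# + ∑ (suc n) (f ∘ suc)  ∎
    pascal : ∀ k → f (suc k) + y * f k ≈ g (suc k)
    pascal k = begin
      fromℕ (n C suc k) * (y * y ^ k) + y * (fromℕ (n C k) * y ^ k)
        ≈⟨ solve 4 (λ a b y z → a :* (y :* z) :+ y :* (b :* z) := (b :+ a) :* (y :* z)) ≡.refl _ _ y (y ^ k) ⟩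
      (fromℕ (n C k) + fromℕ (n C suc k)) * (y * y ^ k)
        ≈⟨ *-congʳ (trans (sym (fromℕ-+ (n C k) (n C suc k))) (reflexive (≡.cong fromℕ (nCk+nC[k+1]≡[n+1]C[k+1] n k)))) ⟩
      fromℕ (suc n C suc k) * (y * y ^ k) ∎

module ResidueField (p₁ : ℕ) (p-prime : Prime (suc p₁)) where

  p : ℕ
  p = suc p₁

  private
    module Z = Quotient ℤ.+-*-commutativeRing (+ p)

  open RingTools Z.quotientRing

  fromℕ≡+ : ∀ n → fromℕ n ≡ + n
  fromℕ≡+ 0 = ≡.refl
  fromℕ≡+ 1 = ≡.refl
  fromℕ≡+ (suc (suc n)) = ≡.cong (ℤ._+_ (+ 1)) (fromℕ≡+ (suc n))

  ∣abs⇒≈0 : ∀ {x} → p ∣ ℤ.∣ x ∣ → x ≈ 0#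
  ∣abs⇒≈0 {x} p∣x with ℤ∣.∣ᵤ⇒∣ {+ p} {x} p∣x
  ... | ℤ∣.divides k x≡kp = Z.multiple k (≡.trans (ℤ.+-identityʳ x) x≡kp)

  ≈0⇒∣abs : ∀ {x} → x ≈ 0# → p ∣ ℤ.∣ x ∣
  ≈0⇒∣abs {x} (Z.multiple k e) = ℤ∣.∣⇒∣ᵤ {+ p} {x} (ℤ∣.divides k (≡.trans (≡.sym (ℤ.+-identityʳ x)) e))

  ∣⇒≈0 : ∀ {n} → p ∣ n → fromℕ n ≈ 0#
  ∣⇒≈0 {n} p∣n = ∣abs⇒≈0 (≡.subst (λ z → p ∣ ℤ.∣ z ∣) (≡.sym (fromℕ≡+ n)) p∣n)

  ≈0⇒∣ : ∀ {n} → fromℕ n ≈ 0# → p ∣ n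
  ≈0⇒∣ {n} e = ≡.subst (λ z → p ∣ ℤ.∣ z ∣) (fromℕ≡+ n) (≈0⇒∣abs e)

  p≢1 : p ≢ 1
  p≢1 e = ℕ.nonTrivial⇒≢1 {{prime⇒nonTrivial p-prime}} e

  residue-isDomain : IsDomain Z.quotientRing
  residue-isDomain = record
    { 1≉0 = λ e → p≢1 (∣.∣1⇒≡1 (≈0⇒∣ {1} e))
    ; _≈0? = λ x → Dec.map′ ∣abs⇒≈0 ≈0⇒∣abs (p ∣.∣? ℤ.∣ x ∣)
    ; cancel = λ {x} {y} x≉0 xy≈0 → Sum.fromInj₂ (λ p∣x → ⊥-elim (x≉0 (∣abs⇒≈0 p∣x)))
        (Sum.map₂ ∣abs⇒≈0 (euclidsLemma ℤ.∣ x ∣ ℤ.∣ y ∣ p-prime (≡.subst (λ z → p ∣ z) (ℤ.abs-* x y) (≈0⇒∣abs xy≈0)))) }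

  residue : ∀ X → ∃[ x ] (x ℕ.< p × fromℕ x ≈ X)
  residue X = x , ℤ.n%ℕd<d X p , sym (Z.multiple (X ℤ./ℕ p) (≡.trans (≡.cong₂ (λ a b → a + - b) (ℤ.a≡a%ℕn+[a/ℕn]*n X p) (fromℕ≡+ x))
      (cancel-left (+ x) ((X ℤ./ℕ p) * + p))))
    where
    x : ℕ
    x = X ℤ.%ℕ p
    open RingTools ℤ.+-*-commutativeRing using () renaming (solve to ℤ-solve; _:+_ to _⊕_; _:-_ to _⊖_; _:=_ to _⊜_)
    cancel-left : ∀ a b → a ℤ.+ b ℤ.+ ℤ.- a ≡ b
    cancel-left = ℤ-solve 2 (λ a b → (a ⊕ b) ⊖ a ⊜ b) ≡.refl

  residueRing : CommutativeRing 0ℓ 0ℓ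
  residueRing = Z.quotientRing

-- The residue ring enters as an abstract domain, so the arguments below use ring laws and never
-- integer representatives.
module PrimeField (F : CommutativeRing 0ℓ 0ℓ) (isDomain : IsDomain F) (p₁ : ℕ) (p-prime : Prime (suc p₁))
  (∣⇒≈0 : (n : ℕ) → suc p₁ ∣ n → CommutativeRing._≈_ F (RingTools.fromℕ F n) (CommutativeRing.0# F))
  (≈0⇒∣ : (n : ℕ) → CommutativeRing._≈_ F (RingTools.fromℕ F n) (CommutativeRing.0# F) → suc p₁ ∣ n)
  (residue : (X : CommutativeRing.Carrier F) → ∃[ x ] (x ℕ.< suc p₁ × CommutativeRing._≈_ F (RingTools.fromℕ F x) X)) where

  p : ℕ
  p = suc p₁

  open RingTools F
  p≢1 : p ≢ 1
  p≢1 e = ℕ.nonTrivial⇒≢1 {{prime⇒nonTrivial p-prime}} e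

  open IsDomain isDomain

  fromℕ≉0 : ∀ {n} → 0 ℕ.< n → n ℕ.< p → ¬ fromℕ n ≈ 0#
  fromℕ≉0 {n} 0<n n<p e = ℕ.<⇒≱ n<p (∣.∣⇒≤ {{ℕ.>-nonZero 0<n}} (≈0⇒∣ _ e))

  p∣pC : ∀ k → suc k ℕ.< p → p ∣ p C suc k
  p∣pC k 1+k<p = Sum.fromInj₂ (λ p∣1+k → ⊥-elim (ℕ.<⇒≱ 1+k<p (∣.∣⇒≤ p∣1+k)))
    (euclidsLemma (suc k) (p C suc k) p-prime (divides (p₁ C k) (≡.trans (absorption p₁ k) (ℕ.*-comm p (p₁ C k)))))

  frobenius : ∀ y → (1# + y) ^ p ≈ 1# + y ^ p
  frobenius y = begin
    (1# + y) ^ p  ≈⟨ binomial F p y ⟩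
    ∑ p f + f p  ≈⟨ +-cong (∑-suc F p₁ f) (trans (*-congʳ (reflexive (≡.cong fromℕ (nCn≡1 p)))) (*-identityˡ _)) ⟩
    f 0 + ∑ p₁ (f ∘ suc) + y ^ p  ≈⟨ +-congʳ (+-cong (*-identityʳ 1#) (∑-zero p₁ λ k k<p₁ → trans (*-congʳ (∣⇒≈0 _ (p∣pC k (s≤s k<p₁)))) (zeroˡ _))) ⟩
    1# + 0# + y ^ p  ≈⟨ +-congʳ (+-identityʳ 1#) ⟩
    1# + y ^ p  ∎
    where
    f : ℕ → Carrier
    f k = fromℕ (p C k) * y ^ k

  fermat : ∀ n → fromℕ n ^ p ≈ fromℕ n
  fermat zero = zeroˡ _
  fermat (suc n) = begin
    fromℕ (suc n) ^ p  ≈⟨ ^-congˡ p (fromℕ-suc n) ⟩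
    (1# + fromℕ n) ^ p  ≈⟨ frobenius (fromℕ n) ⟩
    1# + fromℕ n ^ p  ≈⟨ +-congˡ (fermat n) ⟩
    1# + fromℕ n  ≈⟨ fromℕ-suc n ⟨
    fromℕ (suc n)  ∎

  open BinaryForms F isDomain

  private
    pow : Carrier → Carrier → ∀ e → Form e
    pow α β zero = const 1#
    pow α β (suc e) = lin α β (pow α β e)

    eval-pow : ∀ α β e u v → eval (pow α β e) u v ≈ (α * u + β * v) ^ e
    eval-pow α β zero u v = refl
    eval-pow α β (suc e) u v = trans (*-congʳ (eval-pow α β e u v)) (*-comm _ _)

    bounded-search : ∀ {P : ℕ → Set} → (∀ i → Dec (P i)) → ∀ n → (∃[ i ] (i ℕ.≤ n × ¬ P i)) ⊎ (∀ i → i ℕ.≤ n → P i)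
    bounded-search P? zero with P? 0
    ... | yes P0 = inj₂ λ { zero _ → P0 }
    ... | no ¬P0 = inj₁ (0 , z≤n , ¬P0)
    bounded-search P? (suc n) with P? (suc n) | bounded-search P? n
    ... | _ | inj₁ (i , i≤n , ¬Pi) = inj₁ (i , ℕ.m≤n⇒m≤1+n i≤n , ¬Pi)
    ... | no ¬P | inj₂ _ = inj₁ (suc n , ℕ.≤-refl , ¬P)
    ... | yes P₁₊ₙ | inj₂ all = inj₂ λ i i≤1+n → Sum.[ (λ { (s≤s i≤n) → all i i≤n }) , (λ { ≡.refl → P₁₊ₙ }) ] (ℕ.m≤n⇒m<n∨m≡n i≤1+n)

  -- uᵉ - vᵉ has fewer than e + 1 zeros, so not all of 1, …, e + 1 are e-th roots of unity.
  non-root : ∀ e → 0 ℕ.< e → suc e ℕ.< p → ∃[ i ] (i ℕ.≤ e × ¬ fromℕ (suc i) ^ e + - 1# ≈ 0#)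
  non-root e 0<e 1+e<p with bounded-search (λ i → (fromℕ (suc i) ^ e + - 1#) ≈0?) e
  ... | inj₁ found = found
  -- The form is evaluated at `(0 , 1)`, where it equals -1 because `e` is positive.
  ... | inj₂ all = ⊥-elim (1≉0 (begin
    1#  ≈⟨ solve 1 (λ z → :1 := :- (con (+ 0) :- :1)) ≡.refl 1# ⟩
    - (0# + - 1#)  ≈⟨ -‿cong (+-cong (sym (0^e e 0<e)) (-‿cong (sym (1^ e)))) ⟩
    - (0# ^ e + - (1# ^ e))  ≈⟨ -‿cong (trans (sym (at-f 0# 1#)) (vanishing f (fromℕ ∘ suc) (λ _ → 1#) (λ _ _ → 1≉0) distinct root 0# 1#)) ⟩
    - 0#  ≈⟨ solve 0 (:- con (+ 0) := con (+ 0)) ≡.refl ⟩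
    0#  ∎))
    where
    f : Form e
    f = pow 1# 0# e ⊞ scale (- 1#) (pow 0# 1# e)
    at-f : ∀ u v → eval f u v ≈ u ^ e + - (v ^ e)
    at-f u v = trans
      (+-cong (trans (eval-pow 1# 0# e u v) (^-congˡ e (solve 2 (λ u v → :1 :* u :+ con (+ 0) :* v := u) ≡.refl u v)))
              (*-congˡ (trans (eval-pow 0# 1# e u v) (^-congˡ e (solve 2 (λ u v → con (+ 0) :* u :+ :1 :* v := v) ≡.refl u v)))))
      (solve 2 (λ a b → a :+ :- :1 :* b := a :- b) ≡.refl (u ^ e) (v ^ e))
    0^e : ∀ e → 0 ℕ.< e → 0# ^ e ≈ 0#
    0^e (suc e) _ = zeroˡ _
    1^ : ∀ e → 1# ^ e ≈ 1#
    1^ zero = refl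
    1^ (suc e) = trans (*-identityˡ _) (1^ e)
    root : ∀ i → i ℕ.≤ e → eval f (fromℕ (suc i)) 1# ≈ 0#
    root i i≤e = trans (at-f (fromℕ (suc i)) 1#) (trans (+-congˡ (-‿cong (1^ e))) (all i i≤e))
    distinct : ∀ i j → i ℕ.< j → j ℕ.≤ e → ¬ 1# * fromℕ (suc i) + - (fromℕ (suc j) * 1#) ≈ 0#
    distinct i j i<j j≤e eq = fromℕ≉0 (ℕ.m<n⇒0<n∸m i<j) (ℕ.≤-<-trans (ℕ.m∸n≤m j i) (ℕ.≤-<-trans j≤e (ℕ.<-trans ℕ.≤-refl 1+e<p))) (begin
      fromℕ (j ℕ.∸ i)
        ≈⟨ solve 2 (λ a b → a := (a :+ b) :- b) ≡.refl (fromℕ (j ℕ.∸ i)) (fromℕ (suc i)) ⟩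
      fromℕ (j ℕ.∸ i) + fromℕ (suc i) + - fromℕ (suc i)
        ≈⟨ +-congʳ (trans (sym (fromℕ-+ (j ℕ.∸ i) (suc i))) (reflexive (≡.cong fromℕ (≡.trans (ℕ.+-suc (j ℕ.∸ i) i) (≡.cong suc (ℕ.m∸n+n≡m (ℕ.<⇒≤ i<j))))))) ⟩
      fromℕ (suc j) + - fromℕ (suc i)
        ≈⟨ solve 2 (λ a b → b :- a := :- (:1 :* a :- b :* :1)) ≡.refl (fromℕ (suc i)) (fromℕ (suc j)) ⟩
      - (1# * fromℕ (suc i) + - (fromℕ (suc j) * 1#))
        ≈⟨ trans (-‿cong eq) (solve 0 (:- con (+ 0) := con (+ 0)) ≡.refl) ⟩
      0# ∎)

  -- If `y ^ e ≠ 1` then `w = y ^ e` satisfies `w³ = 1` by Fermat, hence `w² + w + 1 = 0`, and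
  -- `(1 + 2 w)² = -3`.
  sqrt-3 : ∀ e → p ≡ 1 ℕ.+ e ℕ.* 3 → ∃[ x ] (x ℕ.< p × p ∣ x ℕ.* x ℕ.+ 3)
  sqrt-3 zero p≡1 = ⊥-elim (p≢1 p≡1)
  sqrt-3 e@(suc e-1) p≡1+3e with non-root e (s≤s z≤n) (ℕ.<-≤-trans (s≤s (s≤s (s≤s (ℕ.≤-trans (ℕ.m≤m*n e-1 3) (ℕ.n≤1+n _))))) (ℕ.≤-reflexive (≡.sym p≡1+3e)))
  ... | i , i≤e , w≉1 = x , proj₁ (proj₂ (residue X)) , ≈0⇒∣ (x ℕ.* x ℕ.+ 3) (begin
    fromℕ (x ℕ.* x ℕ.+ 3)  ≈⟨ trans (fromℕ-+ (x ℕ.* x) 3) (+-congʳ (fromℕ-* x x)) ⟩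
    fromℕ x * fromℕ x + fromℕ 3 ≈⟨ +-congʳ (*-cong x≈X x≈X) ⟩
    X * X + fromℕ 3  ≈⟨ solve 1 (λ w → (:1 :+ (w :+ w)) :* (:1 :+ (w :+ w)) :+ con (+ 3) := con (+ 4) :* (w :* w :+ w :+ :1)) ≡.refl w ⟩
    fromℕ 4 * (w * w + w + 1#)  ≈⟨ trans (*-congˡ w²+w+1≈0) (zeroʳ _) ⟩
    0#  ∎)
    where
    y w : Carrier
    y = fromℕ (suc i)
    w = y ^ e
    X : Carrier
    X = 1# + (w + w)
    x : ℕ
    x = proj₁ (residue X)
    x≈X : fromℕ x ≈ X
    x≈X = proj₂ (proj₂ (residue X))
    suc-i<p : suc i ℕ.< p
    suc-i<p = ℕ.≤-<-trans (s≤s i≤e) (ℕ.<-≤-trans (s≤s (s≤s (s≤s (ℕ.≤-trans (ℕ.m≤m*n e-1 3) (ℕ.n≤1+n _))))) (ℕ.≤-reflexive (≡.sym p≡1+3e)))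
    w³≈1 : w ^ 3 ≈ 1#
    w³≈1 = *-cancelˡ (fromℕ≉0 {suc i} (s≤s z≤n) suc-i<p) (begin
      y * w ^ 3  ≈⟨ *-congˡ (^-assocʳ y e 3) ⟩
      y ^ (1 ℕ.+ e ℕ.* 3)  ≈⟨ ^-congʳ y p≡1+3e ⟨
      y ^ p  ≈⟨ fermat (suc i) ⟩
      y  ≈⟨ *-identityʳ y ⟨
      y * 1#  ∎)
    w²+w+1≈0 : w * w + w + 1# ≈ 0#
    w²+w+1≈0 = cancel w≉1 (trans (solve 1 (λ w → (w :- :1) :* (w :* w :+ w :+ :1) := w :^ 3 :- :1) ≡.refl w)
      (trans (+-congʳ w³≈1) (-‿inverseʳ 1#)))

  -- Fermat gives `n = (n³)^e n²`, so a nonzero residue is determined by its cube. A root of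
  -- `x² = -3` would give `x - 1` the cube `8 = 2³`; then `x = 3`, and `x² + 3 = 12` would vanish
  -- modulo `p`.
  no-sqrt-3 : ∀ e → p ≡ 2 ℕ.+ e ℕ.* 3 → Coprime p 6 → ∀ x → ¬ p ∣ x ℕ.* x ℕ.+ 3
  no-sqrt-3 e p≡2+3e p⊥6 x p∣x²+3 = go x p∣x²+3
    where
    -- `36 = 6 · 6`, so a prime dividing one of its divisors would divide 6. This covers 2, 3, 4 and
    -- 12.
    not-6-smooth : ∀ c b → c ℕ.* b ≡ 36 → ¬ fromℕ c ≈ 0#
    not-6-smooth c b cb≡36 c≈0 = p≢1 (p⊥6 (∣.∣-refl , coprime-divisor p⊥6 (≡.subst (λ z → p ∣ z) cb≡36 (∣.∣m⇒∣m*n b (≈0⇒∣ c c≈0)))))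
    to-third : ∀ n → (fromℕ n) ^ p ≈ (fromℕ n ^ 3) ^ e * fromℕ n ^ 2
    to-third n = begin
      fromℕ n ^ p  ≈⟨ ^-congʳ (fromℕ n) (≡.trans p≡2+3e (≡.trans (ℕ.+-comm 2 (e ℕ.* 3)) (≡.cong (ℕ._+ 2) (ℕ.*-comm e 3)))) ⟩
      fromℕ n ^ (3 ℕ.* e ℕ.+ 2)  ≈⟨ ^-homo-* (fromℕ n) (3 ℕ.* e) 2 ⟩
      fromℕ n ^ (3 ℕ.* e) * fromℕ n ^ 2  ≈⟨ *-congʳ (^-assocʳ (fromℕ n) 3 e) ⟨
      (fromℕ n ^ 3) ^ e * fromℕ n ^ 2  ∎
    go : ∀ x → ¬ p ∣ x ℕ.* x ℕ.+ 3
    go zero p∣3 = not-6-smooth 3 12 ≡.refl (∣⇒≈0 3 p∣3)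
    go (suc n) p∣x²+3 = not-6-smooth 12 3 ≡.refl (begin
        fromℕ 12  ≈⟨ solve 0 (con (+ 12) := (:1 :+ con (+ 2)) :* (:1 :+ con (+ 2)) :+ con (+ 3)) ≡.refl ⟩
        (1# + fromℕ 2) * (1# + fromℕ 2) + fromℕ 3 ≈⟨ +-congʳ (*-cong (+-congˡ (sym z≈2)) (+-congˡ (sym z≈2))) ⟩
        (1# + z) * (1# + z) + fromℕ 3  ≈⟨ x²+3≈0 ⟩
        0#  ∎)
      where
      z c : Carrier
      z = fromℕ n
      c = fromℕ 8 ^ e
      x²+3≈0 : (1# + z) * (1# + z) + fromℕ 3 ≈ 0#
      x²+3≈0 = trans (+-congʳ (*-cong (sym (fromℕ-suc n)) (sym (fromℕ-suc n))))
        (trans (sym (trans (fromℕ-+ (suc n ℕ.* suc n) 3) (+-congʳ (fromℕ-* (suc n) (suc n))))) (∣⇒≈0 (suc n ℕ.* suc n ℕ.+ 3) p∣x²+3))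
      z≉0 : ¬ z ≈ 0#
      z≉0 z≈0 = not-6-smooth 4 9 ≡.refl (trans (solve 0 (con (+ 4) := (:1 :+ con (+ 0)) :* (:1 :+ con (+ 0)) :+ con (+ 3)) ≡.refl)
        (trans (+-congʳ (*-cong (+-congˡ (sym z≈0)) (+-congˡ (sym z≈0)))) x²+3≈0))
      -- (x - 1)³ = 8 when x² = -3.
      z³≈8 : z ^ 3 ≈ fromℕ 8
      z³≈8 = begin
        z ^ 3  ≈⟨ solve 1 (λ z → z :^ 3 := ((:1 :+ z) :* (:1 :+ z) :+ con (+ 3)) :* (z :- con (+ 2)) :+ con (+ 8)) ≡.refl z ⟩
        ((1# + z) * (1# + z) + fromℕ 3) * (z + - fromℕ 2) + fromℕ 8  ≈⟨ +-congʳ (trans (*-congʳ x²+3≈0) (zeroˡ _)) ⟩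
        0# + fromℕ 8  ≈⟨ +-identityˡ _ ⟩
        fromℕ 8  ∎
      cz≈1 : c * z ≈ 1#
      cz≈1 = *-cancelˡ z≉0 (begin
        z * (c * z)  ≈⟨ solve 2 (λ z c → z :* (c :* z) := c :* z :^ 2) ≡.refl z c ⟩
        c * z ^ 2  ≈⟨ *-congʳ (^-congˡ e (sym z³≈8)) ⟩
        (z ^ 3) ^ e * z ^ 2  ≈⟨ trans (sym (to-third n)) (fermat n) ⟩
        z  ≈⟨ *-identityʳ z ⟨
        z * 1#  ∎)
      c2≈1 : c * fromℕ 2 ≈ 1#
      c2≈1 = *-cancelˡ (not-6-smooth 2 18 ≡.refl) (begin
        fromℕ 2 * (c * fromℕ 2)  ≈⟨ solve 1 (λ c → con (+ 2) :* (c :* con (+ 2)) := c :* con (+ 2) :^ 2) ≡.refl c ⟩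
        c * fromℕ 2 ^ 2  ≈⟨ *-congʳ (^-congˡ e (solve 0 (con (+ 8) := con (+ 2) :^ 3) ≡.refl)) ⟩
        (fromℕ 2 ^ 3) ^ e * fromℕ 2 ^ 2  ≈⟨ trans (sym (to-third 2)) (fermat 2) ⟩
        fromℕ 2  ≈⟨ *-identityʳ _ ⟨
        fromℕ 2 * 1#  ∎)
      z≈2 : z ≈ fromℕ 2
      z≈2 = *-cancelˡ {c} (λ c≈0 → 1≉0 (trans (sym c2≈1) (trans (*-congʳ c≈0) (zeroˡ _)))) (trans cz≈1 (sym c2≈1))

-- The character modulo 3 and the computed Jacobi symbol

χ-+3 : ∀ e r → χ (r ℕ.+ e ℕ.* 3) ≡ χ r
χ-+3 zero r = ≡.cong χ (ℕ.+-identityʳ r)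
χ-+3 (suc e) r = ≡.trans (≡.cong χ (shuffle r (e ℕ.* 3))) (χ-+3 e r)
  where
  shuffle : ∀ r s → r ℕ.+ (3 ℕ.+ s) ≡ 3 ℕ.+ (r ℕ.+ s)
  shuffle = ℕ-solve-∀

χ-* : ∀ m n → χ (m ℕ.* n) ≡ χ m ℤ.* χ n
χ-* 0 n = ≡.refl
χ-* 1 n = ≡.trans (≡.cong χ (ℕ.+-identityʳ n)) (≡.sym (ℤ.*-identityˡ (χ n)))
χ-* 2 0 = ≡.refl
χ-* 2 1 = ≡.refl
χ-* 2 2 = ≡.refl
χ-* 2 (suc (suc (suc n))) = ≡.trans (≡.cong χ (shuffle n)) (χ-* 2 n)
  where
  shuffle : ∀ n → 2 ℕ.* (3 ℕ.+ n) ≡ 6 ℕ.+ 2 ℕ.* n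
  shuffle = ℕ-solve-∀
χ-* (suc (suc (suc m))) n = ≡.trans (≡.cong χ (shuffle m n)) (≡.trans (χ-+3 n (m ℕ.* n)) (χ-* m n))
  where
  shuffle : ∀ m n → (3 ℕ.+ m) ℕ.* n ≡ m ℕ.* n ℕ.+ n ℕ.* 3
  shuffle = ℕ-solve-∀

legendre-χ : ∀ p → Prime p → Coprime p 6 → legendre-3 p ≡ χ p
legendre-χ (suc p₁) p-prime p⊥6 = go (p % 3) (p / 3) (m≡m%n+[m/n]*n p 3) (m%n<n p 3)
  where
  open ResidueField p₁ p-prime using (residueRing; residue-isDomain; ∣⇒≈0; ≈0⇒∣; residue)
  open PrimeField residueRing residue-isDomain p₁ p-prime (λ n → ∣⇒≈0 {n}) (λ n → ≈0⇒∣ {n}) residue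
  is-root : ℕ → Bool
  is-root x = does (p ∣.∣? (x ℕ.* x ℕ.+ 3))
  legendre-value : legendre-3 p ≡ (if any is-root (upTo p) then + 1 else ℤ.- (+ 1))
  legendre-value = ≡.cong (λ b → if b then + 0 else if any is-root (upTo p) then + 1 else ℤ.- (+ 1))
    (Dec.dec-false (p ∣.∣? 3) λ p∣3 → p≢1 (p⊥6 (∣.∣-refl , ∣.∣-trans p∣3 (divides 2 ≡.refl))))
  from-does : ∀ {P : Set} (P? : Dec P) → Bool.T (does P?) → P
  from-does (yes P) _ = P
  to-does : ∀ {P : Set} (P? : Dec P) → P → Bool.T (does P?)
  to-does (yes _) _ = _
  to-does (no ¬P) P = ⊥-elim (¬P P)
  T-any : Bool.T (any is-root (upTo p)) → ∃[ x ] p ∣ x ℕ.* x ℕ.+ 3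
  T-any t with Any.satisfied (Any.any⁻ is-root (upTo p) t)
  ... | x , is-root-x = x , from-does (p ∣.∣? (x ℕ.* x ℕ.+ 3)) is-root-x
  select : ∀ b {c} → (c ≡ + 1 → Bool.T b) → (Bool.T b → c ≡ + 1) → c ≡ + 1 ⊎ c ≡ ℤ.- (+ 1) → (if b then + 1 else ℤ.- (+ 1)) ≡ c
  select true to from _ = ≡.sym (from _)
  select false to from (inj₁ c≡1) = ⊥-elim (to c≡1)
  select false to from (inj₂ c≡-1) = ≡.sym c≡-1
  go : ∀ r e → p ≡ r ℕ.+ e ℕ.* 3 → r ℕ.< 3 → legendre-3 p ≡ χ p
  go 0 e p≡3e _ with p⊥6 {3} (divides e p≡3e , divides 2 ≡.refl)
  ... | ()
  go 1 e p≡1+3e _ = ≡.trans legendre-value (select (any is-root (upTo p)) (λ _ → found (sqrt-3 e p≡1+3e)) (λ _ → χp≡1) (inj₁ χp≡1))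
    where
    χp≡1 : χ p ≡ + 1
    χp≡1 = ≡.trans (≡.cong χ p≡1+3e) (χ-+3 e 1)
    found : ∃[ x ] (x ℕ.< p × p ∣ x ℕ.* x ℕ.+ 3) → Bool.T (any is-root (upTo p))
    found (x , x<p , p∣x²+3) = Any.any⁺ is-root (Membership.lose (∈-upTo⁺ x<p) (to-does (p ∣.∣? (x ℕ.* x ℕ.+ 3)) p∣x²+3))
  go 2 e p≡2+3e _ = ≡.trans legendre-value (select (any is-root (upTo p))
    (λ χp≡1 → case-absurd (≡.trans (≡.sym χp≡-1) χp≡1)) (λ t → ⊥-elim (no-sqrt-3 e p≡2+3e p⊥6 (proj₁ (T-any t)) (proj₂ (T-any t)))) (inj₂ χp≡-1))
    where
    χp≡-1 : χ p ≡ -[1+ 0 ]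
    χp≡-1 = ≡.trans (≡.cong χ p≡2+3e) (χ-+3 e 2)
    case-absurd : ∀ {A : Set} → -[1+ 0 ] ≡ + 1 → A
    case-absurd ()
  go (suc (suc (suc r))) e _ (s≤s (s≤s (s≤s ())))

-- The invariant `n ≤ f + d` means that fuel runs out only when the candidate has reached `n`.
-- Nothing smaller divides `n` then, so the default answer `n` is its least divisor.
findDiv-spec : ∀ f d n → 2 ℕ.≤ d → 2 ℕ.≤ n → n ℕ.≤ f ℕ.+ d → d Rough n →
               findDiv f d n ∣ n × 2 ℕ.≤ findDiv f d n × findDiv f d n Rough n
findDiv-spec zero d n 2≤d 2≤n n≤d rough = ∣.∣-refl , 2≤n , rough-≤ n≤d rough
  where
  rough-≤ : ∀ {m n o} → m ℕ.≤ n → n Rough o → m Rough o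
  rough-≤ m≤n r (∣.hasNonTrivialDivisor d<m d∣o) = r (∣.hasNonTrivialDivisor (ℕ.<-≤-trans d<m m≤n) d∣o)
findDiv-spec (suc f) d n 2≤d 2≤n n≤ rough with d ∣.∣? n
... | yes d∣n = d∣n , 2≤d , rough
... | no d∤n = findDiv-spec f (suc d) n (ℕ.m≤n⇒m≤1+n 2≤d) 2≤n (ℕ.≤-trans n≤ (ℕ.≤-reflexive (≡.sym (ℕ.+-suc f d)))) (∤⇒rough-suc d∤n rough)

spf-∣ : ∀ n → 2 ℕ.≤ n → spf n ∣ n
spf-∣ n 2≤n = proj₁ (findDiv-spec n 2 n ℕ.≤-refl 2≤n (ℕ.m≤m+n n 2) 2-rough)

spf-prime : ∀ n → 2 ℕ.≤ n → Prime (spf n)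
spf-prime n 2≤n with findDiv-spec n 2 n ℕ.≤-refl 2≤n (ℕ.m≤m+n n 2) 2-rough
... | p∣n , 2≤p , rough = prime {{ℕ.n>1⇒nonTrivial 2≤p}} (rough∧∣⇒rough rough p∣n)

-- Both functions split off the smallest prime factor, `jac` by definition and `χ` by
-- multiplicativity. The cofactor is smaller and still coprime with 6, so the fuel suffices.
jac-χ : ∀ f n → n ℕ.≤ f → 0 ℕ.< n → Coprime n 6 → jac f n ≡ χ n
jac-χ (suc f) (suc zero) _ _ _ = ≡.refl
jac-χ (suc f) (suc (suc m)) (s≤s n≤f) _ n⊥6
  with spf (suc (suc m)) | spf-∣ (suc (suc m)) (s≤s (s≤s z≤n)) | spf-prime (suc (suc m)) (s≤s (s≤s z≤n))
... | zero | _ | prime {{()}} _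
... | suc p | p∣n | p-prime = begin
  legendre-3 (suc p) ℤ.* jac f k  ≡⟨ ≡.cong₂ ℤ._*_ (legendre-χ (suc p) p-prime (λ (e∣p , e∣6) → n⊥6 (∣.∣-trans e∣p p∣n , e∣6)))
                                           (jac-χ f k (ℕ.≤-trans (ℕ.s≤s⁻¹ k<n) n≤f) 0<k (λ (e∣k , e∣6) → n⊥6 (∣.∣-trans e∣k k∣n , e∣6))) ⟩
  χ (suc p) ℤ.* χ k  ≡⟨ χ-* (suc p) k ⟨
  χ (suc p ℕ.* k)  ≡⟨ ≡.cong χ p*k≡n ⟩
  χ n  ∎
  where
  open ≡.≡-Reasoning
  n k : ℕ
  n = suc (suc m)
  k = n / suc p
  p*k≡n : suc p ℕ.* k ≡ n
  p*k≡n = ≡.trans (ℕ.*-comm (suc p) k) (m/n*n≡m p∣n)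
  k∣n : k ∣ n
  k∣n = divides (suc p) (≡.sym p*k≡n)
  k<n : k ℕ.< n
  k<n = m/n<m n (suc p) (ℕ.nonTrivial⇒n>1 (suc p) {{prime⇒nonTrivial p-prime}})
  0<k : 0 ℕ.< k
  0<k = ℕ.n≢0⇒n>0 λ k≡0 → ℕ.0≢1+n (≡.trans (≡.sym (≡.trans (≡.cong (suc p ℕ.*_) k≡0) (ℕ.*-zeroʳ (suc p)))) p*k≡n)

jacobi-3-χ : ∀ n → 0 ℕ.< n → Coprime n 6 → jacobi-3 n ≡ χ n
jacobi-3-χ n = jac-χ n n ℕ.≤-refl

-- Coprimality in two variables

-- The facts about polynomials that the coprimality argument consumes. Only the two lowest
-- coefficients are exposed, and coefficient lists stay hidden.
record IsPolynomialRing (B P : CommutativeRing 0ℓ 0ℓ)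
  (const : CommutativeRing.Carrier B → CommutativeRing.Carrier P) (X : CommutativeRing.Carrier P)
  (coeff₀ coeff₁ : CommutativeRing.Carrier P → CommutativeRing.Carrier B) : Set where
  private
    module B = CommutativeRing B
    open CommutativeRing P
  field
    const-isHom     : IsHom B P const
    coeff₀-isHom    : IsHom P B coeff₀
    coeff₀-const    : ∀ r → coeff₀ (const r) B.≈ r
    coeff₀-X        : coeff₀ X B.≈ B.0#
    coeff₁-cong     : ∀ {p p′} → p ≈ p′ → coeff₁ p B.≈ coeff₁ p′
    coeff₁-+        : ∀ p p′ → coeff₁ (p + p′) B.≈ coeff₁ p B.+ coeff₁ p′
    coeff₁-const    : ∀ r → coeff₁ (const r) B.≈ B.0#
    coeff₁-const-*  : ∀ r p → coeff₁ (const r * p) B.≈ r B.* coeff₁ p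
    coeff₁-X-*      : ∀ p → coeff₁ (X * p) B.≈ coeff₀ p
    constant-factor : ∀ {p p′ r} → ¬ r B.≈ B.0# → p * p′ ≈ const r → p ≈ const (coeff₀ p)
    cancel-X        : ∀ p p′ r → ¬ coeff₀ p B.≈ B.0# → p * p′ ≈ r * X → ∃[ p″ ] p * p″ ≈ r

polynomialRing-isPolynomialRing : (R : CommutativeRing 0ℓ 0ℓ) (domain : IsDomain R) → let open Polynomials R in
  IsPolynomialRing R polynomialRing const X (_! 0) (_! 1)
polynomialRing-isPolynomialRing R domain = record
  { const-isHom = P.const-isHom
  ; coeff₀-isHom = P.!0-isHom
  ; coeff₀-const = λ r → refl
  ; coeff₀-X = refl
  ; coeff₁-cong = λ e → e P.!≈ 1
  ; coeff₁-+ = λ p p′ → P.add-! p p′ 1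
  ; coeff₁-const = λ r → refl
  ; coeff₁-const-* = λ r p → P.const-mul-! r p 1
  ; coeff₁-X-* = λ p → P.X-mul p P.!≈ 1
  ; constant-factor = λ {p} {p′} {r} r≉0 e → P.coeffwise λ
      { zero → refl
      ; (suc k) → P.factor-of-constant domain p p′ (P.const r) e (λ z → r≉0 (z P.!≈ 0)) (λ _ → refl) k }
  ; cancel-X = P.cancel-X domain }
  where
  open CommutativeRing R using (refl)
  module P = Polynomials R

module Coprimality {Z R S : CommutativeRing 0ℓ 0ℓ} (Z-isDomain : IsDomain Z) (R-isDomain : IsDomain R)
  {ζ : CommutativeRing.Carrier Z → CommutativeRing.Carrier R} {x : CommutativeRing.Carrier R}
  {r₀ r₁ : CommutativeRing.Carrier R → CommutativeRing.Carrier Z} (R-poly : IsPolynomialRing Z R ζ x r₀ r₁)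
  {κ : CommutativeRing.Carrier R → CommutativeRing.Carrier S} {A : CommutativeRing.Carrier S}
  {s₀ s₁ : CommutativeRing.Carrier S → CommutativeRing.Carrier R} (S-poly : IsPolynomialRing R S κ A s₀ s₁) where

  private
    module Z = RingTools Z
    module R = RingTools R
    open IsDomain R-isDomain using () renaming (cancel to R-cancel; *-≉0 to R-*-≉0; ^-≉0 to R-^-≉0; ∏-≉0 to R-∏-≉0)
    module R-poly = IsPolynomialRing R-poly
    module S-poly = IsPolynomialRing S-poly
    module κ = Homomorphism S-poly.const-isHom
    module at₀ = Homomorphism S-poly.coeff₀-isHom
    module at₀₀ = Homomorphism R-poly.coeff₀-isHom
    module Z-const = Homomorphism R-poly.const-isHom
  open RingTools S

  pair : Carrier → Carrier → Carrier
  pair s a = (1# + - (a * s)) * (a + - s)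

  x≉0 : ¬ x R.≈ R.0#
  x≉0 e = IsDomain.1≉0 Z-isDomain (Z.trans (Z.sym r₁x) (Z.trans (R-poly.coeff₁-cong (R.trans e (R.sym Z-const.0#-homo))) (R-poly.coeff₁-const Z.0#)))
    where
    r₁x : r₁ x Z.≈ Z.1#
    r₁x = Z.trans (R-poly.coeff₁-cong (R.sym (R.*-identityʳ x))) (Z.trans (R-poly.coeff₁-X-* R.1#) at₀₀.1#-homo)

  x^suc≉1 : ∀ j → ¬ x R.^ suc j R.≈ R.1#
  x^suc≉1 j e = IsDomain.1≉0 Z-isDomain (Z.trans (Z.sym at₀₀.1#-homo) (Z.trans (at₀₀.⟦⟧-cong (R.sym e))
    (Z.trans (at₀₀.*-homo x (x R.^ j)) (Z.trans (Z.*-congʳ R-poly.coeff₀-X) (Z.zeroˡ _)))))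

  x^-distinct : ∀ {m n} → m ≢ n → ¬ x R.^ m R.+ R.- x R.^ n R.≈ R.0#
  x^-distinct {m} {n} m≢n e = go (ℕ.<-cmp m n)
    where
    ordered : ∀ {m n} → m ℕ.< n → ¬ x R.^ m R.≈ x R.^ n
    ordered {m} {n} m<n eq with ℕ.m≤n⇒∃[o]m+o≡n m<n
    ... | o , ≡.refl = R-*-≉0 (R-^-≉0 m x≉0) (λ z → x^suc≉1 o (R.sym (R.x-y≈0⇒x≈y z)))
      (R.trans (R.solve 2 (λ y z → y R.:* (R.:1 R.:- z) R.:= y R.:- y R.:* z) ≡.refl (x R.^ m) (x R.^ suc o))
        (R.trans (R.+-congˡ (R.-‿cong (R.trans (R.sym (R.^-homo-* x m (suc o))) (R.trans (R.^-congʳ x (ℕ.+-suc m o)) (R.sym eq))))) (R.-‿inverseʳ (x R.^ m))))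
    go : Tri (m ℕ.< n) (m ≡ n) (n ℕ.< m) → ⊥
    go (tri< m<n _ _) = ordered m<n (R.x-y≈0⇒x≈y e)
    go (tri≈ _ m≡n _) = m≢n m≡n
    go (tri> _ _ n<m) = ordered n<m (R.sym (R.x-y≈0⇒x≈y e))

  1-x^suc≉0 : ∀ j → ¬ R.1# R.+ R.- x R.^ suc j R.≈ R.0#
  1-x^suc≉0 j e = x^suc≉1 j (R.sym (R.x-y≈0⇒x≈y e))

  -- Comaximality over the fraction field of R: the ideal (p , t) contains the image of r.
  Reaches : Carrier → Carrier → R.Carrier → Set
  Reaches p t r = ∃[ u ] ∃[ v ] p * u + t * v ≈ κ r

  -- Write the pair of `s` as `L s = (1 + s²) a - s (1 + a²)`. Then `(1 + t²) L s - (1 + s²) L t`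
  -- and `t L s - s L t` are `1 + a²` and `a` times the stated element of `R`; the first minus `a`
  -- times the second gives the witnesses.
  reaches-pair : ∀ s t → Reaches (pair (κ s) A) (pair (κ t) A) ((t R.+ R.- s) R.* (R.1# R.+ R.- (s R.* t)))
  reaches-pair s t = 1# + κ t * κ t + - (A * κ t) , - (1# + κ s * κ s) + A * κ s , trans
    (solve 3 (λ a s t → let pair = λ s → (:1 :- a :* s) :* (a :- s) in
      pair s :* (:1 :+ t :* t :- a :* t) :+ pair t :* (:- (:1 :+ s :* s) :+ a :* s) := (t :- s) :* (:1 :- s :* t)) ≡.refl A (κ s) (κ t))
    (sym (trans (κ.*-homo (t R.+ R.- s) (R.1# R.+ R.- (s R.* t)))
      (*-cong (trans (κ.+-homo t (R.- s)) (+-congˡ (κ.-‿homo s)))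
              (trans (κ.+-homo R.1# (R.- (s R.* t))) (+-cong κ.1#-homo (trans (κ.-‿homo (s R.* t)) (-‿cong (κ.*-homo s t))))))))

  reaches-* : ∀ {p t t′ r r′} → Reaches p t r → Reaches p t′ r′ → Reaches p (t * t′) (r R.* r′)
  reaches-* {p} {t} {t′} {r} {r′} (u , v , e) (u′ , v′ , e′) = p * u * u′ + u * t′ * v′ + t * v * u′ , v * v′ , (begin
    p * (p * u * u′ + u * t′ * v′ + t * v * u′) + t * t′ * (v * v′)
      ≈⟨ solve 7 (λ p t t′ u v u′ v′ → p :* (p :* u :* u′ :+ u :* t′ :* v′ :+ t :* v :* u′) :+ t :* t′ :* (v :* v′)
           := (p :* u :+ t :* v) :* (p :* u′ :+ t′ :* v′)) ≡.refl p t t′ u v u′ v′ ⟩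
    (p * u + t * v) * (p * u′ + t′ * v′)  ≈⟨ *-cong e e′ ⟩
    κ r * κ r′  ≈⟨ κ.*-homo r r′ ⟨
    κ (r R.* r′)  ∎)

  reaches-∏ : ∀ {p} d (t : ℕ → Carrier) r → (∀ j → Reaches p (t j) (r j)) → Reaches p (∏ d t) (R.∏ d r)
  reaches-∏ {p} zero t r e = 0# , 1# , trans (solve 1 (λ p → p :* con (+ 0) :+ :1 :* :1 := :1) ≡.refl p) (sym κ.1#-homo)
  reaches-∏ (suc d) t r e = reaches-* (reaches-∏ d t r e) (e d)

  s₀-pair : ∀ r → s₀ (pair (κ r) A) R.≈ R.- r
  s₀-pair r = R.trans (at₀.*-homo (1# + - (A * κ r)) (A + - κ r)) (R.trans
    (R.*-cong (R.trans (at₀.+-homo 1# (- (A * κ r))) (R.+-cong at₀.1#-homo (R.trans (at₀.-‿homo (A * κ r)) (R.-‿cong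
                (R.trans (at₀.*-homo A (κ r)) (R.*-congʳ S-poly.coeff₀-X))))))
              (R.trans (at₀.+-homo A (- κ r)) (R.+-cong S-poly.coeff₀-X (R.trans (at₀.-‿homo (κ r)) (R.-‿cong (S-poly.coeff₀-const r))))))
    (R.solve 2 (λ r t → (R.:1 R.:- R.con (+ 0) R.:* t) R.:* (R.con (+ 0) R.:- r) R.:= R.:- r) ≡.refl r (s₀ (κ r))))

  s₁-pair : ∀ r → s₁ (pair (κ r) A) R.≈ R.1# R.+ r R.* r
  s₁-pair r = R.trans (S-poly.coeff₁-cong expand) (R.trans (S-poly.coeff₁-+ (κ (R.- r)) (A * Y))
    (R.trans (R.+-cong (S-poly.coeff₁-const (R.- r)) (R.trans (S-poly.coeff₁-X-* Y) s₀Y)) (R.+-identityˡ _)))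
    where
    Y : Carrier
    Y = κ (R.1# R.+ r R.* r) + A * - κ r
    expand : pair (κ r) A ≈ κ (R.- r) + A * Y
    expand = begin
      pair (κ r) A  ≈⟨ solve 2 (λ a r → (:1 :- a :* r) :* (a :- r) := :- r :+ a :* ((:1 :+ r :* r) :+ a :* :- r)) ≡.refl A (κ r) ⟩
      - κ r + A * (1# + κ r * κ r + A * - κ r)  ≈⟨ +-cong (κ.-‿homo r) (*-congˡ (+-congʳ (trans (κ.+-homo R.1# (r R.* r)) (+-cong κ.1#-homo (κ.*-homo r r))))) ⟨
      κ (R.- r) + A * Y  ∎
    s₀Y : s₀ Y R.≈ R.1# R.+ r R.* r
    s₀Y = R.trans (at₀.+-homo (κ (R.1# R.+ r R.* r)) (A * - κ r)) (R.trans
      (R.+-cong (S-poly.coeff₀-const (R.1# R.+ r R.* r)) (R.trans (at₀.*-homo A (- κ r)) (R.trans (R.*-congʳ S-poly.coeff₀-X) (R.zeroˡ _))))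
      (R.+-identityʳ _))

  module _ (n₁ d : ℕ) (w : ℕ → ℕ) (w≢n : ∀ j → w j ≢ suc n₁) (E : R.Carrier) (E≉0 : ¬ E R.≈ R.0#)
           (u v : R.Carrier) (c₀ : Z.Carrier) (c₀≉0 : ¬ c₀ Z.≈ Z.0#)
           (bezout : E R.* u R.+ (R.[ suc n₁ ] x) R.* v R.≈ ζ c₀) where

    n : ℕ
    n = suc n₁

    [n] s : R.Carrier
    [n] = R.[ n ] x
    s = x R.^ n

    modulus denominator : Carrier
    modulus = κ [n] * pair (κ s) A
    denominator = κ E * ∏ d (λ j → pair (κ (x R.^ w j)) A)

    [n]≉0 : ¬ [n] R.≈ R.0#
    [n]≉0 e = 1-x^suc≉0 n₁ (R.trans (R.sym (R.1-x*[] n x)) (R.trans (R.*-congˡ e) (R.zeroʳ _)))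

    eliminant : R.Carrier
    eliminant = R.∏ d λ j → (x R.^ w j R.+ R.- s) R.* (R.1# R.+ R.- (s R.* x R.^ w j))

    eliminant≉0 : ¬ [n] R.* E R.* eliminant R.≈ R.0#
    eliminant≉0 = R-*-≉0 (R-*-≉0 [n]≉0 E≉0) (R-∏-≉0 d λ j _ → R-*-≉0 (x^-distinct (w≢n j))
      (λ e → 1-x^suc≉0 (n₁ ℕ.+ w j) (R.trans (R.+-congˡ (R.-‿cong (R.^-homo-* x n (w j)))) e)))

    -- An element free of `A` in the ideal of both polynomials forces every common divisor to be
    -- free of `A`.
    eliminate : Reaches modulus denominator ([n] R.* E R.* eliminant)
    eliminate = go (reaches-∏ d (λ j → pair (κ (x R.^ w j)) A) (λ j → (x R.^ w j R.+ R.- s) R.* (R.1# R.+ R.- (s R.* x R.^ w j)))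
                     (λ j → reaches-pair s (x R.^ w j)))
      where
      go : Reaches (pair (κ s) A) (∏ d (λ j → pair (κ (x R.^ w j)) A)) eliminant → Reaches modulus denominator ([n] R.* E R.* eliminant)
      go (u , v , e) = κ E * u , κ [n] * v , (begin
        κ [n] * p * (κ E * u) + κ E * t * (κ [n] * v)  ≈⟨ solve 6 (λ N p E u t v → N :* p :* (E :* u) :+ E :* t :* (N :* v) := N :* E :* (p :* u :+ t :* v)) ≡.refl (κ [n]) p (κ E) u t v ⟩
        κ [n] * κ E * (p * u + t * v)  ≈⟨ *-congˡ e ⟩
        κ [n] * κ E * κ eliminant  ≈⟨ trans (κ.*-homo ([n] R.* E) eliminant) (*-congʳ (κ.*-homo [n] E)) ⟨
        κ ([n] R.* E R.* eliminant)  ∎)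
        where
        p t : Carrier
        p = pair (κ s) A
        t = ∏ d (λ j → pair (κ (x R.^ w j)) A)

    -- At `A = 0` the linear factors of the denominator reduce to powers of `x` up to sign. As `c`
    -- has nonzero constant term, these powers can be stripped one `x` at a time.
    divides-E : ∀ k c z → ¬ r₀ c Z.≈ Z.0# → c R.* z R.≈ E R.* R.∏ k (λ j → R.- (x R.^ w j)) → ∃[ z′ ] c R.* z′ R.≈ E
    divides-E zero c z c₀≉0 e = z , R.trans e (R.*-identityʳ E)
    divides-E (suc k) c z c₀≉0 e = strip (w k) (R.- z) (R.trans (R.solve 2 (λ c z → c R.:* R.:- z R.:= R.:- (c R.:* z)) ≡.refl c z)
      (R.trans (R.-‿cong e) (R.solve 3 (λ E p y → R.:- (E R.:* (p R.:* R.:- y)) R.:= E R.:* p R.:* y) ≡.refl E (R.∏ k (λ j → R.- (x R.^ w j))) (x R.^ w k))))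
      where
      strip : ∀ m z → c R.* z R.≈ E R.* R.∏ k (λ j → R.- (x R.^ w j)) R.* x R.^ m → ∃[ z′ ] c R.* z′ R.≈ E
      strip zero z e = divides-E k c z c₀≉0 (R.trans e (R.*-identityʳ _))
      strip (suc m) z e = go (R-poly.cancel-X c z (E R.* R.∏ k (λ j → R.- (x R.^ w j)) R.* x R.^ m) c₀≉0
        (R.trans e (R.solve 3 (λ a x y → a R.:* (x R.:* y) R.:= a R.:* y R.:* x) ≡.refl (E R.* R.∏ k (λ j → R.- (x R.^ w j))) x (x R.^ m))))
        where
        go : (∃[ z′ ] c R.* z′ R.≈ E R.* R.∏ k (λ j → R.- (x R.^ w j)) R.* x R.^ m) → ∃[ z′ ] c R.* z′ R.≈ E
        go (z′ , e′) = strip m z′ e′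

    -- By `eliminate` the divisor is some `c` free of `A`. Comparing coefficients in `A`, it divides
    -- `[n]` and `E`, hence by the Bézout identity a nonzero integer constant, so it is itself a
    -- constant. Since `[n]` has constant term 1, that constant is a unit.
    common-divisor-unit : ∀ G Y T → G * Y ≈ modulus → G * T ≈ denominator → ∃[ V ] G * V ≈ 1#
    common-divisor-unit G Y T CY CT = κ (ζ y₁₀) , (begin
      G * κ (ζ y₁₀)  ≈⟨ *-cong G≈κc (refl {κ (ζ y₁₀)}) ⟩
      κ c * κ (ζ y₁₀)  ≈⟨ κ.*-homo c (ζ y₁₀) ⟨
      κ (c R.* ζ y₁₀)  ≈⟨ trans (κ.⟦⟧-cong (R.trans (R.*-congʳ c≈const) (R.trans (R.sym (Z-const.*-homo c₀₀ y₁₀)) (R.trans (Z-const.⟦⟧-cong c₀₀y₁₀≈1) Z-const.1#-homo)))) κ.1#-homo ⟩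
      1#  ∎)
      where
      reached : ∃[ W ] G * W ≈ κ ([n] R.* E R.* eliminant)
      reached = go eliminate
        where
        go : Reaches modulus denominator ([n] R.* E R.* eliminant) → ∃[ W ] G * W ≈ κ ([n] R.* E R.* eliminant)
        go (U , V , e) = Y * U + T * V , (begin
          G * (Y * U + T * V)  ≈⟨ solve 5 (λ G Y U T V → G :* (Y :* U :+ T :* V) := G :* Y :* U :+ G :* T :* V) ≡.refl G Y U T V ⟩
          G * Y * U + G * T * V  ≈⟨ +-cong (*-congʳ CY) (*-congʳ CT) ⟩
          modulus * U + denominator * V ≈⟨ e ⟩
          κ ([n] R.* E R.* eliminant) ∎)
      c : R.Carrier
      c = s₀ G
      G≈κc : G ≈ κ c
      G≈κc = S-poly.constant-factor eliminant≉0 (proj₂ reached)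
      κcY : κ c * Y ≈ modulus
      κcY = trans (*-congʳ (sym G≈κc)) CY
      cY₀ : c R.* s₀ Y R.≈ [n] R.* R.- s
      cY₀ = R.trans (R.sym (R.trans (at₀.*-homo (κ c) Y) (R.*-congʳ (S-poly.coeff₀-const c)))) (R.trans (at₀.⟦⟧-cong κcY)
        (R.trans (at₀.*-homo (κ [n]) (pair (κ s) A)) (R.*-cong (S-poly.coeff₀-const [n]) (s₀-pair s))))
      cY₁ : c R.* s₁ Y R.≈ [n] R.* (R.1# R.+ s R.* s)
      cY₁ = R.trans (R.sym (S-poly.coeff₁-const-* c Y)) (R.trans (S-poly.coeff₁-cong κcY)
        (R.trans (S-poly.coeff₁-const-* [n] (pair (κ s) A)) (R.*-congˡ (s₁-pair s))))
      c₀₀ y₁₀ : Z.Carrier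
      c₀₀ = r₀ c
      y₁₀ = r₀ (s₁ Y)
      r₀s : r₀ s Z.≈ Z.0#
      r₀s = Z.trans (at₀₀.*-homo x (x R.^ n₁)) (Z.trans (Z.*-congʳ R-poly.coeff₀-X) (Z.zeroˡ _))
      r₀[n] : r₀ [n] Z.≈ Z.1#
      r₀[n] = Z.trans (at₀₀.[]-homo n x) (Z.trans (Z.∑-cong n λ i _ → Z.^-congˡ i R-poly.coeff₀-X) (Z.trans (Z.[+] 1 n₁ Z.0#) (Z.solve 1 (λ y → (Z.con (+ 0) Z.:+ Z.:1) Z.:+ (Z.con (+ 0) Z.:* Z.:1) Z.:* y Z.:= Z.:1) ≡.refl (Z.[ n₁ ] Z.0#))))
      c₀₀y₁₀≈1 : c₀₀ Z.* y₁₀ Z.≈ Z.1#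
      c₀₀y₁₀≈1 = Z.trans (Z.sym (at₀₀.*-homo c (s₁ Y))) (Z.trans (at₀₀.⟦⟧-cong cY₁) (Z.trans (at₀₀.*-homo [n] (R.1# R.+ s R.* s))
        (Z.trans (Z.*-cong r₀[n] (Z.trans (at₀₀.+-homo R.1# (s R.* s)) (Z.+-cong at₀₀.1#-homo (Z.trans (at₀₀.*-homo s s) (Z.*-cong r₀s r₀s)))))
          (Z.solve 0 (Z.:1 Z.:* (Z.:1 Z.:+ Z.con (+ 0) Z.:* Z.con (+ 0)) Z.:= Z.:1) ≡.refl))))
      c₀₀≉0 : ¬ c₀₀ Z.≈ Z.0#
      c₀₀≉0 e = IsDomain.1≉0 Z-isDomain (Z.trans (Z.sym c₀₀y₁₀≈1) (Z.trans (Z.*-congʳ e) (Z.zeroˡ _)))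
      -- The two lowest coefficients of the modulus are `- s` and `1 + s²` times `[n]`, and
      -- `(1 + s²) + s (- s) = 1`.
      c∣[n] : c R.* (s₁ Y R.+ s R.* s₀ Y) R.≈ [n]
      c∣[n] = R.trans (R.solve 4 (λ c y₁ s y₀ → c R.:* (y₁ R.:+ s R.:* y₀) R.:= c R.:* y₁ R.:+ s R.:* (c R.:* y₀)) ≡.refl c (s₁ Y) s (s₀ Y))
        (R.trans (R.+-cong cY₁ (R.*-congˡ cY₀)) (R.solve 2 (λ N s → N R.:* (R.:1 R.:+ s R.:* s) R.:+ s R.:* (N R.:* R.:- s) R.:= N) ≡.refl [n] s))
      c∣E : ∃[ z ] c R.* z R.≈ E
      c∣E = divides-E d c (s₀ T) c₀₀≉0 (R.trans (R.sym (at₀.*-homo G T)) (R.trans (at₀.⟦⟧-cong CT)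
        (R.trans (at₀.*-homo (κ E) (∏ d (λ j → pair (κ (x R.^ w j)) A))) (R.*-cong (S-poly.coeff₀-const E)
          (R.trans (at₀.∏-homo d (λ j → pair (κ (x R.^ w j)) A)) (R.∏-cong d λ j _ → s₀-pair (x R.^ w j)))))))
      z : R.Carrier
      z = proj₁ c∣E
      c∣c₀ : c R.* (z R.* u R.+ (s₁ Y R.+ s R.* s₀ Y) R.* v) R.≈ ζ c₀
      c∣c₀ = R.trans (R.solve 5 (λ c z u y v → c R.:* (z R.:* u R.:+ y R.:* v) R.:= (c R.:* z) R.:* u R.:+ (c R.:* y) R.:* v) ≡.refl c z u (s₁ Y R.+ s R.* s₀ Y) v)
        (R.trans (R.+-cong (R.*-congʳ (proj₂ c∣E)) (R.*-congʳ c∣[n])) bezout)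
      c≈const : c R.≈ ζ c₀₀
      c≈const = R-poly.constant-factor c₀≉0 c∣c₀

-- The fractions of the theorem as elements of a field

open import Defs renaming (_≈_ to _≈ᴾ_)

module FractionValues (K : CommutativeRing 0ℓ 0ℓ) (isField : IsField K) (e : Poly → CommutativeRing.Carrier K)
  (a q : CommutativeRing.Carrier K)
  (e-A : CommutativeRing._≈_ K (e A) a)
  (e-Q : CommutativeRing._≈_ K (e Q) q)
  (e-⊕ : (P P′ : Poly) → CommutativeRing._≈_ K (e (P ⊕ P′)) (CommutativeRing._+_ K (e P) (e P′)))
  (e-⊛ : (P P′ : Poly) → CommutativeRing._≈_ K (e (P ⊛ P′)) (CommutativeRing._*_ K (e P) (e P′)))
  (e-⊖ : (P : Poly) → CommutativeRing._≈_ K (e (⊖ P)) (CommutativeRing.-_ K (e P)))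
  (e-𝟘 : CommutativeRing._≈_ K (e 𝟘) (CommutativeRing.0# K))
  (e-𝟙 : CommutativeRing._≈_ K (e 𝟙) (CommutativeRing.1# K))
  (q-free : NonTorsion K q) where

  open RingTools K
  open IsField isField

  open Summation K isField q q-free

  e-⊝ : ∀ P P′ → e (P ⊝ P′) ≈ e P + - e P′
  e-⊝ P P′ = trans (e-⊕ P (⊖ P′)) (+-congˡ (e-⊖ P′))

  e-^ᴾ : ∀ P k → e (P ^ᴾ k) ≈ e P ^ k
  e-^ᴾ P zero = e-𝟙
  e-^ᴾ P (suc k) = trans (e-⊛ P (P ^ᴾ k)) (*-congˡ (e-^ᴾ P k))

  e-Q^ : ∀ k → e (Q ^ᴾ k) ≈ q ^ k
  e-Q^ k = trans (e-^ᴾ Q k) (^-congˡ k e-Q)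

  e-qint : ∀ n → e (qint n) ≈ [ n ] q
  e-qint zero = e-𝟘
  e-qint (suc n) = begin
    e (𝟙 ⊕ (Q ⊛ qint n))  ≈⟨ trans (e-⊕ 𝟙 (Q ⊛ qint n)) (+-cong e-𝟙 (trans (e-⊛ Q (qint n)) (*-cong e-Q (e-qint n)))) ⟩
    1# + q * [ n ] q  ≈⟨ solve 2 (λ q y → :1 :+ q :* y := con (+ 0) :+ :1 :+ q :^ 1 :* y) ≡.refl q ([ n ] q) ⟩
    [ 1 ] q + q ^ 1 * [ n ] q ≈⟨ [+] 1 n q ⟨
    [ suc n ] q  ∎

  infix 4 _↦_
  -- Cross-multiplication follows the unreduced fractions of the statement through all operations;
  -- only division asks for a nonvanishing value.
  record _↦_ (F : Frac) (y : Carrier) : Set where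
    constructor maps
    field cross : e (num F) ≈ y * e (den F)

  ↦-resp : ∀ {F y y′} → y ≈ y′ → F ↦ y → F ↦ y′
  ↦-resp y≈y′ (maps c) = maps (trans c (*-congʳ y≈y′))

  ↦-poly : ∀ {P y} → e P ≈ y → poly P ↦ y
  ↦-poly c = maps (trans c (sym (trans (*-congˡ e-𝟙) (*-identityʳ _))))

  ↦-+ : ∀ {F G y z} → F ↦ y → G ↦ z → F +F G ↦ y + z
  ↦-+ {n₁ ⁄ d₁} {n₂ ⁄ d₂} {y} {z} (maps c) (maps c′) = maps (begin
    e ((n₁ ⊛ d₂) ⊕ (n₂ ⊛ d₁))  ≈⟨ trans (e-⊕ (n₁ ⊛ d₂) (n₂ ⊛ d₁)) (+-cong (e-⊛ n₁ d₂) (e-⊛ n₂ d₁)) ⟩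
    e n₁ * e d₂ + e n₂ * e d₁  ≈⟨ +-cong (*-congʳ c) (*-congʳ c′) ⟩
    y * e d₁ * e d₂ + z * e d₂ * e d₁  ≈⟨ solve 4 (λ y z a b → y :* a :* b :+ z :* b :* a := (y :+ z) :* (a :* b)) ≡.refl y z (e d₁) (e d₂) ⟩
    (y + z) * (e d₁ * e d₂)  ≈⟨ *-congˡ (e-⊛ d₁ d₂) ⟨
    (y + z) * e (d₁ ⊛ d₂)  ∎)

  ↦-- : ∀ {F G y z} → F ↦ y → G ↦ z → F -F G ↦ y + - z
  ↦-- {n₁ ⁄ d₁} {n₂ ⁄ d₂} {y} {z} (maps c) (maps c′) = maps (begin
    e ((n₁ ⊛ d₂) ⊝ (n₂ ⊛ d₁))  ≈⟨ trans (e-⊝ (n₁ ⊛ d₂) (n₂ ⊛ d₁)) (+-cong (e-⊛ n₁ d₂) (-‿cong (e-⊛ n₂ d₁))) ⟩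
    e n₁ * e d₂ + - (e n₂ * e d₁)  ≈⟨ +-cong (*-congʳ c) (-‿cong (*-congʳ c′)) ⟩
    y * e d₁ * e d₂ + - (z * e d₂ * e d₁)  ≈⟨ solve 4 (λ y z a b → y :* a :* b :- z :* b :* a := (y :- z) :* (a :* b)) ≡.refl y z (e d₁) (e d₂) ⟩
    (y + - z) * (e d₁ * e d₂)  ≈⟨ *-congˡ (e-⊛ d₁ d₂) ⟨
    (y + - z) * e (d₁ ⊛ d₂)  ∎)

  ↦-* : ∀ {F G y z} → F ↦ y → G ↦ z → F *F G ↦ y * z
  ↦-* {n₁ ⁄ d₁} {n₂ ⁄ d₂} {y} {z} (maps c) (maps c′) = maps (begin
    e (n₁ ⊛ n₂)  ≈⟨ trans (e-⊛ n₁ n₂) (*-cong c c′) ⟩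
    y * e d₁ * (z * e d₂)  ≈⟨ solve 4 (λ y z a b → y :* a :* (z :* b) := (y :* z) :* (a :* b)) ≡.refl y z (e d₁) (e d₂) ⟩
    y * z * (e d₁ * e d₂)  ≈⟨ *-congˡ (e-⊛ d₁ d₂) ⟨
    y * z * e (d₁ ⊛ d₂)  ∎)

  ↦-÷ : ∀ {F G y z} → ¬ z ≈ 0# → F ↦ y → G ↦ z → F ÷F G ↦ y * z ⁻¹
  ↦-÷ {n₁ ⁄ d₁} {n₂ ⁄ d₂} {y} {z} z≉0 (maps c) (maps c′) = maps (begin
    e (n₁ ⊛ d₂)  ≈⟨ trans (e-⊛ n₁ d₂) (*-congʳ c) ⟩
    y * e d₁ * e d₂  ≈⟨ solve 3 (λ y a b → y :* a :* b := y :* :1 :* a :* b) ≡.refl y (e d₁) (e d₂) ⟩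
    y * 1# * e d₁ * e d₂  ≈⟨ *-congʳ (*-congʳ (*-congˡ (inverseʳ z≉0))) ⟨
    y * (z * z ⁻¹) * e d₁ * e d₂  ≈⟨ solve 5 (λ y z i a b → y :* (z :* i) :* a :* b := y :* i :* (a :* (z :* b))) ≡.refl y z (z ⁻¹) (e d₁) (e d₂) ⟩
    y * z ⁻¹ * (e d₁ * (z * e d₂))  ≈⟨ *-congˡ (trans (e-⊛ d₁ n₂) (*-congˡ c′)) ⟨
    y * z ⁻¹ * e (d₁ ⊛ n₂)  ∎)

  ↦-1 : 1F ↦ 1#
  ↦-1 = ↦-poly e-𝟙

  ↦-^ : ∀ {F y} k → F ↦ y → F ^F k ↦ y ^ k
  ↦-^ zero F↦y = ↦-1
  ↦-^ (suc k) F↦y = ↦-* F↦y (↦-^ k F↦y)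

  ↦-poch : ∀ {F G y z} k → F ↦ y → G ↦ z → poch F G k ↦ ∏ k (λ i → 1# + - (y * z ^ i))
  ↦-poch zero F↦y G↦z = ↦-1
  ↦-poch (suc k) F↦y G↦z = ↦-* (↦-poch k F↦y G↦z) (↦-- ↦-1 (↦-* F↦y (↦-^ k G↦z)))

  ↦-sum : ∀ n {f : ℕ → Frac} {g : ℕ → Carrier} → (∀ k → f k ↦ g k) → sumF n f ↦ ∑ n g
  ↦-sum zero f↦g = ↦-poly e-𝟘
  ↦-sum (suc n) f↦g = ↦-+ (↦-sum n f↦g) (f↦g n)

  ∏-pairs : ∀ k (f : ℕ → Carrier) → ∏ (2 ℕ.* k) f ≈ ∏ k (λ i → f (2 ℕ.* i) * f (suc (2 ℕ.* i)))
  ∏-pairs zero f = refl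
  ∏-pairs (suc k) f = trans (reflexive (≡.cong (λ m → ∏ m f) (ℕ.*-suc 2 k)))
    (trans (*-assoc _ _ _) (*-congʳ (∏-pairs k f)))

  1-q*q^ : ∀ c d j → 1# + - (q ^ c * (q ^ d) ^ j) ≈ ⟨ c ℕ.+ d ℕ.* j ⟩
  1-q*q^ c d j = +-congˡ (-‿cong (trans (*-congˡ (^-assocʳ q d j)) (sym (^-homo-* q c (d ℕ.* j)))))

  module _ (a≉0 : ¬ a ≈ 0#) (denom≉0 : ∀ k → ¬ denom k a ≈ 0#) where

    -- The constant product `a ^ k` turns each factor `1 - q ^ s i / a` into `a - q ^ s i`.
    pair-product : ∀ k c d (s : ℕ → ℕ) → (∀ i → c ℕ.+ d ℕ.* i ≡ s i) →
      ∏ k (λ _ → a) * (∏ k (λ i → 1# + - (a * q ^ c * (q ^ d) ^ i)) * ∏ k (λ i → 1# + - (q ^ c * a ⁻¹ * (q ^ d) ^ i)))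
      ≈ ∏ k (λ i → root-pair (q ^ s i) a)
    pair-product k c d s s≡ = trans (*-congˡ (sym (∏-distrib-* k (λ i → 1# + - (a * q ^ c * (q ^ d) ^ i)) (λ i → 1# + - (q ^ c * a ⁻¹ * (q ^ d) ^ i)))))
      (trans (sym (∏-distrib-* k (λ _ → a) _)) (∏-cong k λ i _ → factor i))
      where
      factor : ∀ i → a * ((1# + - (a * q ^ c * (q ^ d) ^ i)) * (1# + - (q ^ c * a ⁻¹ * (q ^ d) ^ i))) ≈ root-pair (q ^ s i) a
      factor i = begin
        a * ((1# + - (a * q ^ c * (q ^ d) ^ i)) * (1# + - (q ^ c * a ⁻¹ * (q ^ d) ^ i)))
          ≈⟨ solve 4 (λ a b c d → a :* ((:1 :- a :* c :* d) :* (:1 :- c :* b :* d)) := (:1 :- a :* (c :* d)) :* (a :- c :* d :* (a :* b))) ≡.refl a (a ⁻¹) (q ^ c) ((q ^ d) ^ i) ⟩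
        (1# + - (a * (q ^ c * (q ^ d) ^ i))) * (a + - (q ^ c * (q ^ d) ^ i * (a * a ⁻¹)))
          ≈⟨ *-congˡ (+-congˡ (-‿cong (trans (*-congˡ (inverseʳ a≉0)) (*-identityʳ _)))) ⟩
        (1# + - (a * (q ^ c * (q ^ d) ^ i))) * (a + - (q ^ c * (q ^ d) ^ i))
          ≈⟨ *-cong (+-congˡ (-‿cong (*-congˡ qs))) (+-congˡ (-‿cong qs)) ⟩
        root-pair (q ^ s i) a ∎
        where
        qs : q ^ c * (q ^ d) ^ i ≈ q ^ s i
        qs = trans (*-congˡ (^-assocʳ q d i)) (trans (sym (^-homo-* q c (d ℕ.* i))) (^-congʳ q (s≡ i)))

    odd-product : ∀ k → ∏ (2 ℕ.* k) (λ i → 1# + - (q ^ 1 * (q ^ 2) ^ i)) ≈ odd-factors k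
    odd-product k = trans (∏-pairs k _) (∏-cong k λ i _ → *-cong (factor (2 ℕ.* i) (1 ℕ.+ 4 ℕ.* i) (even i)) (factor (suc (2 ℕ.* i)) (3 ℕ.+ 4 ℕ.* i) (odd i)))
      where
      factor : ∀ j m → 1 ℕ.+ 2 ℕ.* j ≡ m → 1# + - (q ^ 1 * (q ^ 2) ^ j) ≈ ⟨ m ⟩
      factor j m j≡m = trans (1-q*q^ 1 2 j) (reflexive (≡.cong ⟨_⟩ j≡m))
      even : ∀ i → 1 ℕ.+ 2 ℕ.* (2 ℕ.* i) ≡ 1 ℕ.+ 4 ℕ.* i
      even = ℕ-solve-∀
      odd : ∀ i → 1 ℕ.+ 2 ℕ.* suc (2 ℕ.* i) ≡ 3 ℕ.+ 4 ℕ.* i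
      odd = ℕ-solve-∀

    even-product : ∀ k → ∏ (2 ℕ.* k) (λ i → 1# + - (q ^ 2 * (q ^ 2) ^ i)) ≈ even-factors k
    even-product k = trans (∏-pairs k _) (∏-cong k λ i _ → *-cong (factor (2 ℕ.* i) (2 ℕ.+ 4 ℕ.* i) (even i)) (factor (suc (2 ℕ.* i)) (4 ℕ.+ 4 ℕ.* i) (odd i)))
      where
      factor : ∀ j m → 2 ℕ.+ 2 ℕ.* j ≡ m → 1# + - (q ^ 2 * (q ^ 2) ^ j) ≈ ⟨ m ⟩
      factor j m j≡m = trans (1-q*q^ 2 2 j) (reflexive (≡.cong ⟨_⟩ j≡m))
      even : ∀ i → 2 ℕ.+ 2 ℕ.* (2 ℕ.* i) ≡ 2 ℕ.+ 4 ℕ.* i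
      even = ℕ-solve-∀
      odd : ∀ i → 2 ℕ.+ 2 ℕ.* suc (2 ℕ.* i) ≡ 4 ℕ.+ 4 ℕ.* i
      odd = ℕ-solve-∀

    term5↦ : ∀ k → term5 k ↦ term k a
    term5↦ k = ↦-resp value (↦-* (↦-* (↦-÷ bottom≉0
        (↦-* (↦-* (↦-poch k (↦-* a↦ q↦) (q^↦ 2)) (↦-poch k (↦-÷ a≉0 q↦ a↦) (q^↦ 2))) (↦-poch (2 ℕ.* k) q↦ (q^↦ 2)))
        (↦-* (↦-* (↦-poch (2 ℕ.* k) (q^↦ 2) (q^↦ 2)) (↦-poch k (↦-* a↦ (q^↦ 6)) (q^↦ 6))) (↦-poch k (↦-÷ a≉0 (q^↦ 6) a↦) (q^↦ 6))))
      (↦-poly (e-qint (8 ℕ.* k ℕ.+ 1)))) (q^↦ (2 ℕ.* k ℕ.* k)))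
      where
      a↦ : aF ↦ a
      a↦ = ↦-poly e-A
      -- The exponent 1 is written out to match `pair-product` and `odd-product`, which expect
      -- powers of `q`.
      q↦ : qF ↦ q ^ 1
      q↦ = ↦-poly (trans e-Q (sym (*-identityʳ q)))
      q^↦ : ∀ j → qpowF j ↦ q ^ j
      q^↦ j = ↦-poly (e-Q^ j)
      P N₁ N₂ O E D₁ D₂ : Carrier
      P = ∏ k (λ _ → a)
      N₁ = ∏ k (λ i → 1# + - (a * q ^ 1 * (q ^ 2) ^ i))
      N₂ = ∏ k (λ i → 1# + - (q ^ 1 * a ⁻¹ * (q ^ 2) ^ i))
      O = ∏ (2 ℕ.* k) (λ i → 1# + - (q ^ 1 * (q ^ 2) ^ i))
      E = ∏ (2 ℕ.* k) (λ i → 1# + - (q ^ 2 * (q ^ 2) ^ i))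
      D₁ = ∏ k (λ i → 1# + - (a * q ^ 6 * (q ^ 6) ^ i))
      D₂ = ∏ k (λ i → 1# + - (q ^ 6 * a ⁻¹ * (q ^ 6) ^ i))
      numer≈ : P * (N₁ * N₂) ≈ numer k a
      numer≈ = pair-product k 1 2 (λ i → suc (2 ℕ.* i)) (λ i → ≡.refl)
      denom≈ : P * (D₁ * D₂) ≈ denom k a
      denom≈ = pair-product k 6 6 (λ i → 6 ℕ.* suc i) (λ i → ≡.sym (ℕ.*-suc 6 i))
      E≉0 : ¬ E ≈ 0#
      E≉0 E≈0 = even-factors≉0 k (trans (sym (even-product k)) E≈0)
      bottom≉0 : ¬ E * D₁ * D₂ ≈ 0#
      bottom≉0 e = *-≉0 E≉0 (λ D≈0 → denom≉0 k (trans (sym denom≈) (trans (*-congˡ D≈0) (zeroʳ _)))) (trans (sym (*-assoc E D₁ D₂)) e)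
      quotient : N₁ * N₂ * O * (E * D₁ * D₂) ⁻¹ ≈ odd-factors k * even-factors k ⁻¹ * (numer k a * denom k a ⁻¹)
      quotient = *-cancelˡ (*-≉0 (even-factors≉0 k) (denom≉0 k)) (begin
        even-factors k * denom k a * (N₁ * N₂ * O * (E * D₁ * D₂) ⁻¹)
          ≈⟨ *-congʳ (*-cong (sym (even-product k)) (sym denom≈)) ⟩
        E * (P * (D₁ * D₂)) * (N₁ * N₂ * O * (E * D₁ * D₂) ⁻¹)
          ≈⟨ solve 8 (λ E P D₁ D₂ N₁ N₂ O i → E :* (P :* (D₁ :* D₂)) :* (N₁ :* N₂ :* O :* i) := O :* (P :* (N₁ :* N₂)) :* (E :* D₁ :* D₂ :* i)) ≡.refl E P D₁ D₂ N₁ N₂ O ((E * D₁ * D₂) ⁻¹) ⟩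
        O * (P * (N₁ * N₂)) * (E * D₁ * D₂ * (E * D₁ * D₂) ⁻¹)
          ≈⟨ *-cong (*-cong (odd-product k) numer≈) (inverseʳ bottom≉0) ⟩
        odd-factors k * numer k a * 1#
          ≈⟨ solve 2 (λ o n → o :* n :* :1 := :1 :* :1 :* (o :* n)) ≡.refl (odd-factors k) (numer k a) ⟩
        1# * 1# * (odd-factors k * numer k a)
          ≈⟨ *-congʳ (*-cong (inverseʳ (even-factors≉0 k)) (inverseʳ (denom≉0 k))) ⟨
        even-factors k * even-factors k ⁻¹ * (denom k a * denom k a ⁻¹) * (odd-factors k * numer k a)
          ≈⟨ solve 6 (λ e i d j o n → e :* i :* (d :* j) :* (o :* n) := e :* d :* (o :* i :* (n :* j))) ≡.refl (even-factors k) (even-factors k ⁻¹) (denom k a) (denom k a ⁻¹) (odd-factors k) (numer k a) ⟩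
        even-factors k * denom k a * (odd-factors k * even-factors k ⁻¹ * (numer k a * denom k a ⁻¹)) ∎)
      bracket : [ 8 ℕ.* k ℕ.+ 1 ] q ≈ [8 k +1]
      bracket = *-cancelˡ (⟨suc⟩≉0 0) (begin
        ⟨ 1 ⟩ * [ 8 ℕ.* k ℕ.+ 1 ] q  ≈⟨ *-congʳ (+-congˡ (-‿cong (*-identityʳ q))) ⟩
        (1# + - q) * [ 8 ℕ.* k ℕ.+ 1 ] q  ≈⟨ 1-x*[] (8 ℕ.* k ℕ.+ 1) q ⟩
        ⟨ 8 ℕ.* k ℕ.+ 1 ⟩  ≈⟨ reflexive (≡.cong ⟨_⟩ (ℕ.+-comm (8 ℕ.* k) 1)) ⟩
        ⟨ suc (8 ℕ.* k) ⟩  ≈⟨ /-* (⟨suc⟩≉0 0) ⟨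
        [8 k +1] * ⟨ 1 ⟩  ≈⟨ *-comm _ _ ⟩
        ⟨ 1 ⟩ * [8 k +1]  ∎)
      value : N₁ * N₂ * O * (E * D₁ * D₂) ⁻¹ * [ 8 ℕ.* k ℕ.+ 1 ] q * q ^ (2 ℕ.* k ℕ.* k) ≈ term k a
      value = trans (*-congʳ (*-cong quotient bracket))
        (solve 6 (λ o i n j b p → o :* i :* (n :* j) :* b :* p := o :* i :* p :* b :* n :* j) ≡.refl
          (odd-factors k) (even-factors k ⁻¹) (numer k a) (denom k a ⁻¹) [8 k +1] (q ^ (2 ℕ.* k ℕ.* k)))

    lhs5↦ : ∀ n → lhs5 n ↦ ∑ n (λ k → term k a)
    lhs5↦ n = ↦-sum n term5↦

  rhs5↦ : ∀ n {r} → e (cst (jacobi-3 n)) * [ n ] q ≈ r * q ^ (n / 2) → rhs5 n ↦ r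
  rhs5↦ n {r} c = maps (begin
    e (cst (jacobi-3 n) ⊛ qint n)  ≈⟨ trans (e-⊛ (cst (jacobi-3 n)) (qint n)) (*-congˡ (e-qint n)) ⟩
    e (cst (jacobi-3 n)) * [ n ] q  ≈⟨ c ⟩
    r * q ^ (n / 2)  ≈⟨ *-congˡ (e-Q^ (n / 2)) ⟨
    r * e (Q ^ᴾ (n / 2))  ∎)

  e-modulus5 : ∀ n → e (modulus5 n) ≈ [ n ] q * root-pair (q ^ n) a
  e-modulus5 n = trans (e-⊛ (qint n) _) (*-cong (e-qint n) (trans (e-⊛ (𝟙 ⊝ (A ⊛ (Q ^ᴾ n))) (A ⊝ (Q ^ᴾ n)))
    (*-cong (trans (e-⊝ 𝟙 (A ⊛ (Q ^ᴾ n))) (+-cong e-𝟙 (-‿cong (trans (e-⊛ A (Q ^ᴾ n)) (*-cong e-A (e-Q^ n))))))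
            (trans (e-⊝ A (Q ^ᴾ n)) (+-cong e-A (-‿cong (e-Q^ n)))))))

-- From the localised congruence to the fractions of the statement

open import Data.Nat using (_<_)

fromℕ≡+ : ∀ n → RingTools.fromℕ ℤ.+-*-commutativeRing n ≡ + n
fromℕ≡+ 0 = ≡.refl
fromℕ≡+ 1 = ≡.refl
fromℕ≡+ (suc (suc n)) = ≡.cong (ℤ._+_ (+ 1)) (fromℕ≡+ (suc n))

fromℤ≡ : ∀ i → RingTools.fromℤ ℤ.+-*-commutativeRing i ≡ i
fromℤ≡ (+ n) = fromℕ≡+ n
fromℤ≡ -[1+ n ] = ≡.cong ℤ.-_ (fromℕ≡+ (suc n))

-- σ and τ are the identity in the only instance; keeping the rings abstract prevents the unfolding of polynomial arithmetic.
module Assembly {R S K : CommutativeRing 0ℓ 0ℓ} (R-isDomain : IsDomain R) (isField : IsField K)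
  {ζ : ℤ → CommutativeRing.Carrier R} {x : CommutativeRing.Carrier R}
  {r₀ r₁ : CommutativeRing.Carrier R → ℤ} (R-poly : IsPolynomialRing ℤ.+-*-commutativeRing R ζ x r₀ r₁)
  {κ : CommutativeRing.Carrier R → CommutativeRing.Carrier S} {y : CommutativeRing.Carrier S}
  {s₀ s₁ : CommutativeRing.Carrier S → CommutativeRing.Carrier R} (S-poly : IsPolynomialRing R S κ y s₀ s₁)
  {ι : CommutativeRing.Carrier S → CommutativeRing.Carrier K} (ι-hom : IsHom S K ι)
  (ι-injective : (s t : CommutativeRing.Carrier S) → CommutativeRing._≈_ K (ι s) (ι t) → CommutativeRing._≈_ S s t)
  (σ : Poly → CommutativeRing.Carrier S) (τ : CommutativeRing.Carrier S → Poly)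
  (σ-cong : (P P′ : Poly) → P ≈ᴾ P′ → CommutativeRing._≈_ S (σ P) (σ P′))
  (σ-reflect : (P P′ : Poly) → CommutativeRing._≈_ S (σ P) (σ P′) → P ≈ᴾ P′)
  (σ-τ : (s : CommutativeRing.Carrier S) → CommutativeRing._≈_ S (σ (τ s)) s)
  (σ-⊕ : (P P′ : Poly) → CommutativeRing._≈_ S (σ (P ⊕ P′)) (CommutativeRing._+_ S (σ P) (σ P′)))
  (σ-⊛ : (P P′ : Poly) → CommutativeRing._≈_ S (σ (P ⊛ P′)) (CommutativeRing._*_ S (σ P) (σ P′)))
  (σ-⊖ : (P : Poly) → CommutativeRing._≈_ S (σ (⊖ P)) (CommutativeRing.-_ S (σ P)))
  (σ-𝟘 : CommutativeRing._≈_ S (σ 𝟘) (CommutativeRing.0# S))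
  (σ-𝟙 : CommutativeRing._≈_ S (σ 𝟙) (CommutativeRing.1# S))
  (σ-A : CommutativeRing._≈_ S (σ A) y)
  (σ-Q : CommutativeRing._≈_ S (σ Q) (κ x))
  (σ-cst : (c : ℤ) → CommutativeRing._≈_ S (σ (cst c)) (κ (ζ c))) where

  private
    module R = RingTools R
    module S = RingTools S
    module S-poly = IsPolynomialRing S-poly
    module R-poly = IsPolynomialRing R-poly
    module ι = Homomorphism ι-hom
    module η = Homomorphism (∘-isHom S-poly.const-isHom ι-hom)
    module ζ = Homomorphism R-poly.const-isHom
    module coefficient = Homomorphism (∘-isHom R-poly.const-isHom (∘-isHom S-poly.const-isHom ι-hom))
  open RingTools K
  open IsField isField using (*-≉0; ∏-≉0)
  open Coprimality ℤ-isDomain R-isDomain R-poly S-poly using (pair; x^suc≉1; x≉0; s₀-pair; common-divisor-unit)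

  e : Poly → Carrier
  e = ι ∘ σ

  a q : Carrier
  a = ι y
  q = ι (κ x)

  e-⊛ : ∀ P P′ → e (P ⊛ P′) ≈ e P * e P′
  e-⊛ P P′ = trans (ι.⟦⟧-cong (σ-⊛ P P′)) (ι.*-homo (σ P) (σ P′))

  e-cst : ∀ c → e (cst c) ≈ fromℤ c
  e-cst c = trans (ι.⟦⟧-cong (σ-cst c)) (trans (reflexive (≡.cong (λ z → ι (κ (ζ z))) (≡.sym (fromℤ≡ c)))) (coefficient.fromℤ-homo c))

  e-reflect : ∀ P P′ → e P ≈ e P′ → P ≈ᴾ P′
  e-reflect P P′ eq = σ-reflect P P′ (ι-injective (σ P) (σ P′) eq)

  η-injective : ∀ r r′ → ι (κ r) ≈ ι (κ r′) → r R.≈ r′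
  η-injective r r′ eq = R.trans (R.sym (S-poly.coeff₀-const r))
    (R.trans (IsHom.⟦⟧-cong S-poly.coeff₀-isHom (ι-injective (κ r) (κ r′) eq)) (S-poly.coeff₀-const r′))

  q-free : ∀ j → ¬ (q ^ suc j ≈ 1# ⊎ q ≈ 0#)
  q-free j (inj₁ q^≈1) = x^suc≉1 j (η-injective (x R.^ suc j) R.1# (trans (η.^-homo x (suc j)) (trans q^≈1 (sym η.1#-homo))))
  q-free j (inj₂ q≈0) = x≉0 (η-injective x R.0# (trans q≈0 (sym η.0#-homo)))

  a≉0 : ¬ a ≈ 0#
  a≉0 a≈0 = IsDomain.1≉0 R-isDomain (R.trans (R.sym y₁) (R.trans
    (S-poly.coeff₁-cong (S.trans (ι-injective y S.0# (trans a≈0 (sym ι.0#-homo))) (S.sym (IsHom.0#-homo S-poly.const-isHom)))) (S-poly.coeff₁-const R.0#)))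
    where
    y₁ : s₁ y R.≈ R.1#
    y₁ = R.trans (S-poly.coeff₁-cong (S.sym (S.*-identityʳ y))) (R.trans (S-poly.coeff₁-X-* S.1#) (IsHom.1#-homo S-poly.coeff₀-isHom))

  open FractionValues K isField e a q (ι.⟦⟧-cong σ-A) (ι.⟦⟧-cong σ-Q)
    (λ P P′ → trans (ι.⟦⟧-cong (σ-⊕ P P′)) (ι.+-homo (σ P) (σ P′))) e-⊛ (λ P → trans (ι.⟦⟧-cong (σ-⊖ P)) (ι.-‿homo (σ P)))
    (trans (ι.⟦⟧-cong σ-𝟘) ι.0#-homo) (trans (ι.⟦⟧-cong σ-𝟙) ι.1#-homo) q-free
  open Summation K isField q q-free using (root-pair; denom; term)

  ι-pair : ∀ w → ι (pair (κ (x R.^ w)) y) ≈ root-pair (q ^ w) a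
  ι-pair w = trans (ι.*-homo (S.1# S.+ S.- (y S.* s)) (y S.+ S.- s))
    (*-cong (trans (ι.+-homo S.1# (S.- (y S.* s))) (+-cong ι.1#-homo (trans (ι.-‿homo (y S.* s)) (-‿cong (trans (ι.*-homo y s) (*-congˡ (η.^-homo x w)))))))
            (trans (ι.+-homo y (S.- s)) (+-congˡ (trans (ι.-‿homo s) (-‿cong (η.^-homo x w))))))
    where
    s : S.Carrier
    s = κ (x R.^ w)

  root-pair≉0 : ∀ w → ¬ root-pair (q ^ w) a ≈ 0#
  root-pair≉0 w eq = IsDomain.^-≉0 R-isDomain w x≉0 (R.trans (R.solve 1 (λ z → z R.:= R.:- R.:- z) ≡.refl (x R.^ w))
    (R.trans (R.-‿cong (R.trans (R.sym (s₀-pair (x R.^ w))) (R.trans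
        (IsHom.⟦⟧-cong S-poly.coeff₀-isHom (ι-injective (pair (κ (x R.^ w)) y) S.0# (trans (ι-pair w) (trans eq (sym ι.0#-homo)))))
        (IsHom.0#-homo S-poly.coeff₀-isHom))))
      (R.solve 0 (R.:- R.con (+ 0) R.:= R.con (+ 0)) ≡.refl)))

  denom≉0 : ∀ k → ¬ denom k a ≈ 0#
  denom≉0 k = ∏-≉0 k λ j _ → root-pair≉0 (6 ℕ.* suc j)

  module _ (i₀ : ℕ) (n⊥6 : Coprime (suc (2 ℕ.* i₀)) 6) (half : suc (2 ℕ.* i₀) / 2 ≡ i₀) where

    open Congruence S-poly.const-isHom ι-hom isField x q-free i₀ n⊥6
      using (d; InLoc; inLoc; congruence; sum; q^i₀*sum)
    open NodeValues S-poly.const-isHom ι-hom isField x q-free d n⊥6 using (n; node)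
    open Localisation S-poly.const-isHom ι-hom isField x q-free n (s≤s z≤n) using (Good; module Good)

    difference : Frac
    difference = lhs5 n -F rhs5 n

    δ : Carrier
    δ = sum a + - sum (node i₀)

    difference↦ : difference ↦ δ
    difference↦ = ↦-- (lhs5↦ a≉0 denom≉0 n) (rhs5↦ n (begin
      e (cst (jacobi-3 n)) * [ n ] q  ≈⟨ *-congʳ (trans (e-cst (jacobi-3 n)) (reflexive (≡.cong fromℤ (jacobi-3-χ n (s≤s z≤n) n⊥6)))) ⟩
      fromℤ (χ n) * [ n ] q  ≈⟨ q^i₀*sum ⟨
      q ^ i₀ * sum (node i₀)  ≈⟨ *-comm (q ^ i₀) (sum (node i₀)) ⟩
      sum (node i₀) * q ^ i₀  ≈⟨ *-congˡ (^-congʳ q (≡.sym half)) ⟩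
      sum (node i₀) * q ^ (n / 2)  ∎))

    -- The denominator accumulated by `lhs5 n` contains `1 - q^(2n)` once some `2k` reaches `n`, so
    -- it is not coprime with `[n]` in general. The fraction is therefore represented anew as
    -- `N / D`, with the modulus visible in `N` and `D` the good factor times the linear factors of
    -- `denom d`.
    assemble : InLoc ([ n ] q * root-pair (node i₀) a) (denom d a * δ) → CongMod (lhs5 n) (rhs5 n) (modulus5 n)
    assemble (inLoc {E} good-E s clear) = N , D
      , (λ D≈𝟘 → *-≉0 (Good.nonzero good-E) (denom≉0 d) (trans (sym e-D) (trans (ι.⟦⟧-cong (S.trans (σ-cong D 𝟘 D≈𝟘) σ-𝟘)) ι.0#-homo)))
      , e-reflect (N ⊛ den difference) (D ⊛ num difference) ND
      , (τ s , λ i j → ≡.refl)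
      , coprime
      where
      w : ℕ → ℕ
      w j = 6 ℕ.* suc j
      D′ : S.Carrier
      D′ = κ E S.* S.∏ d (λ j → pair (κ (x R.^ w j)) y)
      N D : Poly
      N = modulus5 n ⊛ τ s
      D = τ D′
      e-D : e D ≈ ι (κ E) * denom d a
      e-D = trans (ι.⟦⟧-cong (σ-τ D′)) (trans (ι.*-homo (κ E) _) (*-congˡ (trans (ι.∏-homo d _) (∏-cong d λ j _ → ι-pair (w j)))))
      ND : e (N ⊛ den difference) ≈ e (D ⊛ num difference)
      ND = begin
        e (N ⊛ den difference)
          ≈⟨ trans (e-⊛ N (den difference)) (*-congʳ (trans (e-⊛ (modulus5 n) (τ s)) (*-cong (e-modulus5 n) (ι.⟦⟧-cong (σ-τ s))))) ⟩
        [ n ] q * root-pair (q ^ n) a * ι s * e (den difference)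
          ≈⟨ *-congʳ clear ⟨
        ι (κ E) * (denom d a * δ) * e (den difference)
          ≈⟨ solve 4 (λ E D x y → E :* (D :* x) :* y := E :* D :* (x :* y)) ≡.refl (ι (κ E)) (denom d a) δ (e (den difference)) ⟩
        ι (κ E) * denom d a * (δ * e (den difference))
          ≈⟨ *-cong e-D (_↦_.cross difference↦) ⟨
        e D * e (num difference)
          ≈⟨ e-⊛ D (num difference) ⟨
        e (D ⊛ num difference) ∎
      c₀ : ℤ
      c₀ = RingTools.fromℕ ℤ.+-*-commutativeRing (suc (Good.c good-E))
      c₀≢0 : c₀ ≢ + 0
      c₀≢0 c₀≡0 with ≡.trans (≡.sym (fromℕ≡+ (suc (Good.c good-E)))) c₀≡0
      ... | ()
      E≉0 : ¬ E R.≈ R.0#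
      E≉0 E≈0 = Good.nonzero good-E (trans (η.⟦⟧-cong E≈0) η.0#-homo)
      modulus≈ : σ (modulus5 n) S.≈ κ (R.[ n ] x) S.* pair (κ (x R.^ n)) y
      modulus≈ = ι-injective (σ (modulus5 n)) _ (trans (e-modulus5 n) (sym (trans (ι.*-homo (κ (R.[ n ] x)) _) (*-cong (η.[]-homo n x) (ι-pair n)))))
      coprime : CoprimeᴾP (modulus5 n) D
      coprime B (Y , BY) (T , BT) = τ (proj₁ unit)
        , σ-reflect (B ⊛ τ (proj₁ unit)) 𝟙 (S.trans (σ-⊛ B (τ (proj₁ unit))) (S.trans (S.*-congˡ (σ-τ (proj₁ unit))) (S.trans (proj₂ unit) (S.sym σ-𝟙))))
        where
        unit : ∃[ V ] σ B S.* V S.≈ S.1#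
        -- Parity separates the exponents `6 (j + 1)` of `D` from the odd `n`, and `c₀` is the
        -- positive integer of the Bézout identity.
        unit = common-divisor-unit (2 ℕ.* i₀) d w (λ j w≡n → odd≢6* i₀ (suc j) (≡.sym w≡n)) E E≉0 (Good.u good-E) (Good.v good-E)
          c₀ c₀≢0 (R.trans (Good.bezout good-E) (R.sym (ζ.fromℕ-homo (suc (Good.c good-E))))) (σ B) (σ Y) (σ T)
          (S.trans (S.sym (σ-⊛ B Y)) (S.trans (σ-cong (B ⊛ Y) (modulus5 n) BY) modulus≈))
          (S.trans (S.sym (σ-⊛ B T)) (S.trans (σ-cong (B ⊛ T) D BT) (σ-τ D′)))

    theorem5-odd : CongMod (lhs5 n) (rhs5 n) (modulus5 n)
    theorem5-odd = assemble (congruence (y , refl) denom≉0)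

-- The instance: polynomials in `a` over ℤ[q]

module Concrete where

  module P₁ = Polynomials ℤ.+-*-commutativeRing
  R : CommutativeRing 0ℓ 0ℓ
  R = P₁.polynomialRing
  R-isDomain : IsDomain R
  R-isDomain = P₁.polynomialDomain ℤ-isDomain
  module P₂ = Polynomials R
  S : CommutativeRing 0ℓ 0ℓ
  S = P₂.polynomialRing
  S-isDomain : IsDomain S
  S-isDomain = P₂.polynomialDomain R-isDomain
  module F = FieldOfFractions S S-isDomain
  K : CommutativeRing 0ℓ 0ℓ
  K = F.fractionRing

  private
    module S = CommutativeRing S

  add1≡add : ∀ p r → add1 p r ≡ P₁.add p r
  add1≡add [] r = ≡.refl
  add1≡add (x ∷ p) [] = ≡.refl
  add1≡add (x ∷ p) (y ∷ r) = ≡.cong (x ℤ.+ y ∷_) (add1≡add p r)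

  mul1≡mul : ∀ p r → mul1 p r ≡ P₁.mul p r
  mul1≡mul [] r = ≡.refl
  mul1≡mul (x ∷ p) r = ≡.trans (add1≡add (map (x ℤ.*_) r) (+ 0 ∷ mul1 p r)) (≡.cong (λ s → P₁.add (map (x ℤ.*_) r) (+ 0 ∷ s)) (mul1≡mul p r))

  ⊕≡add : ∀ P P′ → P ⊕ P′ ≡ P₂.add P P′
  ⊕≡add [] P′ = ≡.refl
  ⊕≡add (p ∷ P) [] = ≡.refl
  ⊕≡add (p ∷ P) (r ∷ P′) = ≡.cong₂ _∷_ (add1≡add p r) (⊕≡add P P′)

  ⊛≡mul : ∀ P P′ → P ⊛ P′ ≡ P₂.mul P P′
  ⊛≡mul [] P′ = ≡.refl
  ⊛≡mul (p ∷ P) P′ = ≡.trans (⊕≡add (map (mul1 p) P′) ([] ∷ (P ⊛ P′)))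
    (≡.cong₂ (λ s t → P₂.add s ([] ∷ t)) (List.map-cong (mul1≡mul p) P′) (⊛≡mul P P′))

  coeff1≡! : ∀ p j → coeff1 p j ≡ p P₁.! j
  coeff1≡! [] j = ≡.refl
  coeff1≡! (x ∷ p) zero = ≡.refl
  coeff1≡! (x ∷ p) (suc j) = coeff1≡! p j

  coeff≡! : ∀ P i j → coeff P i j ≡ (P P₂.! i) P₁.! j
  coeff≡! [] i j = ≡.refl
  coeff≡! (p ∷ P) zero j = coeff1≡! p j
  coeff≡! (p ∷ P) (suc i) j = coeff≡! P i j

  ≈ᴾ⇒≋ : ∀ {P P′} → P ≈ᴾ P′ → P S.≈ P′
  ≈ᴾ⇒≋ {P} {P′} P≈P′ = P₂.coeffwise λ i → P₁.coeffwise λ j → ≡.trans (≡.sym (coeff≡! P i j)) (≡.trans (P≈P′ i j) (coeff≡! P′ i j))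

  ≋⇒≈ᴾ : ∀ {P P′} → P S.≈ P′ → P ≈ᴾ P′
  ≋⇒≈ᴾ {P} {P′} P≋P′ i j = ≡.trans (coeff≡! P i j) (≡.trans ((P≋P′ P₂.!≈ i) P₁.!≈ j) (≡.sym (coeff≡! P′ i j)))

  open Assembly R-isDomain F.fractionField
    (polynomialRing-isPolynomialRing ℤ.+-*-commutativeRing ℤ-isDomain)
    (polynomialRing-isPolynomialRing R R-isDomain)
    F.embed-isHom (λ s t → F.embed-injective) (λ P → P) (λ s → s)
    (λ P P′ → ≈ᴾ⇒≋) (λ P P′ → ≋⇒≈ᴾ {P} {P′}) (λ s → P₂.≋-refl)
    (λ P P′ → S.reflexive (⊕≡add P P′)) (λ P P′ → S.reflexive (⊛≡mul P P′)) (λ P → P₂.≋-refl)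
    P₂.≋-refl P₂.≋-refl P₂.≋-refl P₂.≋-refl (λ c → P₂.≋-refl)
    using (theorem5-odd) public

theorem5 : (n : ℕ) → 0 < n → Coprime n 6 → CongMod (lhs5 n) (rhs5 n) (modulus5 n)
theorem5 n 0<n n⊥6 = go (n % 2) (n / 2) (m≡m%n+[m/n]*n n 2) (m%n<n n 2) ≡.refl
  where
  go : ∀ r i → n ≡ r ℕ.+ i ℕ.* 2 → r ℕ.< 2 → n / 2 ≡ i → CongMod (lhs5 n) (rhs5 n) (modulus5 n)
  go 0 i n≡2i _ _ with n⊥6 {2} (divides i n≡2i , divides 3 ≡.refl)
  ... | ()
  go 1 i n≡1+2i _ half = odd (≡.trans n≡1+2i (≡.cong suc (ℕ.*-comm i 2))) n⊥6 half
    where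
    -- Generalising `n` to a variable `m` lets the equation be matched with `≡.refl`, which carries
    -- the value of `n / 2` along.
    odd : ∀ {m} → m ≡ suc (2 ℕ.* i) → Coprime m 6 → m / 2 ≡ i → CongMod (lhs5 m) (rhs5 m) (modulus5 m)
    odd ≡.refl m⊥6 half = Concrete.theorem5-odd i m⊥6 half
  go (suc (suc r)) i _ (s≤s (s≤s ())) _
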